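{- Fix an integer $d>1$. Let $P$ be a $d$-dimensional $2$-level polytope that is not affinely isomorphic to the $d$-dimensional cube or to the $d$-dimensional cross-polytope. Then \[ f_0(P)\cdot f_{d-1}(P)\le (d-1)\,2^{d+1}+8(d-1). \]
   Context: A polytope $P$ is called $2$-level if for every facet-defining hyperplane $H$ of $P$ there is a hyperplane $H'$ parallel to $H$ such that $H\cup H'$ contains all vertices of $P$. For a $d$-dimensional polytope $P$, $f_0(P)$ denotes its number of vertices and $f_{d-1}(P)$ its number of facets.
   Formalization: The polytope's vertices, its facet-defining hyperplanes and the affine isomorphisms are taken over the rationals instead of the reals; that every 2-level polytope is affinely isomorphic to one with 0/1 vertices is not part of the formal statement. -}

module Defs where

open import Data.Nat using (ℕ; zero; suc)
open import Data.Bool using (Bool; true; false; if_then_else_)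
open import Data.Fin using (Fin; zero; suc; _≟_)
open import Data.Fin.Subset using (Subset; _∈_)
open import Data.Rational using (ℚ; 0ℚ; 1ℚ; _+_; _*_; -_; _≤_; _<_)
open import Data.Product using (Σ; ∃; ∃-syntax; _×_; _,_)
open import Data.Sum using (_⊎_)
open import Data.List using (List; length)
open import Data.List.Relation.Unary.Unique.Propositional using (Unique)
import Data.List.Membership.Propositional as LM
open import Relation.Nullary using (¬_; does)
open import Relation.Binary.PropositionalEquality using (_≡_)
open import Function.Bundles using (_⇔_)

Point : ℕ → Set
Point d = Fin d → ℚ

∑ : {n : ℕ} → (Fin n → ℚ) → ℚ
∑ {zero}  f = 0ℚ
∑ {suc n} f = f zero + ∑ (λ i → f (suc i))

lincomb : {n d : ℕ} → (Fin n → ℚ) → (Fin n → Point d) → Point d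
lincomb c V j = ∑ (λ i → c i * V i j)

_·_ : {d : ℕ} → Point d → Point d → ℚ
a · x = ∑ (λ j → a j * x j)

_≐_ : {d : ℕ} → Point d → Point d → Set
x ≐ y = ∀ j → x j ≡ y j

-- A polytope P ⊆ ℚ^d is described by its vertex list V : Fin n → Point d,
-- P = conv {V i}.  V lists the vertices: they are pairwise distinct and
-- in convex position (no V i is a convex combination of the others).

Distinct : {n d : ℕ} → (Fin n → Point d) → Set
Distinct V = ∀ i j → V i ≐ V j → i ≡ j

ConvexPosition : {n d : ℕ} → (Fin n → Point d) → Set
ConvexPosition {n} V = ∀ i → ¬ (Σ (Fin n → ℚ) λ c →
  (∀ k → 0ℚ ≤ c k) × (c i ≡ 0ℚ) × (∑ c ≡ 1ℚ) × (lincomb c V ≐ V i))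

AffinelyIndependent : {m d : ℕ} → (Fin m → Point d) → Set
AffinelyIndependent {m} W = ∀ (c : Fin m → ℚ) → ∑ c ≡ 0ℚ →
  (∀ j → lincomb c W j ≡ 0ℚ) → ∀ i → c i ≡ 0ℚ

FullDim : {n d : ℕ} → (Fin n → Point d) → Set
FullDim {n} {d} V = Σ (Fin (suc d) → Fin n) λ s → AffinelyIndependent (λ k → V (s k))

IsFacetIneq : {n d : ℕ} → (Fin n → Point d) → Point d → ℚ → Set
IsFacetIneq {n} {d} V a b =
  (∀ i → a · V i ≤ b) ×
  (∃[ i ] (a · V i < b)) ×
  (Σ (Fin d → Fin n) λ s → (∀ k → a · V (s k) ≡ b) × AffinelyIndependent (λ k → V (s k)))

TwoLevel : {n d : ℕ} → (Fin n → Point d) → Set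
TwoLevel V = ∀ a b → IsFacetIneq V a b →
  ∃[ b' ] (∀ i → (a · V i ≡ b) ⊎ (a · V i ≡ b'))

IsFacet : {n d : ℕ} → (Fin n → Point d) → Subset n → Set
IsFacet V F = ∃[ a ] ∃[ b ] (IsFacetIneq V a b × (∀ i → (i ∈ F) ⇔ (a · V i ≡ b)))

-- f_{d-1}(P) = k : the facets (identified with their vertex sets) are
-- exactly the entries of a duplicate-free list of length k.
NumFacets : {n d : ℕ} → (Fin n → Point d) → ℕ → Set
NumFacets {n} V k = Σ (List (Subset n)) λ L →
  Unique L × (∀ F → IsFacet V F ⇔ (F LM.∈ L)) × (length L ≡ k)

Matrix : ℕ → Set
Matrix d = Fin d → Fin d → ℚ

apply : {d : ℕ} → Matrix d → Point d → Point d
apply A x i = ∑ (λ j → A i j * x j)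

mmul : {d : ℕ} → Matrix d → Matrix d → Matrix d
mmul A B i k = ∑ (λ j → A i j * B j k)

idM : {d : ℕ} → Matrix d
idM i j = if does (i ≟ j) then 1ℚ else 0ℚ

Invertible : {d : ℕ} → Matrix d → Set
Invertible {d} A = Σ (Matrix d) λ B →
  (∀ i j → mmul A B i j ≡ idM i j) × (∀ i j → mmul B A i j ≡ idM i j)

affine : {d : ℕ} → Matrix d → Point d → Point d → Point d
affine A t x i = apply A x i + t i

cubeVertex : {d : ℕ} → (Fin d → Bool) → Point d
cubeVertex w j = if w j then 1ℚ else 0ℚ

crossVertex : {d : ℕ} → Fin d → Bool → Point d
crossVertex k s j = if does (j ≟ k) then (if s then 1ℚ else - 1ℚ) else 0ℚ

IsoCube : {n d : ℕ} → (Fin n → Point d) → Set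
IsoCube {n} {d} V = Σ (Matrix d) λ A → Σ (Point d) λ t → Invertible A ×
  (∀ i → ∃[ w ] (affine A t (V i) ≐ cubeVertex w)) ×
  (∀ w → ∃[ i ] (affine A t (V i) ≐ cubeVertex w))

IsoCross : {n d : ℕ} → (Fin n → Point d) → Set
IsoCross {n} {d} V = Σ (Matrix d) λ A → Σ (Point d) λ t → Invertible A ×
  (∀ i → ∃[ k ] ∃[ s ] (affine A t (V i) ≐ crossVertex k s)) ×
  (∀ k s → ∃[ i ] (affine A t (V i) ≐ crossVertex k s))

{-# OPTIONS --safe #-}
-- Homogenise, so that affine functions become linear functionals, and let β(A) be the number of functionals with values in
-- {0,1} on the vertex set A of a d-dimensional 2-level polytope. Split A along a facet into the facet A₀ (p points) and the
-- opposite face A₁ (q ≤ p points). If v of the functionals vanish on A₁ and c are not constant on A₁, then β(A) = 2v + c, by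
-- restriction v + c ≤ β(A₀), by dimension qv ≤ 2^d, and (p+q)(2v+c) = 2p(v+c) + 2qv - (p-q)c. This is the induction of Kupavskii
-- and Weltge for |A| β(A) ≤ (d+1) 2^(d+1). If the facet has the largest possible number of vertices and the near-equality cases
-- are examined, it gives the sharper alternative: |A| ≤ d+1, or β(A) ≤ 2(d+1), or |A| β(A) ≤ d (2^(d+1) + 4).
--
-- If no two facets are parallel, then the number k of facets satisfies 2k ≤ β(A), which suffices. Otherwise let F be the larger of
-- two parallel facets: all facets restrict injectively to F, so |A| k ≤ 2 |F| β(F), and the third alternative for F is the claim.
-- If β(F) ≤ 2d, then A is a cube. If |F| = d, then A consists of two simplices; either at most three quarters of the 2^d patterns
-- of values on F come from facets, or every facet functional is 1/2 at the centroid of A and A is a cross-polytope.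

module Submission where

open import Defs
open import Data.Nat using (ℕ; zero; suc; _+_; _*_; _∸_; _^_; _≤_; _<_; z≤n; s≤s)
import Data.Nat.Properties as ℕ
import Data.Nat.Tactic.RingSolver as ℕSolver
open import Data.Rational using (ℚ; 0ℚ; 1ℚ) renaming (_+_ to _+ℚ_; _*_ to _*ℚ_; -_ to -ℚ_; _≤_ to _≤ℚ_; _<_ to _<ℚ_)
import Data.Rational as ℚ
import Data.Rational.Properties as ℚ
open import Data.Bool using (Bool; true; false; not; if_then_else_)
import Data.Bool.Properties as Bool
open import Data.Empty using (⊥; ⊥-elim)
open import Data.Unit using (⊤; tt)
open import Data.Maybe using (Maybe; just; nothing)
open import Data.Product using (Σ; _×_; _,_; proj₁; proj₂)
open import Data.Sum using (_⊎_; inj₁; inj₂)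
open import Data.Fin using (Fin; zero; suc)
import Data.Fin.Properties as Fin
import Data.Fin.Subset as Sub
import Data.Fin.Subset.Properties as Sub
open import Data.Vec using (Vec; []; _∷_; lookup; updateAt)
import Data.Vec as Vec
import Data.Vec.Properties as Vec
open import Data.Vec.Relation.Unary.All using ([]; _∷_) renaming (All to AllV)
import Data.Vec.Relation.Unary.All as AllV
import Data.Vec.Relation.Unary.All.Properties as AllV
open import Data.List using (List; []; _∷_; length; filter; _++_)
import Data.List as List
import Data.List.Properties as List
open import Data.List.Membership.Propositional using (_∈_; find; lose)
open import Data.List.Membership.Propositional.Properties using (∈-∃++; ∈-++⁻; ∈-++⁺ˡ; ∈-++⁺ʳ; ∈-filter⁺; ∈-filter⁻; ∈-map⁺; ∈-map⁻; ∈-tabulate⁺; ∈-tabulate⁻)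
open import Data.List.Relation.Unary.Any using (Any; here; there; any?)
open import Data.List.Relation.Unary.All using (All; []; _∷_; all?)
import Data.List.Relation.Unary.All as All
import Data.List.Relation.Unary.All.Properties as All
open import Data.List.Relation.Unary.AllPairs using (AllPairs; []; _∷_)
import Data.List.Relation.Unary.AllPairs as AllPairs
import Data.List.Relation.Unary.AllPairs.Properties as AllPairs
open import Data.List.Relation.Unary.Unique.Propositional using (Unique)
import Data.List.Relation.Unary.Unique.Propositional.Properties as Unique
open import Function using (_∘_; id; case_of_)
open import Function.Bundles using (mk⇔; Equivalence)
open import Relation.Nullary using (¬_; Dec; yes; no; does; ¬?; contradiction)
open import Relation.Nullary.Decidable using (_⊎-dec_; _×-dec_; decidable-stable; dec-true; dec-false)
open import Relation.Unary using (Decidable)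
open import Relation.Binary.Definitions using (tri<; tri≈; tri>)
open import Relation.Binary.PropositionalEquality
open import Tactic.RingSolver using (solve-∀)
open import Tactic.RingSolver.Core.AlmostCommutativeRing using (AlmostCommutativeRing; fromCommutativeRing)

-- The constants are values at examples. In dimension d the simplex and the cube have |A| β(A) =
-- (d+1) 2^(d+1); the first two alternatives set them apart, and d (2^(d+1) + 4) = 2d (2^d + 2) is
-- the value at the cross-polytope. The bound of the theorem, 4(d-1) (2^(d-1) + 2), is the product
-- for the prism over a (d-1)-dimensional cross-polytope. The quarter gained in the near-equality
-- cases always comes from one count: four predicates of equal size that never hold together have
-- density at most 3/4. An affine function of bits that depends on two of them leaves {0,1}
-- somewhere on each square in these two directions. This serves points coded by functionals as well
-- as functionals coded by points. An obstacle is that two-levelness speaks of facets only, so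
-- facets have to be produced: a nonnegative functional is rotated about its zeros while its value
-- at one point of the span of A is kept. That this point may lie outside A is what allows a missing
-- vertex of a cube to be cut off.

zeroℚ? : (x : ℚ) → Maybe (0ℚ ≡ x)
zeroℚ? x with 0ℚ ℚ.≟ x
... | yes p = just p
... | no _ = nothing

ℚ-ring : AlmostCommutativeRing _ _
ℚ-ring = fromCommutativeRing ℚ.+-*-commutativeRing zeroℚ?

opaque
  inverse : (x : ℚ) → x ≢ 0ℚ → Σ ℚ λ r → r *ℚ x ≡ 1ℚ
  inverse x x≢0 = (ℚ.1/ x) {{ℚ.≢-nonZero x≢0}} , ℚ.*-inverseˡ x {{ℚ.≢-nonZero x≢0}}

-- Vectors and functionals over ℚ

infixl 6 _⊕_
infixr 7 _•_
infix 8 _∙_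

0v : ∀ {M} → Vec ℚ M
0v = Vec.replicate _ 0ℚ

_≟v_ : ∀ {M} (x y : Vec ℚ M) → Dec (x ≡ y)
_≟v_ = Vec.≡-dec ℚ._≟_

opaque

  _⊕_ : ∀ {M} → Vec ℚ M → Vec ℚ M → Vec ℚ M
  _⊕_ = Vec.zipWith _+ℚ_

  _•_ : ∀ {M} → ℚ → Vec ℚ M → Vec ℚ M
  c • x = Vec.map (c *ℚ_) x

  _∙_ : ∀ {M} → Vec ℚ M → Vec ℚ M → ℚ
  [] ∙ [] = 0ℚ
  (x ∷ xs) ∙ (y ∷ ys) = x *ℚ y +ℚ xs ∙ ys

  ∙-∷ : ∀ {M} x (xs : Vec ℚ M) y ys → (x ∷ xs) ∙ (y ∷ ys) ≡ x *ℚ y +ℚ xs ∙ ys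
  ∙-∷ x xs y ys = refl

  ∙-comm : ∀ {M} (x y : Vec ℚ M) → x ∙ y ≡ y ∙ x
  ∙-comm [] [] = refl
  ∙-comm (x ∷ xs) (y ∷ ys) = cong₂ _+ℚ_ (ℚ.*-comm x y) (∙-comm xs ys)

  ∙-zeroʳ : ∀ {M} (f : Vec ℚ M) → f ∙ 0v ≡ 0ℚ
  ∙-zeroʳ [] = refl
  ∙-zeroʳ (x ∷ f) rewrite ∙-zeroʳ f = lemma x
    where
    lemma : ∀ x → x *ℚ 0ℚ +ℚ 0ℚ ≡ 0ℚ
    lemma = solve-∀ ℚ-ring

  ∙-zeroˡ : ∀ {M} (x : Vec ℚ M) → 0v ∙ x ≡ 0ℚ
  ∙-zeroˡ x = trans (∙-comm 0v x) (∙-zeroʳ x)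

  ∙-linʳ : ∀ {M} (f x : Vec ℚ M) c y → f ∙ (x ⊕ c • y) ≡ f ∙ x +ℚ c *ℚ f ∙ y
  ∙-linʳ [] [] c [] = lemma c
    where
    lemma : ∀ c → 0ℚ ≡ 0ℚ +ℚ c *ℚ 0ℚ
    lemma = solve-∀ ℚ-ring
  ∙-linʳ (f ∷ fs) (x ∷ xs) c (y ∷ ys) rewrite ∙-linʳ fs xs c ys = lemma f x c y (fs ∙ xs) (fs ∙ ys)
    where
    lemma : ∀ f x c y a b →
      f *ℚ (x +ℚ c *ℚ y) +ℚ (a +ℚ c *ℚ b) ≡ (f *ℚ x +ℚ a) +ℚ c *ℚ (f *ℚ y +ℚ b)
    lemma = solve-∀ ℚ-ring

  ∙-linˡ : ∀ {M} (f : Vec ℚ M) c g x → (f ⊕ c • g) ∙ x ≡ f ∙ x +ℚ c *ℚ g ∙ x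
  ∙-linˡ f c g x = trans (∙-comm (f ⊕ c • g) x)
    (trans (∙-linʳ x f c g) (cong₂ (λ a b → a +ℚ c *ℚ b) (∙-comm x f) (∙-comm x g)))

  ∙-scaleʳ : ∀ {M} (f : Vec ℚ M) c x → f ∙ (c • x) ≡ c *ℚ f ∙ x
  ∙-scaleʳ [] c [] = sym (ℚ.*-zeroʳ c)
  ∙-scaleʳ (f ∷ fs) c (x ∷ xs) rewrite ∙-scaleʳ fs c xs = lemma f c x (fs ∙ xs)
    where
    lemma : ∀ f c x a → f *ℚ (c *ℚ x) +ℚ c *ℚ a ≡ c *ℚ (f *ℚ x +ℚ a)
    lemma = solve-∀ ℚ-ring

  ∙-scaleˡ : ∀ {M} c (f x : Vec ℚ M) → (c • f) ∙ x ≡ c *ℚ f ∙ x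
  ∙-scaleˡ c f x = trans (∙-comm (c • f) x) (trans (∙-scaleʳ x c f) (cong (c *ℚ_) (∙-comm x f)))

  ∙-addʳ : ∀ {M} (f x y : Vec ℚ M) → f ∙ (x ⊕ y) ≡ f ∙ x +ℚ f ∙ y
  ∙-addʳ [] [] [] = refl
  ∙-addʳ (f ∷ fs) (x ∷ xs) (y ∷ ys) rewrite ∙-addʳ fs xs ys = lemma f x y (fs ∙ xs) (fs ∙ ys)
    where
    lemma : ∀ f x y a b → f *ℚ (x +ℚ y) +ℚ (a +ℚ b) ≡ (f *ℚ x +ℚ a) +ℚ (f *ℚ y +ℚ b)
    lemma = solve-∀ ℚ-ring

  -- Vector identities are tested against all functionals, which turns them into ring identities in
  -- ℚ.
  ext∙ : ∀ {M} {x y : Vec ℚ M} → (∀ f → f ∙ x ≡ f ∙ y) → x ≡ y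
  ext∙ {x = []} {[]} _ = refl
  ext∙ {x = x ∷ xs} {y ∷ ys} eq = cong₂ _∷_ head≡ (ext∙ tail≡)
    where
    unit : ∀ a {M} (as : Vec ℚ M) → (1ℚ ∷ 0v) ∙ (a ∷ as) ≡ a
    unit a as rewrite ∙-zeroˡ as = trans (ℚ.+-identityʳ _) (ℚ.*-identityˡ a)
    head≡ : x ≡ y
    head≡ = trans (sym (unit x xs)) (trans (eq (1ℚ ∷ 0v)) (unit y ys))
    drop : ∀ f a {M} (as g : Vec ℚ M) → f ≡ 0ℚ → (f ∷ g) ∙ (a ∷ as) ≡ g ∙ as
    drop f a as g refl = trans (cong (_+ℚ g ∙ as) (ℚ.*-zeroˡ a)) (ℚ.+-identityˡ _)
    tail≡ : ∀ f → f ∙ xs ≡ f ∙ ys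
    tail≡ f = trans (sym (drop 0ℚ x xs f refl)) (trans (eq (0ℚ ∷ f)) (drop 0ℚ y ys f refl))

  dual-nonzero : ∀ {M} (x : Vec ℚ M) → x ≢ 0v → Σ (Vec ℚ M) λ φ → φ ∙ x ≡ 1ℚ
  dual-nonzero [] x≢0 = ⊥-elim (x≢0 refl)
  dual-nonzero (x ∷ xs) x≢0 with x ℚ.≟ 0ℚ
  ... | no x≢ = let r , rx = inverse x x≢ in (r ∷ 0v) , trans (cong₂ _+ℚ_ rx (∙-zeroˡ xs)) (ℚ.+-identityʳ _)
  ... | yes refl with dual-nonzero xs (x≢0 ∘ cong (0ℚ ∷_))
  ...   | φ , φx = (0ℚ ∷ φ) , trans (cong (0ℚ *ℚ 0ℚ +ℚ_) φx) refl

-- Spans, separating functionals and dimension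

module _ {M : ℕ} where

  comb : ∀ {k} → Vec ℚ k → Vec (Vec ℚ M) k → Vec ℚ M
  comb [] [] = 0v
  comb (c ∷ cs) (t ∷ T) = comb cs T ⊕ c • t

  values : ∀ {k} → Vec ℚ M → Vec (Vec ℚ M) k → Vec ℚ k
  values f = Vec.map (f ∙_)

  ∙-combʳ : ∀ {k} f (c : Vec ℚ k) T → f ∙ comb c T ≡ c ∙ values f T
  ∙-combʳ f [] [] = trans (∙-zeroʳ f) (sym (∙-zeroʳ []))
  ∙-combʳ f (c ∷ cs) (t ∷ T) =
    trans (∙-linʳ f (comb cs T) c t) (trans (ℚ.+-comm (f ∙ comb cs T) (c *ℚ f ∙ t))
      (trans (cong (c *ℚ f ∙ t +ℚ_) (∙-combʳ f cs T)) (sym (∙-∷ c cs (f ∙ t) (values f T)))))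

  opaque
    unfolding _⊕_

    values-lin : ∀ {k} f c g (T : Vec (Vec ℚ M) k) → values (f ⊕ c • g) T ≡ values f T ⊕ c • values g T
    values-lin f c g [] = refl
    values-lin f c g (t ∷ T) = cong₂ _∷_ (∙-linˡ f c g t) (values-lin f c g T)

  ∙-combˡ : ∀ {k} (c : Vec ℚ k) fs x → comb c fs ∙ x ≡ c ∙ Vec.map (_∙ x) fs
  ∙-combˡ c fs x = trans (∙-comm (comb c fs) x)
    (trans (∙-combʳ x c fs) (cong (c ∙_) (Vec.map-cong (∙-comm x) fs)))

  Span : ∀ {k} → Vec (Vec ℚ M) k → Vec ℚ M → Set
  Span {k} T x = Σ (Vec ℚ k) λ c → comb c T ≡ x

  Kills : ∀ {k} → Vec ℚ M → Vec (Vec ℚ M) k → Set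
  Kills φ = AllV (λ t → φ ∙ t ≡ 0ℚ)

  kills-values : ∀ {k φ} {T : Vec (Vec ℚ M) k} → Kills φ T → values φ T ≡ 0v
  kills-values [] = refl
  kills-values (p ∷ ps) = cong₂ _∷_ p (kills-values ps)

  kills-span : ∀ {k φ} {T : Vec (Vec ℚ M) k} {x} → Kills φ T → Span T x → φ ∙ x ≡ 0ℚ
  kills-span {φ = φ} {T} kills (c , refl) =
    trans (∙-combʳ φ c T) (trans (cong (c ∙_) (kills-values kills)) (∙-zeroʳ c))

  agree-span : ∀ {k f g} {T : Vec (Vec ℚ M) k} {x} →
    AllV (λ t → f ∙ t ≡ g ∙ t) T → Span T x → f ∙ x ≡ g ∙ x
  agree-span {f = f} {g} {T} agree (c , refl) =
    trans (∙-combʳ f c T) (trans (cong (c ∙_) (eq agree)) (sym (∙-combʳ g c T)))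
    where
    eq : ∀ {k} {T : Vec (Vec ℚ M) k} → AllV (λ t → f ∙ t ≡ g ∙ t) T → values f T ≡ values g T
    eq [] = refl
    eq (p ∷ ps) = cong₂ _∷_ p (eq ps)

  span-there : ∀ {k} {T : Vec (Vec ℚ M) k} {t x} → Span T x → Span (t ∷ T) x
  span-there {T = T} {t} (c , refl) = (0ℚ ∷ c) , ext∙ λ f →
    trans (∙-linʳ f (comb c T) 0ℚ t) (lemma (f ∙ comb c T) (f ∙ t))
    where
    lemma : ∀ a b → a +ℚ 0ℚ *ℚ b ≡ a
    lemma = solve-∀ ℚ-ring

  span-zero : ∀ {k} (T : Vec (Vec ℚ M) k) → Span T 0v
  span-zero [] = [] , refl
  span-zero (t ∷ T) = span-there (span-zero T)

  span-lin : ∀ {k} {T : Vec (Vec ℚ M) k} {x y} c → Span T x → Span T y → Span T (x ⊕ c • y)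
  span-lin {T = T} c (a , refl) (b , refl) = (a ⊕ c • b) , ext∙ λ f →
    trans (∙-combʳ f (a ⊕ c • b) T) (trans (∙-linˡ a c b (values f T))
      (sym (trans (∙-linʳ f (comb a T) c (comb b T))
        (cong₂ (λ u v → u +ℚ c *ℚ v) (∙-combʳ f a T) (∙-combʳ f b T)))))

  span-scale : ∀ {k} {T : Vec (Vec ℚ M) k} {x} c → Span T x → Span T (c • x)
  span-scale {T = T} {x} c s = subst (Span T) (ext∙ λ f →
      trans (∙-linʳ f 0v c x) (trans (cong (_+ℚ c *ℚ f ∙ x) (∙-zeroʳ f))
        (trans (ℚ.+-identityˡ _) (sym (∙-scaleʳ f c x)))))
    (span-lin c (span-zero T) s)

  span-here : ∀ {k} {T : Vec (Vec ℚ M) k} {t} → Span (t ∷ T) t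
  span-here {T = T} {t} = (1ℚ ∷ proj₁ z) , ext∙ λ f →
      trans (∙-linʳ f (comb (proj₁ z) T) 1ℚ t)
        (trans (cong (λ u → f ∙ u +ℚ 1ℚ *ℚ f ∙ t) (proj₂ z))
          (trans (cong (_+ℚ 1ℚ *ℚ f ∙ t) (∙-zeroʳ f)) (lemma (f ∙ t))))
    where
    z = span-zero T
    lemma : ∀ b → 0ℚ +ℚ 1ℚ *ℚ b ≡ b
    lemma = solve-∀ ℚ-ring

  -- Induction on `T`. If `φ` kills `T` and is 1 at `t`, the alternative is decided for
  -- `x - (φ ∙ x) t`, the projection of `x` along `t`. A functional `ψ` found there is corrected to
  -- `ψ - (ψ ∙ t) φ`, which also kills `t` and has at `x` the value of `ψ` at the projection.
  fredholm : ∀ {k} (T : Vec (Vec ℚ M) k) x →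
    Span T x ⊎ Σ (Vec ℚ M) λ φ → Kills φ T × φ ∙ x ≡ 1ℚ
  fredholm [] x with x ≟v 0v
  ... | yes refl = inj₁ ([] , refl)
  ... | no x≢0 = let φ , φx = dual-nonzero x x≢0 in inj₂ (φ , [] , φx)
  fredholm (t ∷ T) x with fredholm T t
  fredholm (t ∷ T) x | inj₁ st with fredholm T x
  ... | inj₁ sx = inj₁ (span-there sx)
  ... | inj₂ (φ , φT , φx) = inj₂ (φ , kills-span φT st ∷ φT , φx)
  fredholm (t ∷ T) x | inj₂ (φ , φT , φt) with fredholm T (x ⊕ (-ℚ (φ ∙ x)) • t)
  ... | inj₁ (c , eq) = inj₁ ((φ ∙ x ∷ c) , ext∙ λ f →
        trans (∙-linʳ f (comb c T) (φ ∙ x) t)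
          (trans (cong (λ u → f ∙ u +ℚ φ ∙ x *ℚ f ∙ t) eq)
            (trans (cong (_+ℚ φ ∙ x *ℚ f ∙ t) (∙-linʳ f x (-ℚ (φ ∙ x)) t)) (lemma (f ∙ x) (φ ∙ x) (f ∙ t)))))
    where
    lemma : ∀ a b c → (a +ℚ (-ℚ b) *ℚ c) +ℚ b *ℚ c ≡ a
    lemma = solve-∀ ℚ-ring
  ... | inj₂ (ψ , ψT , ψx) = inj₂ (χ , (χt ∷ zipAll ψT φT) , χx)
    where
    χ = ψ ⊕ (-ℚ (ψ ∙ t)) • φ
    lemma₁ : ∀ a → a +ℚ (-ℚ a) *ℚ 1ℚ ≡ 0ℚ
    lemma₁ = solve-∀ ℚ-ring
    χt : χ ∙ t ≡ 0ℚ
    χt = trans (∙-linˡ ψ (-ℚ (ψ ∙ t)) φ t) (trans (cong (λ u → ψ ∙ t +ℚ (-ℚ (ψ ∙ t)) *ℚ u) φt) (lemma₁ (ψ ∙ t)))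
    lemma₂ : ∀ c → 0ℚ +ℚ c *ℚ 0ℚ ≡ 0ℚ
    lemma₂ = solve-∀ ℚ-ring
    zipAll : ∀ {k} {T : Vec (Vec ℚ M) k} → Kills ψ T → Kills φ T → Kills χ T
    zipAll [] [] = []
    zipAll {T = s ∷ _} (p ∷ ps) (q ∷ qs) =
      trans (∙-linˡ ψ (-ℚ (ψ ∙ t)) φ s) (trans (cong₂ (λ u v → u +ℚ (-ℚ (ψ ∙ t)) *ℚ v) p q) (lemma₂ (-ℚ (ψ ∙ t))))
      ∷ zipAll ps qs
    lemma₃ : ∀ a b c → a +ℚ (-ℚ b) *ℚ c ≡ a +ℚ (-ℚ c) *ℚ b
    lemma₃ = solve-∀ ℚ-ring
    χx : χ ∙ x ≡ 1ℚ
    χx = trans (∙-linˡ ψ (-ℚ (ψ ∙ t)) φ x) (trans (lemma₃ (ψ ∙ x) (ψ ∙ t) (φ ∙ x))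
      (trans (sym (∙-linʳ ψ x (-ℚ (φ ∙ x)) t)) ψx))

  span? : ∀ {k} (T : Vec (Vec ℚ M) k) x → Dec (Span T x)
  span? T x with fredholm T x
  ... | inj₁ s = yes s
  ... | inj₂ (φ , φT , φx) = no λ s → 1≢0 (trans (sym φx) (kills-span φT s))
    where
    1≢0 : 1ℚ ≢ 0ℚ
    1≢0 ()

  opaque
    separate : ∀ {k} {T : Vec (Vec ℚ M) k} {x} → ¬ Span T x → Σ (Vec ℚ M) λ φ → Kills φ T × φ ∙ x ≡ 1ℚ
    separate {T = T} {x} ¬s with fredholm T x
    ... | inj₁ s = ⊥-elim (¬s s)
    ... | inj₂ r = r

  Ind : ∀ {k} → Vec (Vec ℚ M) k → Set
  Ind [] = ⊤
  Ind (t ∷ T) = ¬ Span T t × Ind T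

  -- The map `y ↦ y + (ψ ∙ y) s` is linear and so passes through combinations. When `ψ ∙ s` is -1 it
  -- is the projection along `s` onto the kernel of `ψ`.
  span-replace : ∀ {k} (s : Vec ℚ M) ψ (T : Vec (Vec ℚ M) k) c →
    comb c (Vec.map (λ y → y ⊕ (ψ ∙ y) • s) T) ≡ comb c T ⊕ (ψ ∙ comb c T) • s
  span-replace s ψ [] [] = ext∙ λ f → sym (trans (∙-linʳ f 0v (ψ ∙ 0v) s)
      (trans (cong (λ u → f ∙ 0v +ℚ u *ℚ f ∙ s) (∙-zeroʳ ψ)) (lemma (f ∙ 0v) (f ∙ s))))
    where
    lemma : ∀ a b → a +ℚ 0ℚ *ℚ b ≡ a
    lemma = solve-∀ ℚ-ring
  span-replace s ψ (t ∷ T) (c ∷ cs) = ext∙ λ f → begin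
    f ∙ (comb cs T' ⊕ c • (t ⊕ (ψ ∙ t) • s))
      ≡⟨ ∙-linʳ f (comb cs T') c _ ⟩
    f ∙ comb cs T' +ℚ c *ℚ f ∙ (t ⊕ (ψ ∙ t) • s)
      ≡⟨ cong₂ (λ u v → f ∙ u +ℚ c *ℚ v) (span-replace s ψ T cs) (∙-linʳ f t (ψ ∙ t) s) ⟩
    f ∙ (y ⊕ (ψ ∙ y) • s) +ℚ c *ℚ (f ∙ t +ℚ ψ ∙ t *ℚ f ∙ s)
      ≡⟨ cong (_+ℚ c *ℚ (f ∙ t +ℚ ψ ∙ t *ℚ f ∙ s)) (∙-linʳ f y (ψ ∙ y) s) ⟩
    (f ∙ y +ℚ ψ ∙ y *ℚ f ∙ s) +ℚ c *ℚ (f ∙ t +ℚ ψ ∙ t *ℚ f ∙ s)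
      ≡⟨ lemma (f ∙ y) (ψ ∙ y) (f ∙ s) c (f ∙ t) (ψ ∙ t) ⟩
    (f ∙ y +ℚ c *ℚ f ∙ t) +ℚ (ψ ∙ y +ℚ c *ℚ ψ ∙ t) *ℚ f ∙ s
      ≡⟨ cong₂ (λ u v → u +ℚ v *ℚ f ∙ s) (sym (∙-linʳ f y c t)) (sym (∙-linʳ ψ y c t)) ⟩
    f ∙ (y ⊕ c • t) +ℚ ψ ∙ (y ⊕ c • t) *ℚ f ∙ s
      ≡⟨ sym (∙-linʳ f (y ⊕ c • t) _ s) ⟩
    f ∙ ((y ⊕ c • t) ⊕ (ψ ∙ (y ⊕ c • t)) • s) ∎
    where
    open ≡-Reasoning
    T' = Vec.map (λ y → y ⊕ (ψ ∙ y) • s) T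
    y = comb cs T
    lemma : ∀ a b d c e g → (a +ℚ b *ℚ d) +ℚ c *ℚ (e +ℚ g *ℚ d) ≡ (a +ℚ c *ℚ e) +ℚ (b +ℚ c *ℚ g) *ℚ d
    lemma = solve-∀ ℚ-ring

  -- One elimination step: the first generator on which `φ` is nonzero is the pivot, the later ones
  -- are projected along it into the kernel of `φ`, and the earlier ones lie there already.
  kernel-shrink : ∀ {m} φ (S : Vec (Vec ℚ M) m) → Kills φ S ⊎
    Σ ℕ λ m' → m ≡ suc m' × Σ (Vec (Vec ℚ M) m') λ S' → ∀ {x} → Span S x → φ ∙ x ≡ 0ℚ → Span S' x
  kernel-shrink φ [] = inj₁ []
  kernel-shrink φ (s ∷ S) with φ ∙ s ℚ.≟ 0ℚ
  ... | no φs≢0 = inj₂ (_ , refl , Vec.map π S , span')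
    where
    r = proj₁ (inverse (φ ∙ s) φs≢0)
    ψ = (-ℚ r) • φ
    π : Vec ℚ M → Vec ℚ M
    π y = y ⊕ (ψ ∙ y) • s
    ψs : ψ ∙ s ≡ -ℚ 1ℚ
    ψs = trans (∙-scaleˡ (-ℚ r) φ s) (trans (sym (ℚ.neg-distribˡ-* r (φ ∙ s))) (cong -ℚ_ (proj₂ (inverse (φ ∙ s) φs≢0))))
    span' : ∀ {x} → Span (s ∷ S) x → φ ∙ x ≡ 0ℚ → Span (Vec.map π S) x
    span' ((c ∷ cs) , refl) φx = cs , trans (span-replace s ψ S cs) (cong (λ u → y ⊕ u • s) ψy)
      where
      y = comb cs S
      zero-eq : ψ ∙ y +ℚ c *ℚ ψ ∙ s ≡ 0ℚ
      zero-eq = trans (sym (∙-linʳ ψ y c s)) (trans (∙-scaleˡ (-ℚ r) φ (y ⊕ c • s)) (trans (cong ((-ℚ r) *ℚ_) φx) (ℚ.*-zeroʳ (-ℚ r))))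
      lemma : ∀ a c b → a ≡ (a +ℚ c *ℚ b) +ℚ c *ℚ (-ℚ b)
      lemma = solve-∀ ℚ-ring
      lemma' : ∀ c → 0ℚ +ℚ c *ℚ (-ℚ (-ℚ 1ℚ)) ≡ c
      lemma' = solve-∀ ℚ-ring
      ψy : ψ ∙ y ≡ c
      ψy = trans (lemma (ψ ∙ y) c (ψ ∙ s)) (trans (cong₂ (λ u v → u +ℚ c *ℚ (-ℚ v)) zero-eq ψs) (lemma' c))
  ... | yes φs≡0 with kernel-shrink φ S
  ...   | inj₁ kills = inj₁ (φs≡0 ∷ kills)
  ...   | inj₂ (m' , refl , S' , shrink) = inj₂ (suc m' , refl , s ∷ S' , span')
    where
    span' : ∀ {x} → Span (s ∷ S) x → φ ∙ x ≡ 0ℚ → Span (s ∷ S') x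
    span' ((c ∷ cs) , refl) φx =
      span-lin c (span-there (shrink (cs , refl) φy)) span-here
      where
      φy : φ ∙ comb cs S ≡ 0ℚ
      φy = trans (lemma (φ ∙ comb cs S) c) (trans (cong (λ u → φ ∙ comb cs S +ℚ c *ℚ u) (sym φs≡0))
             (trans (sym (∙-linʳ φ (comb cs S) c s)) φx))
        where
        lemma : ∀ a c → a ≡ a +ℚ c *ℚ 0ℚ
        lemma = solve-∀ ℚ-ring

  -- A functional separating `t` from `T` cannot kill `S`, whose span contains `t`. Its kernel
  -- contains `T`, and the part of the span of `S` in this kernel needs one generator fewer.
  steinitz : ∀ {k m} {T : Vec (Vec ℚ M) k} {S : Vec (Vec ℚ M) m} → Ind T → AllV (Span S) T → k ≤ m
  steinitz {T = []} _ _ = z≤n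
  steinitz {T = t ∷ T} {S} (t∉T , ind) (t∈S ∷ T⊆S) with separate t∉T
  ... | φ , φT , φt with kernel-shrink φ S
  ...   | inj₁ kills = case trans (sym φt) (kills-span kills t∈S) of λ ()
  ...   | inj₂ (_ , refl , S' , shrink) = s≤s (steinitz ind (shrinkAll φT T⊆S))
    where
    shrinkAll : ∀ {k} {T : Vec (Vec ℚ M) k} → Kills φ T → AllV (Span S) T → AllV (Span S') T
    shrinkAll [] [] = []
    shrinkAll (p ∷ ps) (q ∷ qs) = shrink q p ∷ shrinkAll ps qs

-- Counting in lists

-- A relation `R` in place of a function and `Sep` in place of inequality are needed because
-- functionals are counted only up to agreement on a set of points.
pigeonhole : {X Y : Set} {R : X → Y → Set} {Sep : X → X → Set} {xs : List X} {ys : List Y} →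
  AllPairs Sep xs → (∀ x → x ∈ xs → Σ Y λ y → y ∈ ys × R x y) →
  (∀ {x x' y} → x ∈ xs → x' ∈ xs → Sep x x' → R x y → R x' y → ⊥) → length xs ≤ length ys
pigeonhole {xs = []} _ _ _ = z≤n
pigeonhole {Y = Y} {R} {xs = x ∷ xs} (sx ∷ sep) hits inj with hits x (here refl)
... | y , y∈ys , Rxy with ∈-∃++ y∈ys
...   | ys₁ , ys₂ , refl = subst (suc (length xs) ≤_) (sym lengths) (s≤s
        (pigeonhole sep hits' λ x∈ x'∈ → inj (there x∈) (there x'∈)))
  where
  lengths : length (ys₁ ++ y ∷ ys₂) ≡ suc (length (ys₁ ++ ys₂))
  lengths = trans (List.length-++ ys₁) (trans (ℕ.+-suc (length ys₁) (length ys₂)) (cong suc (sym (List.length-++ ys₁))))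
  hits' : ∀ x' → x' ∈ xs → Σ Y λ y' → y' ∈ ys₁ ++ ys₂ × R x' y'
  hits' x' x'∈ with hits x' (there x'∈)
  ... | y' , y'∈ , Rx'y' with ∈-++⁻ ys₁ y'∈
  ...   | inj₁ p = y' , ∈-++⁺ˡ p , Rx'y'
  ...   | inj₂ (there p) = y' , ∈-++⁺ʳ ys₁ p , Rx'y'
  ...   | inj₂ (here refl) = ⊥-elim (inj (here refl) (there x'∈) (All.lookup sx x'∈) Rxy Rx'y')

filter-split : ∀ {X : Set} {P : X → Set} (P? : Decidable P) xs →
  length xs ≡ length (filter P? xs) + length (filter (¬? ∘ P?) xs)
filter-split P? [] = refl
filter-split P? (x ∷ xs) with P? x
... | yes _ = cong suc (filter-split P? xs)
... | no _ = trans (cong suc (filter-split P? xs)) (sym (ℕ.+-suc _ _))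

filter-mono : ∀ {X : Set} {P Q : X → Set} (P? : Decidable P) (Q? : Decidable Q) xs →
  (∀ x → x ∈ xs → P x → Q x) → length (filter P? xs) ≤ length (filter Q? xs)
filter-mono P? Q? [] _ = z≤n
filter-mono P? Q? (x ∷ xs) sub with P? x | Q? x
... | yes p | yes _ = s≤s (filter-mono P? Q? xs (λ y → sub y ∘ there))
... | yes p | no ¬q = ⊥-elim (¬q (sub x (here refl) p))
... | no _ | yes _ = ℕ.m≤n⇒m≤1+n (filter-mono P? Q? xs (λ y → sub y ∘ there))
... | no _ | no _ = filter-mono P? Q? xs (λ y → sub y ∘ there)

filter-mono-< : ∀ {X : Set} {P Q : X → Set} (P? : Decidable P) (Q? : Decidable Q) xs {b} →
  (∀ x → x ∈ xs → P x → Q x) → b ∈ xs → Q b → ¬ P b → length (filter P? xs) < length (filter Q? xs)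
filter-mono-< P? Q? (x ∷ xs) sub b∈ qb ¬pb with P? x | Q? x | b∈
... | yes p | no ¬q | _ = ⊥-elim (¬q (sub x (here refl) p))
... | yes p | yes _ | here refl = ⊥-elim (¬pb p)
... | no _ | no ¬q | here refl = ⊥-elim (¬q qb)
... | no _ | yes _ | here refl = s≤s (filter-mono P? Q? xs (λ y → sub y ∘ there))
... | yes p | yes _ | there b∈' = s≤s (filter-mono-< P? Q? xs (λ y → sub y ∘ there) b∈' qb ¬pb)
... | no _ | yes _ | there b∈' = ℕ.m≤n⇒m≤1+n (filter-mono-< P? Q? xs (λ y → sub y ∘ there) b∈' qb ¬pb)
... | no _ | no _ | there b∈' = filter-mono-< P? Q? xs (λ y → sub y ∘ there) b∈' qb ¬pb

-- Order in ℚ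

0<1ℚ : 0ℚ <ℚ 1ℚ
0<1ℚ = ℚ.positive⁻¹ 1ℚ

0≤1ℚ : 0ℚ ≤ℚ 1ℚ
0≤1ℚ = ℚ.<⇒≤ 0<1ℚ

1≢0ℚ : 1ℚ ≢ 0ℚ
1≢0ℚ ()

*-nonneg : ∀ {x y} → 0ℚ ≤ℚ x → 0ℚ ≤ℚ y → 0ℚ ≤ℚ x *ℚ y
*-nonneg {x} {y} 0≤x 0≤y = subst (_≤ℚ x *ℚ y) (ℚ.*-zeroʳ x) (ℚ.*-monoˡ-≤-nonNeg x {{ℚ.nonNegative 0≤x}} 0≤y)

*-monoʳ : ∀ {x y} r → 0ℚ ≤ℚ r → x ≤ℚ y → x *ℚ r ≤ℚ y *ℚ r
*-monoʳ r 0≤r = ℚ.*-monoʳ-≤-nonNeg r {{ℚ.nonNegative 0≤r}}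

*-nonneg-nonpos : ∀ {x y} → 0ℚ ≤ℚ x → y ≤ℚ 0ℚ → x *ℚ y ≤ℚ 0ℚ
*-nonneg-nonpos {x} {y} 0≤x y≤0 = subst (x *ℚ y ≤ℚ_) (ℚ.*-zeroʳ x) (ℚ.*-monoˡ-≤-nonNeg x {{ℚ.nonNegative 0≤x}} y≤0)

≢0⇒0< : ∀ {x} → 0ℚ ≤ℚ x → x ≢ 0ℚ → 0ℚ <ℚ x
≢0⇒0< 0≤x x≢0 with ℚ.<-cmp 0ℚ _
... | tri< lt _ _ = lt
... | tri≈ _ eq _ = contradiction (sym eq) x≢0
... | tri> _ _ gt = contradiction (ℚ.<-≤-trans gt 0≤x) (ℚ.<-irrefl refl)

0<⇒≢0 : ∀ {x} → 0ℚ <ℚ x → x ≢ 0ℚ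
0<⇒≢0 0<x refl = ℚ.<-irrefl refl 0<x

≤⇒0≤- : ∀ {x y} → x ≤ℚ y → 0ℚ ≤ℚ y +ℚ -ℚ x
≤⇒0≤- {x} {y} x≤y = subst (_≤ℚ y +ℚ -ℚ x) (ℚ.+-inverseʳ x) (ℚ.+-monoˡ-≤ (-ℚ x) x≤y)

0≤-⇒≤ : ∀ {x y} → 0ℚ ≤ℚ y +ℚ -ℚ x → x ≤ℚ y
0≤-⇒≤ {x} {y} le = subst₂ _≤ℚ_ (ℚ.+-identityˡ x) (lemma y x) (ℚ.+-monoˡ-≤ x le)
  where
  lemma : ∀ y x → (y +ℚ -ℚ x) +ℚ x ≡ y
  lemma = solve-∀ ℚ-ring

+-nonneg : ∀ {x y} → 0ℚ ≤ℚ x → 0ℚ ≤ℚ y → 0ℚ ≤ℚ x +ℚ y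
+-nonneg {x} {y} p q = subst (_≤ℚ x +ℚ y) (ℚ.+-identityˡ 0ℚ) (ℚ.+-mono-≤ p q)

inverse-nonneg : ∀ {q r} → 0ℚ <ℚ q → r *ℚ q ≡ 1ℚ → 0ℚ ≤ℚ r
inverse-nonneg {q} {r} 0<q rq with 0ℚ ℚ.≤? r
... | yes ok = ok
... | no ¬ok = ⊥-elim (ℚ.<-irrefl refl (ℚ.<-≤-trans 0<1ℚ (subst (_≤ℚ 0ℚ) (trans (ℚ.*-comm q r) rq)
                 (*-nonneg-nonpos (ℚ.<⇒≤ 0<q) (ℚ.<⇒≤ (ℚ.≰⇒> ¬ok))))))

quotient : ∀ {p q} → 0ℚ ≤ℚ p → 0ℚ <ℚ q → Σ ℚ λ t → 0ℚ ≤ℚ t × t *ℚ q ≡ p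
quotient {p} {q} 0≤p 0<q with inverse q (0<⇒≢0 0<q)
... | r , rq = p *ℚ r , *-nonneg 0≤p (inverse-nonneg 0<q rq) ,
      trans (ℚ.*-assoc p r q) (trans (cong (p *ℚ_) rq) (ℚ.*-identityʳ p))

opaque
  -- Greedy choice from the back of `L`. The map `ev` lets functionals be selected according to
  -- their values on a basis; points are selected with `ev = id`.
  extend : ∀ {X : Set} {M} (ev : X → Vec ℚ M) (L : List X) {k} (base : Vec (Vec ℚ M) k) → Ind base →
    Σ ℕ λ m → Σ (Vec X m) λ fs → AllV (_∈ L) fs × Ind (Vec.map ev fs Vec.++ base) ×
      (∀ x → x ∈ L → Span (Vec.map ev fs Vec.++ base) (ev x))
  extend ev [] base ind = 0 , [] , [] , ind , λ _ ()
  extend ev (x ∷ L) base ind with extend ev L base ind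
  ... | m , fs , fs⊆ , ind' , spans with span? (Vec.map ev fs Vec.++ base) (ev x)
  ...   | yes s = m , fs , AllV.map there fs⊆ , ind' , λ where
            _ (here refl) → s
            y (there y∈) → spans y y∈
  ...   | no ¬s = suc m , x ∷ fs , here refl ∷ AllV.map there fs⊆ , (¬s , ind') , λ where
            _ (here refl) → span-here
            y (there y∈) → span-there (spans y y∈)

allSpan : ∀ {M k} (T : Vec (Vec ℚ M) k) → AllV (Span T) T
allSpan [] = []
allSpan (t ∷ T) = span-here ∷ AllV.map span-there (allSpan T)

¬all⇒any : ∀ {X : Set} {P : X → Set} (P? : Decidable P) xs → ¬ (∀ x → x ∈ xs → P x) → Σ X λ x → x ∈ xs × ¬ P x
¬all⇒any P? [] ¬all = ⊥-elim (¬all λ _ ())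
¬all⇒any P? (x ∷ xs) ¬all with P? x
... | no ¬p = x , here refl , ¬p
... | yes p with ¬all⇒any P? xs (λ rest → ¬all λ where
        _ (here refl) → p
        y (there y∈) → rest y y∈)
...   | y , y∈ , ¬p = y , there y∈ , ¬p

all-dec : ∀ {X : Set} {P : X → Set} (P? : Decidable P) xs → Dec (∀ x → x ∈ xs → P x)
all-dec P? xs with all? P? xs
... | yes all = yes λ _ → All.lookup all
... | no ¬all = no λ all → ¬all (All.tabulate (all _))

-- Points, facets and the rotation of functionals

module _ {M : ℕ} where

  Pt : Set
  Pt = Vec ℚ M

  Bin : List Pt → Pt → Set
  Bin A f = ∀ a → a ∈ A → f ∙ a ≡ 0ℚ ⊎ f ∙ a ≡ 1ℚ

  Agree : List Pt → Pt → Pt → Set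
  Agree A f g = ∀ a → a ∈ A → f ∙ a ≡ g ∙ a

  Nonneg : List Pt → Pt → Set
  Nonneg A φ = ∀ a → a ∈ A → 0ℚ ≤ℚ φ ∙ a

  -- z lies in the linear span of A; the dual formulation avoids coefficients.
  InSpan : List Pt → Pt → Set
  InSpan A z = ∀ ψ → (∀ a → a ∈ A → ψ ∙ a ≡ 0ℚ) → ψ ∙ z ≡ 0ℚ

  -- φ is determined on A up to a scalar by its zero set, i.e. the zero set has codimension one.
  Facet : List Pt → Pt → Set
  Facet A φ = (Σ Pt λ a → a ∈ A × φ ∙ a ≢ 0ℚ) ×
    (∀ g → (∀ a → a ∈ A → φ ∙ a ≡ 0ℚ → g ∙ a ≡ 0ℚ) → Σ ℚ λ κ → ∀ a → a ∈ A → g ∙ a ≡ κ *ℚ φ ∙ a)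

  TL : List Pt → Set
  TL A = ∀ φ → Nonneg A φ → Facet A φ → Σ ℚ λ c → ∀ a → a ∈ A → φ ∙ a ≡ 0ℚ ⊎ φ ∙ a ≡ c

  record Rank (A : List Pt) (D : ℕ) : Set where
    constructor rank
    field
      basis : Vec Pt D
      basis⊆ : AllV (_∈ A) basis
      basis-ind : Ind basis
      basis-spans : ∀ a → a ∈ A → Span basis a

  opaque
    rank-of : ∀ A → Σ ℕ (Rank A)
    rank-of A with extend id A [] tt
    ... | m , T , T⊆ , ind , spans rewrite Vec.map-id T = (m + 0) , rank (T Vec.++ []) (snoc T⊆) ind spans
      where
      snoc : ∀ {m} {T : Vec Pt m} → AllV (_∈ A) T → AllV (_∈ A) (T Vec.++ [])
      snoc [] = []
      snoc (p ∷ ps) = p ∷ snoc ps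

  spans-all : ∀ {A k m} {T : Vec Pt k} {S : Vec Pt m} → AllV (_∈ A) T → (∀ a → a ∈ A → Span S a) → AllV (Span S) T
  spans-all T⊆ spans = AllV.map (λ {t} → spans t) T⊆

  rank-unique : ∀ {A D D'} → Rank A D → Rank A D' → D ≡ D'
  rank-unique (rank B B⊆ indB spB) (rank C C⊆ indC spC) =
    ℕ.≤-antisym (steinitz indB (spans-all B⊆ spC)) (steinitz indC (spans-all C⊆ spB))

  opaque
    -- The ratio test of the simplex method: `t` is the least `φ / χ` over the points where `χ` is
    -- positive. Where `χ` is not positive, the inequality holds for every nonnegative `t`.
    min-ratio : ∀ φ χ A → Nonneg A φ → (∀ a → a ∈ A → χ ∙ a ≤ℚ 0ℚ) ⊎
      Σ ℚ λ t → Σ Pt λ b → 0ℚ ≤ℚ t × b ∈ A × 0ℚ <ℚ χ ∙ b × t *ℚ χ ∙ b ≡ φ ∙ b ×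
        (∀ a → a ∈ A → t *ℚ χ ∙ a ≤ℚ φ ∙ a)
    min-ratio φ χ [] _ = inj₁ λ _ ()
    min-ratio φ χ (x ∷ A) nonneg with min-ratio φ χ A (λ a → nonneg a ∘ there) | 0ℚ ℚ.<? χ ∙ x
    ... | inj₁ all≤ | no ¬pos = inj₁ λ where
          _ (here refl) → ℚ.≮⇒≥ ¬pos
          a (there a∈) → all≤ a a∈
    ... | inj₁ all≤ | yes pos = let t , 0≤t , eq = quotient (nonneg x (here refl)) pos in
          inj₂ (t , x , 0≤t , here refl , pos , eq , λ where
            _ (here refl) → ℚ.≤-reflexive eq
            a (there a∈) → ℚ.≤-trans (*-nonneg-nonpos 0≤t (all≤ a a∈)) (nonneg a (there a∈)))
    ... | inj₂ (t , b , 0≤t , b∈ , posb , eqb , all≤) | no ¬pos =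
          inj₂ (t , b , 0≤t , there b∈ , posb , eqb , λ where
            _ (here refl) → ℚ.≤-trans (*-nonneg-nonpos 0≤t (ℚ.≮⇒≥ ¬pos)) (nonneg x (here refl))
            a (there a∈) → all≤ a a∈)
    ... | inj₂ (t , b , 0≤t , b∈ , posb , eqb , all≤) | yes pos with quotient (nonneg x (here refl)) pos
    ...   | s , 0≤s , eq with ℚ.≤-total t s
    ...     | inj₁ t≤s = inj₂ (t , b , 0≤t , there b∈ , posb , eqb , λ where
            _ (here refl) → ℚ.≤-trans (*-monoʳ (χ ∙ x) (ℚ.<⇒≤ pos) t≤s) (ℚ.≤-reflexive eq)
            a (there a∈) → all≤ a a∈)
    ...     | inj₂ s≤t = inj₂ (s , x , 0≤s , here refl , pos , eq , λ where
            _ (here refl) → ℚ.≤-reflexive eq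
            a (there a∈) → bound a a∈)
      where
      bound : ∀ a → a ∈ A → s *ℚ χ ∙ a ≤ℚ φ ∙ a
      bound a a∈ with ℚ.≤-total 0ℚ (χ ∙ a)
      ... | inj₁ 0≤χ = ℚ.≤-trans (*-monoʳ (χ ∙ a) 0≤χ s≤t) (all≤ a a∈)
      ... | inj₂ χ≤0 = ℚ.≤-trans (*-nonneg-nonpos 0≤s χ≤0) (nonneg a (there a∈))

  opaque
    tilt : ∀ A φ χ b → Nonneg A φ → b ∈ A → 0ℚ <ℚ χ ∙ b → Σ ℚ λ t → Nonneg A (φ ⊕ (-ℚ t) • χ) ×
      Σ Pt λ a → a ∈ A × 0ℚ <ℚ χ ∙ a × (φ ⊕ (-ℚ t) • χ) ∙ a ≡ 0ℚ
    tilt A φ χ b nonneg b∈ posb with min-ratio φ χ A nonneg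
    ... | inj₁ all≤ = ⊥-elim (ℚ.<-irrefl refl (ℚ.<-≤-trans posb (all≤ b b∈)))
    ... | inj₂ (t , a , 0≤t , a∈ , posa , eq , all≤) = t ,
        (λ x x∈ → subst (0ℚ ≤ℚ_) (trans (lemma t (χ ∙ x) (φ ∙ x)) (sym (∙-linˡ φ (-ℚ t) χ x))) (≤⇒0≤- (all≤ x x∈))) ,
        a , a∈ , posa , trans (∙-linˡ φ (-ℚ t) χ a) (trans (cong (_+ℚ (-ℚ t) *ℚ χ ∙ a) (sym eq)) (lemma' t (χ ∙ a)))
      where
      lemma : ∀ t x y → y +ℚ -ℚ (t *ℚ x) ≡ y +ℚ (-ℚ t) *ℚ x
      lemma = solve-∀ ℚ-ring
      lemma' : ∀ t x → t *ℚ x +ℚ (-ℚ t) *ℚ x ≡ 0ℚ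
      lemma' = solve-∀ ℚ-ring

  zero? : (φ a : Pt) → Dec (φ ∙ a ≡ 0ℚ)
  zero? φ a = φ ∙ a ℚ.≟ 0ℚ

  Zeros NonZeros : List Pt → Pt → List Pt
  Zeros A φ = filter (zero? φ) A
  NonZeros A φ = filter (¬? ∘ zero? φ) A

  basis-kills : ∀ {A D ψ} (r : Rank A D) → (∀ a → a ∈ A → ψ ∙ a ≡ 0ℚ) → Kills ψ (Rank.basis r)
  basis-kills r kills = AllV.map (λ {t} → kills t) (Rank.basis⊆ r)

  -- A functional vanishing on the zero set of `φ` is fixed by its value at `z`, and κ is the ratio
  -- of the two values there. The point `z` need only lie in the span of `A`.
  spanned-facet : ∀ {A φ z k} {T : Vec Pt k} → φ ∙ z ≢ 0ℚ → InSpan A z → AllV (λ t → t ∈ A × φ ∙ t ≡ 0ℚ) T →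
    (∀ a → a ∈ A → Span (z ∷ T) a) → Facet A φ
  spanned-facet {A} {φ} {z} {T = T} φz≢0 z∈ T-zeros spans = ¬all⇒any (zero? φ) A (φz≢0 ∘ z∈ φ) , determined
    where
    r = proj₁ (inverse (φ ∙ z) φz≢0)
    determined : ∀ g → (∀ a → a ∈ A → φ ∙ a ≡ 0ℚ → g ∙ a ≡ 0ℚ) → Σ ℚ λ κ → ∀ a → a ∈ A → g ∙ a ≡ κ *ℚ φ ∙ a
    determined g kills = κ , λ a a∈ → trans (agree-span {f = g} {κ • φ} (at-z ∷ AllV.map at-T T-zeros) (spans a a∈)) (∙-scaleˡ κ φ a)
      where
      κ = g ∙ z *ℚ r
      at-z : g ∙ z ≡ (κ • φ) ∙ z
      at-z = sym (trans (∙-scaleˡ κ φ z) (trans (ℚ.*-assoc (g ∙ z) r (φ ∙ z))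
        (trans (cong (g ∙ z *ℚ_) (proj₂ (inverse (φ ∙ z) φz≢0))) (ℚ.*-identityʳ (g ∙ z)))))
      at-T : ∀ {t} → t ∈ A × φ ∙ t ≡ 0ℚ → g ∙ t ≡ (κ • φ) ∙ t
      at-T {t} (t∈ , φt) = trans (kills t t∈ φt) (sym (trans (∙-scaleˡ κ φ t) (trans (cong (κ *ℚ_) φt) (ℚ.*-zeroʳ κ))))

  Rotated : List Pt → Pt → Pt → Set
  Rotated A φ z = Σ Pt λ ψ → Nonneg A ψ × Facet A ψ × ψ ∙ z ≡ φ ∙ z × (∀ a → a ∈ A → φ ∙ a ≡ 0ℚ → ψ ∙ a ≡ 0ℚ)

  -- If the zero set of φ together with z does not span A, then φ can be tilted about it until a
  -- further point of A is hit, keeping the value at z.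
  rotate : ∀ A z → InSpan A z → ∀ φ → Nonneg A φ → φ ∙ z ≢ 0ℚ → Rotated A φ z
  rotate A z z∈ φ₀ = go (suc (length (NonZeros A φ₀))) φ₀ ℕ.≤-refl
    where
    -- `k` exceeds the number of points at which `φ` is nonzero. The direction `χ` vanishes at `z`
    -- and at all zeros of `φ` in `A`, so a tilt keeps these zeros and adds `b`.
    go : ∀ k φ → length (NonZeros A φ) < k → Nonneg A φ → φ ∙ z ≢ 0ℚ → Rotated A φ z
    go (suc k) φ bound nonneg φz≢0 with rank-of (Zeros A φ)
    ... | m , r@(rank T T⊆ _ T-spans) with all-dec (span? (z ∷ T)) A
    ...   | yes spans = φ , nonneg , spanned-facet φz≢0 z∈ (AllV.map (∈-filter⁻ (zero? φ) {xs = A}) T⊆) spans , refl , λ _ _ eq → eq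
    ...   | no ¬spans with ¬all⇒any (span? (z ∷ T)) A ¬spans
    ...     | a , a∈ , ¬s with separate ¬s
    ...       | χ , χz ∷ χT , χa with tilt A φ χ a nonneg a∈ (subst (0ℚ <ℚ_) (sym χa) 0<1ℚ)
    ...         | t , nonneg' , b , b∈ , posb , zerob
        = let ψ , nonnegψ , facetψ , ψz , sub = go k φ' (ℕ.<-≤-trans fewer (ℕ.≤-pred bound)) nonneg' (λ eq → φz≢0 (trans (sym (keep χz)) eq))
          in ψ , nonnegψ , facetψ , trans ψz (keep χz) , λ x x∈ φx → sub x x∈ (trans (keep (χzero x x∈ φx)) φx)
      where
      φ' = φ ⊕ (-ℚ t) • χ
      keep : ∀ {x} → χ ∙ x ≡ 0ℚ → φ' ∙ x ≡ φ ∙ x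
      keep {x} χx = trans (∙-linˡ φ (-ℚ t) χ x) (trans (cong (λ u → φ ∙ x +ℚ (-ℚ t) *ℚ u) χx)
        (trans (cong (φ ∙ x +ℚ_) (ℚ.*-zeroʳ (-ℚ t))) (ℚ.+-identityʳ _)))
      χzero : ∀ x → x ∈ A → φ ∙ x ≡ 0ℚ → χ ∙ x ≡ 0ℚ
      χzero x x∈ φx = kills-span χT (T-spans x (∈-filter⁺ (zero? φ) x∈ φx))
      fewer : length (NonZeros A φ') < length (NonZeros A φ)
      fewer = filter-mono-< (¬? ∘ zero? φ') (¬? ∘ zero? φ) A
        (λ x x∈ ≢0 φx → ≢0 (trans (keep (χzero x x∈ φx)) φx)) b∈
        (λ φb → 0<⇒≢0 posb (χzero b b∈ φb)) (λ ≢0 → ≢0 zerob)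

-- Facets of two-level sets

*-cancel-zero : ∀ {x y} → x *ℚ y ≡ 0ℚ → y ≢ 0ℚ → x ≡ 0ℚ
*-cancel-zero {x} {y} eq y≢0 with inverse y y≢0
... | r , ry = begin
  x                ≡⟨ sym (ℚ.*-identityʳ x) ⟩
  x *ℚ 1ℚ          ≡⟨ cong (x *ℚ_) (trans (sym ry) (ℚ.*-comm r y)) ⟩
  x *ℚ (y *ℚ r)    ≡⟨ sym (ℚ.*-assoc x y r) ⟩
  (x *ℚ y) *ℚ r    ≡⟨ cong (_*ℚ r) eq ⟩
  0ℚ *ℚ r          ≡⟨ ℚ.*-zeroˡ r ⟩
  0ℚ               ∎
  where open ≡-Reasoning

module _ {M : ℕ} where

  ∈-zeros⁻ : ∀ {A} {φ t : Vec ℚ M} → t ∈ Zeros A φ → t ∈ A × φ ∙ t ≡ 0ℚ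
  ∈-zeros⁻ {A} {φ} = ∈-filter⁻ (zero? φ) {xs = A}

  ∈-zeros⁺ : ∀ {A} {φ t : Vec ℚ M} → t ∈ A → φ ∙ t ≡ 0ℚ → t ∈ Zeros A φ
  ∈-zeros⁺ {φ = φ} = ∈-filter⁺ (zero? φ)

  ∈-nonzeros⁻ : ∀ {A} {φ t : Vec ℚ M} → t ∈ NonZeros A φ → t ∈ A × φ ∙ t ≢ 0ℚ
  ∈-nonzeros⁻ {A} {φ} = ∈-filter⁻ (¬? ∘ zero? φ) {xs = A}

  ∈-nonzeros⁺ : ∀ {A} {φ t : Vec ℚ M} → t ∈ A → φ ∙ t ≢ 0ℚ → t ∈ NonZeros A φ
  ∈-nonzeros⁺ {φ = φ} = ∈-filter⁺ (¬? ∘ zero? φ)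

  bin-nonzero : ∀ {A} {f a : Vec ℚ M} → Bin A f → a ∈ A → f ∙ a ≢ 0ℚ → f ∙ a ≡ 1ℚ
  bin-nonzero bin a∈ ≢0 with bin _ a∈
  ... | inj₁ eq = ⊥-elim (≢0 eq)
  ... | inj₂ eq = eq

  bin-nonneg : ∀ {A} {f : Vec ℚ M} → Bin A f → Nonneg A f
  bin-nonneg bin a a∈ with bin a a∈
  ... | inj₁ eq = ℚ.≤-reflexive (sym eq)
  ... | inj₂ eq = subst (0ℚ ≤ℚ_) (sym eq) 0≤1ℚ

  facet-determined : ∀ {A} {f : Vec ℚ M} → Facet A f → ∀ g → (∀ a → a ∈ Zeros A f → g ∙ a ≡ 0ℚ) →
    Σ ℚ λ κ → ∀ a → a ∈ A → g ∙ a ≡ κ *ℚ f ∙ a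
  facet-determined (_ , det) g kills = det g λ a a∈ fa → kills a (∈-zeros⁺ a∈ fa)

  Normalised : List (Vec ℚ M) → Vec ℚ M → Set
  Normalised A ψ = Σ (Vec ℚ M) λ f → Bin A f × Facet A f × Σ ℚ λ c → 0ℚ <ℚ c × (∀ x → ψ ∙ x ≡ c *ℚ f ∙ x)

  -- The values are 0 and some `c`, positive because `ψ` is nonnegative and not zero on `A`. The
  -- proportionality holds at every `x`, so signs at points outside `A` survive the normalisation.
  normalise : ∀ {A ψ} → TL A → Nonneg A ψ → Facet A ψ → Normalised A ψ
  normalise {A} {ψ} tl nonneg facet@((a , a∈ , ψa≢0) , det) with tl ψ nonneg facet
  ... | c , two with two a a∈
  ...   | inj₁ eq = ⊥-elim (ψa≢0 eq)
  ...   | inj₂ ψa≡c = r • ψ , bin , ((a , a∈ , fa≢0) , det') , c , 0<c , λ x →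
          sym (trans (cong (c *ℚ_) (∙-scaleˡ r ψ x)) (trans (sym (ℚ.*-assoc c r _))
            (trans (cong (_*ℚ ψ ∙ x) (trans (ℚ.*-comm c r) rc)) (ℚ.*-identityˡ _))))
    where
    0<c : 0ℚ <ℚ c
    0<c = subst (0ℚ <ℚ_) ψa≡c (≢0⇒0< (nonneg a a∈) ψa≢0)
    r = proj₁ (inverse c (0<⇒≢0 0<c))
    rc = proj₂ (inverse c (0<⇒≢0 0<c))
    scaled : ∀ {x v} → ψ ∙ x ≡ v → (r • ψ) ∙ x ≡ r *ℚ v
    scaled {x} refl = ∙-scaleˡ r ψ x
    bin : Bin A (r • ψ)
    bin x x∈ with two x x∈
    ... | inj₁ eq = inj₁ (trans (scaled eq) (ℚ.*-zeroʳ r))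
    ... | inj₂ eq = inj₂ (trans (scaled eq) rc)
    fa≢0 : (r • ψ) ∙ a ≢ 0ℚ
    fa≢0 eq = 1≢0ℚ (trans (sym (trans (scaled ψa≡c) rc)) eq)
    det' : ∀ g → (∀ x → x ∈ A → (r • ψ) ∙ x ≡ 0ℚ → g ∙ x ≡ 0ℚ) → Σ ℚ λ κ → ∀ x → x ∈ A → g ∙ x ≡ κ *ℚ (r • ψ) ∙ x
    det' g kills with det g (λ x x∈ ψx → kills x x∈ (trans (scaled ψx) (ℚ.*-zeroʳ r)))
    ... | κ , eq = κ *ℚ c , λ x x∈ → trans (eq x x∈) (sym (trans (cong ((κ *ℚ c) *ℚ_) (∙-scaleˡ r ψ x))
            (trans (lemma κ c r (ψ ∙ x)) (trans (cong (λ u → κ *ℚ (u *ℚ ψ ∙ x)) rc) (cong (κ *ℚ_) (ℚ.*-identityˡ _))))))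
      where
      lemma : ∀ κ c r x → (κ *ℚ c) *ℚ (r *ℚ x) ≡ κ *ℚ ((r *ℚ c) *ℚ x)
      lemma = solve-∀ ℚ-ring

  add-multiple : (A : List (Vec ℚ M)) (f ψ : Vec ℚ M) → Bin A f → (∀ a → a ∈ A → f ∙ a ≡ 0ℚ → 0ℚ ≤ℚ ψ ∙ a) →
    Σ ℚ λ t → Nonneg A (ψ ⊕ t • f)
  add-multiple A f ψ bin pos = let t , _ , nonneg = go A bin pos in t , nonneg
    where
    lemma₀ : ∀ x t → x +ℚ t *ℚ 0ℚ ≡ x
    lemma₀ = solve-∀ ℚ-ring
    lemma₁ : ∀ x t → x +ℚ t *ℚ 1ℚ ≡ t +ℚ -ℚ (-ℚ x)
    lemma₁ = solve-∀ ℚ-ring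
    value₀ : ∀ t {a} → f ∙ a ≡ 0ℚ → 0ℚ ≤ℚ ψ ∙ a → 0ℚ ≤ℚ (ψ ⊕ t • f) ∙ a
    value₀ t {a} eq 0≤ = subst (0ℚ ≤ℚ_) (sym (trans (∙-linˡ ψ t f a)
      (trans (cong (λ u → ψ ∙ a +ℚ t *ℚ u) eq) (lemma₀ (ψ ∙ a) t)))) 0≤
    value₁ : ∀ t {a} → f ∙ a ≡ 1ℚ → -ℚ (ψ ∙ a) ≤ℚ t → 0ℚ ≤ℚ (ψ ⊕ t • f) ∙ a
    value₁ t {a} eq le = subst (0ℚ ≤ℚ_) (sym (trans (∙-linˡ ψ t f a)
      (trans (cong (λ u → ψ ∙ a +ℚ t *ℚ u) eq) (lemma₁ (ψ ∙ a) t)))) (≤⇒0≤- le)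
    -- All larger multiples are claimed as well, so that the maximum with the threshold of the next
    -- point is admissible.
    go : ∀ A → Bin A f → (∀ a → a ∈ A → f ∙ a ≡ 0ℚ → 0ℚ ≤ℚ ψ ∙ a) →
      Σ ℚ λ t → (∀ t' → t ≤ℚ t' → Nonneg A (ψ ⊕ t' • f)) × Nonneg A (ψ ⊕ t • f)
    go [] _ _ = 0ℚ , (λ _ _ _ ()) , λ _ ()
    go (x ∷ A) bin pos with go A (λ a → bin a ∘ there) (λ a → pos a ∘ there)
    ... | t , mono , nonneg = t' , mono' , mono' t' ℚ.≤-refl
      where
      t' = t ℚ.⊔ (-ℚ (ψ ∙ x))
      mono' : ∀ t'' → t' ≤ℚ t'' → Nonneg (x ∷ A) (ψ ⊕ t'' • f)
      mono' t'' le a (there a∈) = mono t'' (ℚ.≤-trans (ℚ.p≤p⊔q t (-ℚ (ψ ∙ x))) le) a a∈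
      mono' t'' le _ (here refl) with bin x (here refl)
      ... | inj₁ eq = value₀ t'' eq (pos x (here refl) eq)
      ... | inj₂ eq = value₁ t'' eq (ℚ.≤-trans (ℚ.p≤q⊔p t (-ℚ (ψ ∙ x))) le)

  -- Every facet of the facet `f = 0` is cut out by another facet of `A`: a functional nonnegative
  -- on `f = 0` becomes nonnegative on `A` after adding a multiple of `f`, and the least such
  -- multiple creates a zero off `f = 0`.
  facet-TL : ∀ {A : List (Vec ℚ M)} {f} → TL A → Bin A f → Facet A f → TL (Zeros A f)
  facet-TL {A} {f} tl bin ((z , z∈ , fz≢0) , det) ψ nonneg ((w , w∈ , ψw≢0) , detψ) =
    proj₁ two , λ a a∈ → subst (λ u → u ≡ 0ℚ ⊎ u ≡ proj₁ two) (same a∈) (proj₂ two a (proj₁ (∈-zeros⁻ a∈)))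
    where
    raised = add-multiple A f ψ bin (λ a a∈ fa → nonneg a (∈-zeros⁺ a∈ fa))
    t₀ = proj₁ raised
    tilted = tilt A (ψ ⊕ t₀ • f) f z (proj₂ raised) z∈ (subst (0ℚ <ℚ_) (sym (bin-nonzero bin z∈ fz≢0)) 0<1ℚ)
    t = proj₁ tilted
    -- A facet inequality of the facet f = 0 becomes one of the whole polytope after adding a multiple of f.
    ψ' : Vec ℚ M
    ψ' = (ψ ⊕ t₀ • f) ⊕ (-ℚ t) • f
    nonneg' : Nonneg A ψ'
    nonneg' = proj₁ (proj₂ tilted)
    b : Vec ℚ M
    b = proj₁ (proj₂ (proj₂ tilted))
    at-b : b ∈ A × 0ℚ <ℚ f ∙ b × ψ' ∙ b ≡ 0ℚ
    at-b = proj₂ (proj₂ (proj₂ tilted))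
    same : ∀ {a} → a ∈ Zeros A f → ψ' ∙ a ≡ ψ ∙ a
    same {a} a∈ = trans (∙-linˡ (ψ ⊕ t₀ • f) (-ℚ t) f a) (trans (cong₂ (λ u v → u +ℚ (-ℚ t) *ℚ v) (∙-linˡ ψ t₀ f a) fa)
      (trans (cong (λ v → (ψ ∙ a +ℚ t₀ *ℚ v) +ℚ (-ℚ t) *ℚ 0ℚ) fa) (lemma (ψ ∙ a) t₀ t)))
      where
      fa = proj₂ (∈-zeros⁻ {A} {f} a∈)
      lemma : ∀ x t₀ t → (x +ℚ t₀ *ℚ 0ℚ) +ℚ (-ℚ t) *ℚ 0ℚ ≡ x
      lemma = solve-∀ ℚ-ring
    determined : ∀ g → (∀ a → a ∈ A → ψ' ∙ a ≡ 0ℚ → g ∙ a ≡ 0ℚ) → Σ ℚ λ κ → ∀ a → a ∈ A → g ∙ a ≡ κ *ℚ ψ' ∙ a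
    determined g kills = κ , λ a a∈ → difference (g ∙ a) (ψ' ∙ a) (trans (sym (∙-linˡ g (-ℚ κ) ψ' a))
        (trans (proj₂ rest a a∈) (trans (cong (_*ℚ f ∙ a) λ≡0) (ℚ.*-zeroˡ (f ∙ a)))))
      where
      onfacet : Σ ℚ λ κ → ∀ a → a ∈ Zeros A f → g ∙ a ≡ κ *ℚ ψ ∙ a
      onfacet = detψ g (λ a a∈ ψa → kills a (proj₁ (∈-zeros⁻ a∈)) (trans (same a∈) ψa))
      κ = proj₁ onfacet
      cancel : ∀ k x → k *ℚ x +ℚ (-ℚ k) *ℚ x ≡ 0ℚ
      cancel = solve-∀ ℚ-ring
      rest : Σ ℚ λ λ' → ∀ a → a ∈ A → (g ⊕ (-ℚ κ) • ψ') ∙ a ≡ λ' *ℚ f ∙ a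
      rest = det (g ⊕ (-ℚ κ) • ψ') (λ a a∈ fa → trans (∙-linˡ g (-ℚ κ) ψ' a)
              (trans (cong₂ (λ u v → u +ℚ (-ℚ κ) *ℚ v) (proj₂ onfacet a (∈-zeros⁺ a∈ fa)) (same (∈-zeros⁺ a∈ fa))) (cancel κ (ψ ∙ a))))
      expand : ∀ x k y → x ≡ (x +ℚ (-ℚ k) *ℚ y) +ℚ k *ℚ y
      expand = solve-∀ ℚ-ring
      difference : ∀ x y → x +ℚ (-ℚ κ) *ℚ y ≡ 0ℚ → x ≡ κ *ℚ y
      difference x y e = trans (expand x κ y) (trans (cong (_+ℚ κ *ℚ y) e) (ℚ.+-identityˡ (κ *ℚ y)))
      at-b-zero : proj₁ rest *ℚ f ∙ b ≡ 0ℚ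
      at-b-zero = trans (sym (proj₂ rest b (proj₁ at-b))) (trans (∙-linˡ g (-ℚ κ) ψ' b)
        (trans (cong₂ (λ u v → u +ℚ (-ℚ κ) *ℚ v) (kills b (proj₁ at-b) (proj₂ (proj₂ at-b))) (proj₂ (proj₂ at-b)))
          (trans (cong (0ℚ +ℚ_) (ℚ.*-zeroʳ (-ℚ κ))) refl)))
      -- On the facet `g` is `κ` times `ψ'`, so the difference is a multiple of `f` on `A`. At `b`
      -- both `g` and `ψ'` vanish but `f` does not, hence this multiple is zero.
      λ≡0 : proj₁ rest ≡ 0ℚ
      λ≡0 = *-cancel-zero at-b-zero (0<⇒≢0 (proj₁ (proj₂ at-b)))
    two : Σ ℚ λ c → ∀ a → a ∈ A → ψ' ∙ a ≡ 0ℚ ⊎ ψ' ∙ a ≡ c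
    two = tl ψ' nonneg' ((w , proj₁ (∈-zeros⁻ w∈) , λ eq → ψw≢0 (trans (sym (same w∈)) eq)) , determined)

  -- One point `z` off the facet completes a basis of the zero set to a basis of `A`: a functional
  -- killing both would be a multiple of `f`, and its vanishing at `z` makes the multiple zero.
  facet-rank : ∀ {A f D} → Rank A (suc D) → Facet A f → Rank (Zeros A f) D
  facet-rank {A} {f} {D} rA ((z , z∈ , fz≢0) , det) with rank-of (Zeros A f)
  ... | m , r@(rank T T⊆ ind spans) = subst (Rank (Zeros A f)) (ℕ.suc-injective (rank-unique rA' rA)) r
    where
    f-kills-T : Kills f T
    f-kills-T = AllV.map (λ t∈ → proj₂ (∈-zeros⁻ {A} {f} t∈)) T⊆
    spans-A : ∀ a → a ∈ A → Span (z ∷ T) a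
    spans-A a a∈ with fredholm (z ∷ T) a
    ... | inj₁ s = s
    ... | inj₂ (χ , χz ∷ χT , χa) with det χ (λ b b∈ fb → kills-span χT (spans b (∈-zeros⁺ b∈ fb)))
    ...   | κ , eq = ⊥-elim (1≢0ℚ (trans (sym χa) (trans (eq a a∈)
            (trans (cong (_*ℚ f ∙ a) (*-cancel-zero {κ} (trans (sym (eq z z∈)) χz) fz≢0)) (ℚ.*-zeroˡ (f ∙ a))))))
    rA' : Rank A (suc m)
    rA' = rank (z ∷ T) (z∈ ∷ AllV.map (λ t∈ → proj₁ (∈-zeros⁻ {A} {f} t∈)) T⊆)
      ((λ s → fz≢0 (kills-span f-kills-T s)) , ind) spans-A

  -- Rotating ℓ + t h about w, where ℓ ∙ w ≠ 0, ends in a facet functional that does not vanish at w.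
  bin-separate : ∀ {A : List (Vec ℚ M)} {h w} → TL A → (∀ a → a ∈ A → h ∙ a ≡ 1ℚ) → InSpan A w →
    (∀ g → Bin A g → g ∙ w ≡ 0ℚ) → w ≡ 0v
  bin-separate {A} {h} {w} tl hom w∈ kills with w ≟v 0v
  ... | yes eq = eq
  ... | no w≢0 = ⊥-elim (1≢0ℚ absurd)
    where
    ℓ = proj₁ (dual-nonzero w w≢0)
    ℓw = proj₂ (dual-nonzero w w≢0)
    above = add-multiple A h ℓ (λ a a∈ → inj₂ (hom a a∈)) (λ a a∈ ha → ⊥-elim (1≢0ℚ (trans (sym (hom a a∈)) ha)))
    t = proj₁ above
    φ = ℓ ⊕ t • h
    φw : φ ∙ w ≡ 1ℚ
    φw = trans (∙-linˡ ℓ t h w) (trans (cong₂ (λ u v → u +ℚ t *ℚ v) ℓw (kills h (λ a a∈ → inj₂ (hom a a∈))))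
      (trans (cong (1ℚ +ℚ_) (ℚ.*-zeroʳ t)) refl))
    absurd : 1ℚ ≡ 0ℚ
    absurd = let ψ , nonneg , facet , ψw , _ = rotate A w w∈ φ (proj₂ above) (λ eq → 1≢0ℚ (trans (sym φw) eq))
                 f , bin , _ , c , _ , eq = normalise tl nonneg facet
             in trans (sym φw) (trans (sym ψw) (trans (eq w) (trans (cong (c *ℚ_) (kills f bin)) (ℚ.*-zeroʳ c))))

-- Representatives of the two-valued functionals

does-true : ∀ {P : Set} (P? : Dec P) → does P? ≡ true → P
does-true (yes p) _ = p

bin? : ∀ x → Dec (x ≡ 0ℚ ⊎ x ≡ 1ℚ)
bin? x = (x ℚ.≟ 0ℚ) ⊎-dec (x ℚ.≟ 1ℚ)

module _ {M : ℕ} where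

  -- A transversal of the functionals with values in {0,1}, modulo agreement on `A`. The length of
  -- `L` is the number β(A) of the overview.
  record Sys (A L : List (Vec ℚ M)) : Set where
    field
      bin : ∀ f → f ∈ L → Bin A f
      distinct : AllPairs (λ f g → ¬ Agree A f g) L
      complete : ∀ f → Bin A f → Σ (Vec ℚ M) λ g → g ∈ L × Agree A f g

  private
    with-value : Vec ℚ M → Vec ℚ M → ℚ → Vec ℚ M → Vec ℚ M
    with-value χ a v f = f ⊕ (v +ℚ -ℚ (f ∙ a)) • χ

    with-value-at : ∀ {χ a} v f → χ ∙ a ≡ 1ℚ → with-value χ a v f ∙ a ≡ v
    with-value-at {χ} {a} v f χa = trans (∙-linˡ f (v +ℚ -ℚ (f ∙ a)) χ a)
      (trans (cong (λ u → f ∙ a +ℚ (v +ℚ -ℚ (f ∙ a)) *ℚ u) χa) (lemma (f ∙ a) v))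
      where
      lemma : ∀ x v → x +ℚ (v +ℚ -ℚ x) *ℚ 1ℚ ≡ v
      lemma = solve-∀ ℚ-ring

    with-value-off : ∀ {χ a b} v f → χ ∙ b ≡ 0ℚ → with-value χ a v f ∙ b ≡ f ∙ b
    with-value-off {χ} {a} {b} v f χb = trans (∙-linˡ f (v +ℚ -ℚ (f ∙ a)) χ b)
      (trans (cong (λ u → f ∙ b +ℚ (v +ℚ -ℚ (f ∙ a)) *ℚ u) χb) (lemma (f ∙ b) (v +ℚ -ℚ (f ∙ a))))
      where
      lemma : ∀ x v → x +ℚ v *ℚ 0ℚ ≡ x
      lemma = solve-∀ ℚ-ring

  -- Points are added one at a time. A point in the span of the earlier ones filters the list by the
  -- value it forces; an independent point doubles the list, since both values can be prescribed
  -- there.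
  sys-exists : (A : List (Vec ℚ M)) → Σ (List (Vec ℚ M)) (Sys A)
  sys-exists [] = 0v ∷ [] , record
    { bin = λ _ _ _ ()
    ; distinct = [] ∷ []
    ; complete = λ _ _ → 0v , here refl , λ _ () }
  sys-exists (a ∷ A) with sys-exists A | rank-of A
  ... | L , sys | m , rank T T⊆ ind spans with fredholm T a
  ...   | inj₁ s = filter (λ f → bin? (f ∙ a)) L , record { bin = bin' ; distinct = distinct' ; complete = complete' }
    where
    open Sys sys
    bin' : ∀ f → f ∈ filter (λ f → bin? (f ∙ a)) L → Bin (a ∷ A) f
    bin' f f∈ with ∈-filter⁻ (λ f → bin? (f ∙ a)) {xs = L} f∈
    ... | f∈L , fa = λ where
      _ (here refl) → fa
      b (there b∈) → bin f f∈L b b∈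
    distinct' : AllPairs (λ f g → ¬ Agree (a ∷ A) f g) (filter (λ f → bin? (f ∙ a)) L)
    distinct' = AllPairs.filter⁺ (λ f → bin? (f ∙ a)) (AllPairs.map (λ ¬agree agree → ¬agree (λ b → agree b ∘ there)) distinct)
    complete' : ∀ f → Bin (a ∷ A) f → Σ (Vec ℚ M) λ g → g ∈ filter (λ f → bin? (f ∙ a)) L × Agree (a ∷ A) f g
    complete' f fbin with complete f (λ b → fbin b ∘ there)
    ... | g , g∈ , agree = g , ∈-filter⁺ (λ f → bin? (f ∙ a)) g∈ (subst (λ u → u ≡ 0ℚ ⊎ u ≡ 1ℚ) at-a (fbin a (here refl))) , λ where
          _ (here refl) → at-a
          b (there b∈) → agree b b∈
      where
      at-a : f ∙ a ≡ g ∙ a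
      at-a = agree-span (AllV.map (λ {t} → agree t) T⊆) s
  ...   | inj₂ (χ , χT , χa) = List.map (with-value χ a 0ℚ) L ++ List.map (with-value χ a 1ℚ) L , record
          { bin = bin'
          ; distinct = AllPairs.++⁺ (distinct-half 0ℚ) (distinct-half 1ℚ) (All.map⁺ (All.tabulate λ {f} _ →
              All.map⁺ (All.tabulate λ {g} _ → λ agree → 1≢0ℚ (sym
                (trans (sym (with-value-at 0ℚ f χa)) (trans (agree a (here refl)) (with-value-at 1ℚ g χa)))))))
          ; complete = complete' }
    where
    open Sys sys
    χA : ∀ b → b ∈ A → χ ∙ b ≡ 0ℚ
    χA b b∈ = kills-span χT (spans b b∈)
    bin-half : ∀ v → v ≡ 0ℚ ⊎ v ≡ 1ℚ → ∀ f → f ∈ List.map (with-value χ a v) L → Bin (a ∷ A) f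
    bin-half v vbin f f∈ with ∈-map⁻ (with-value χ a v) f∈
    ... | g , g∈ , refl = λ where
      _ (here refl) → subst (λ u → u ≡ 0ℚ ⊎ u ≡ 1ℚ) (sym (with-value-at v g χa)) vbin
      b (there b∈) → subst (λ u → u ≡ 0ℚ ⊎ u ≡ 1ℚ) (sym (with-value-off v g (χA b b∈))) (bin g g∈ b b∈)
    bin' : ∀ f → f ∈ List.map (with-value χ a 0ℚ) L ++ List.map (with-value χ a 1ℚ) L → Bin (a ∷ A) f
    bin' f f∈ with ∈-++⁻ (List.map (with-value χ a 0ℚ) L) f∈
    ... | inj₁ p = bin-half 0ℚ (inj₁ refl) f p
    ... | inj₂ p = bin-half 1ℚ (inj₂ refl) f p
    distinct-half : ∀ v → AllPairs (λ f g → ¬ Agree (a ∷ A) f g) (List.map (with-value χ a v) L)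
    distinct-half v = AllPairs.map⁺ (AllPairs.map (λ {f} {g} ¬agree agree → ¬agree λ b b∈ →
      trans (sym (with-value-off v f (χA b b∈))) (trans (agree b (there b∈)) (with-value-off v g (χA b b∈)))) distinct)
    complete' : ∀ f → Bin (a ∷ A) f → Σ (Vec ℚ M) λ g →
      g ∈ List.map (with-value χ a 0ℚ) L ++ List.map (with-value χ a 1ℚ) L × Agree (a ∷ A) f g
    complete' f fbin with complete f (λ b → fbin b ∘ there) | fbin a (here refl)
    ... | g , g∈ , agree | inj₁ fa = with-value χ a 0ℚ g , ∈-++⁺ˡ (∈-map⁺ _ g∈) , λ where
          _ (here refl) → trans fa (sym (with-value-at 0ℚ g χa))
          b (there b∈) → trans (agree b b∈) (sym (with-value-off 0ℚ g (χA b b∈)))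
    ... | g , g∈ , agree | inj₂ fa = with-value χ a 1ℚ g , ∈-++⁺ʳ _ (∈-map⁺ _ g∈) , λ where
          _ (here refl) → trans fa (sym (with-value-at 1ℚ g χa))
          b (there b∈) → trans (agree b b∈) (sym (with-value-off 1ℚ g (χA b b∈)))

-- Counting Boolean vectors

count : ∀ m → (Vec Bool m → Bool) → ℕ
count zero P = if P [] then 1 else 0
count (suc m) P = count m (P ∘ (true ∷_)) + count m (P ∘ (false ∷_))

codes : ∀ m → (Vec Bool m → Bool) → List (Vec Bool m)
codes zero P = if P [] then [] ∷ [] else []
codes (suc m) P = List.map (true ∷_) (codes m (P ∘ (true ∷_))) ++ List.map (false ∷_) (codes m (P ∘ (false ∷_)))

all-codes : ∀ m → List (Vec Bool m)
all-codes m = codes m (λ _ → true)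

length-codes : ∀ m P → length (codes m P) ≡ count m P
length-codes zero P with P []
... | true = refl
... | false = refl
length-codes (suc m) P = trans (List.length-++ (List.map (true ∷_) (codes m (P ∘ (true ∷_)))))
  (cong₂ _+_ (trans (List.length-map _ (codes m (P ∘ (true ∷_)))) (length-codes m (P ∘ (true ∷_))))
             (trans (List.length-map _ (codes m (P ∘ (false ∷_)))) (length-codes m (P ∘ (false ∷_)))))

∈-codes : ∀ m P y → P y ≡ true → y ∈ codes m P
∈-codes zero P [] eq rewrite eq = here refl
∈-codes (suc m) P (true ∷ y) eq = ∈-++⁺ˡ (∈-map⁺ (true ∷_) (∈-codes m (P ∘ (true ∷_)) y eq))
∈-codes (suc m) P (false ∷ y) eq =
  ∈-++⁺ʳ (List.map (true ∷_) (codes m (P ∘ (true ∷_)))) (∈-map⁺ (false ∷_) (∈-codes m (P ∘ (false ∷_)) y eq))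

code-bound : ∀ {X : Set} {Sep : X → X → Set} {xs : List X} m (P : Vec Bool m → Bool) (code : X → Vec Bool m) →
  AllPairs Sep xs → (∀ x → x ∈ xs → P (code x) ≡ true) →
  (∀ {x x'} → x ∈ xs → x' ∈ xs → Sep x x' → code x ≡ code x' → ⊥) → length xs ≤ count m P
code-bound m P code sep good inj = subst (_ ≤_) (length-codes m P)
  (pigeonhole {R = λ x y → code x ≡ y} sep (λ x x∈ → code x , ∈-codes m P (code x) (good x x∈) , refl)
    λ x∈ x'∈ s eq eq' → inj x∈ x'∈ s (trans eq (sym eq')))

count-true : ∀ m → count m (λ _ → true) ≡ 2 ^ m
count-true zero = refl
count-true (suc m) rewrite count-true m | ℕ.+-identityʳ (2 ^ m) = refl

flip : ∀ {m} → Fin m → Vec Bool m → Vec Bool m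
flip i y = updateAt y i not

count-flip : ∀ m (i : Fin m) P → count m (P ∘ flip i) ≡ count m P
count-flip (suc m) zero P = ℕ.+-comm (count m (P ∘ (false ∷_))) (count m (P ∘ (true ∷_)))
count-flip (suc m) (suc i) P = cong₂ _+_ (count-flip m i (P ∘ (true ∷_))) (count-flip m i (P ∘ (false ∷_)))

count-not : ∀ m P → count m (P ∘ Vec.map not) ≡ count m P
count-not zero P = refl
count-not (suc m) P = trans (cong₂ _+_ (count-not m (P ∘ (false ∷_))) (count-not m (P ∘ (true ∷_))))
  (ℕ.+-comm (count m (P ∘ (false ∷_))) (count m (P ∘ (true ∷_))))

-- Meant for one predicate composed with four bijections of the cube: the four counts then coincide,
-- and each is at most three quarters of all vectors.
count-four : ∀ m (P Q R S : Vec Bool m → Bool) →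
  (∀ y → P y ≡ true → Q y ≡ true → R y ≡ true → S y ≡ true → ⊥) →
  (count m P + count m Q) + (count m R + count m S) ≤ 3 * 2 ^ m
count-four zero P Q R S no4 with P [] in p | Q [] in q | R [] in r | S [] in s
... | true | true | true | true = ⊥-elim (no4 [] p q r s)
... | true | true | true | false = ℕ.≤-refl
... | true | true | false | true = ℕ.≤-refl
... | true | false | true | true = ℕ.≤-refl
... | false | true | true | true = ℕ.≤-refl
... | true | true | false | false = s≤s (s≤s z≤n)
... | true | false | true | false = s≤s (s≤s z≤n)
... | true | false | false | true = s≤s (s≤s z≤n)
... | false | true | true | false = s≤s (s≤s z≤n)
... | false | true | false | true = s≤s (s≤s z≤n)
... | false | false | true | true = s≤s (s≤s z≤n)
... | true | false | false | false = s≤s z≤n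
... | false | true | false | false = s≤s z≤n
... | false | false | true | false = s≤s z≤n
... | false | false | false | true = s≤s z≤n
... | false | false | false | false = z≤n
count-four (suc m) P Q R S no4 = subst₂ _≤_
  (interchange (count m (P ∘ (true ∷_))) (count m (P ∘ (false ∷_))) (count m (Q ∘ (true ∷_))) (count m (Q ∘ (false ∷_)))
     (count m (R ∘ (true ∷_))) (count m (R ∘ (false ∷_))) (count m (S ∘ (true ∷_))) (count m (S ∘ (false ∷_))))
  (double (2 ^ m))
  (ℕ.+-mono-≤ (count-four m (P ∘ (true ∷_)) (Q ∘ (true ∷_)) (R ∘ (true ∷_)) (S ∘ (true ∷_)) (no4 ∘ (true ∷_)))
              (count-four m (P ∘ (false ∷_)) (Q ∘ (false ∷_)) (R ∘ (false ∷_)) (S ∘ (false ∷_)) (no4 ∘ (false ∷_))))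
  where
  interchange : ∀ p p' q q' r r' s s' →
    ((p + q) + (r + s)) + ((p' + q') + (r' + s')) ≡ ((p + p') + (q + q')) + ((r + r') + (s + s'))
  interchange = ℕSolver.solve-∀
  double : ∀ x → 3 * x + 3 * x ≡ 3 * (2 * x)
  double = ℕSolver.solve-∀

-- Affine functions on the Boolean cube

⟦_⟧ : Bool → ℚ
⟦ b ⟧ = if b then 1ℚ else 0ℚ

private
  lookup-flip-other : ∀ {m} (y : Vec Bool m) {i j} → i ≢ j → lookup (flip i y) j ≡ lookup y j
  lookup-flip-other y {i} {j} i≢j = Vec.lookup∘updateAt′ j i (i≢j ∘ sym) y

  signed : Bool → ℚ → ℚ
  signed b x = if b then -ℚ x else x

  signed≢0 : ∀ b {x} → x ≢ 0ℚ → signed b x ≢ 0ℚ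
  signed≢0 false x≢0 = x≢0
  signed≢0 true {x} x≢0 eq = x≢0 (trans (neg-neg x) (cong -ℚ_ eq))
    where
    neg-neg : ∀ x → x ≡ -ℚ (-ℚ x)
    neg-neg = solve-∀ ℚ-ring

∙-flip : ∀ {m} (β : Vec ℚ m) y i →
  β ∙ Vec.map ⟦_⟧ (flip i y) ≡ β ∙ Vec.map ⟦_⟧ y +ℚ signed (lookup y i) (lookup β i)
∙-flip (b ∷ β) (true ∷ y) zero = trans (∙-∷ b β _ _) (trans (lemma b (β ∙ Vec.map ⟦_⟧ y)) (cong (_+ℚ -ℚ b) (sym (∙-∷ b β _ _))))
  where
  lemma : ∀ b r → b *ℚ 0ℚ +ℚ r ≡ (b *ℚ 1ℚ +ℚ r) +ℚ -ℚ b
  lemma = solve-∀ ℚ-ring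
∙-flip (b ∷ β) (false ∷ y) zero = trans (∙-∷ b β _ _) (trans (lemma b (β ∙ Vec.map ⟦_⟧ y)) (cong (_+ℚ b) (sym (∙-∷ b β _ _))))
  where
  lemma : ∀ b r → b *ℚ 1ℚ +ℚ r ≡ (b *ℚ 0ℚ +ℚ r) +ℚ b
  lemma = solve-∀ ℚ-ring
∙-flip (b ∷ β) (x ∷ y) (suc i) = trans (∙-∷ b β _ _) (trans (cong (b *ℚ ⟦ x ⟧ +ℚ_) (∙-flip β y i))
  (trans (sym (ℚ.+-assoc (b *ℚ ⟦ x ⟧) _ _)) (cong (_+ℚ signed (lookup y i) (lookup β i)) (sym (∙-∷ b β _ _)))))

private
  complement : ∀ {x y} → x ≡ 0ℚ ⊎ x ≡ 1ℚ → y ≡ 0ℚ ⊎ y ≡ 1ℚ → x ≢ y → y ≡ 1ℚ +ℚ -ℚ x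
  complement (inj₁ refl) (inj₁ refl) x≢y = ⊥-elim (x≢y refl)
  complement (inj₁ refl) (inj₂ refl) _ = refl
  complement (inj₂ refl) (inj₁ refl) _ = refl
  complement (inj₂ refl) (inj₂ refl) x≢y = ⊥-elim (x≢y refl)

  shift≢ : ∀ v {x} → x ≢ 0ℚ → v ≢ v +ℚ x
  shift≢ v {x} x≢0 eq = x≢0 (trans (lemma v x) (trans (cong (_+ℚ -ℚ v) (sym eq)) (ℚ.+-inverseʳ v)))
    where
    lemma : ∀ v x → x ≡ (v +ℚ x) +ℚ -ℚ v
    lemma = solve-∀ ℚ-ring

  -- A nonzero step between two bits sends v to 1 - v. Hence x = y = 1 - 2v, whereas two successive
  -- steps lead back to v, so x + y = 0 and 2x = 0.
  no-binary-square : ∀ v x y → x ≢ 0ℚ → y ≢ 0ℚ → v ≡ 0ℚ ⊎ v ≡ 1ℚ → v +ℚ x ≡ 0ℚ ⊎ v +ℚ x ≡ 1ℚ →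
    v +ℚ y ≡ 0ℚ ⊎ v +ℚ y ≡ 1ℚ → (v +ℚ x) +ℚ y ≡ 0ℚ ⊎ (v +ℚ x) +ℚ y ≡ 1ℚ → ⊥
  no-binary-square v x y x≢0 y≢0 b₀ bx by bxy = x≢0 (*-cancel-zero {x} {1ℚ +ℚ 1ℚ} two-x λ ())
    where
    ex = complement b₀ bx (shift≢ v x≢0)
    ey = complement b₀ by (shift≢ v y≢0)
    exy = complement bx bxy (shift≢ (v +ℚ x) y≢0)
    lemma : ∀ v x y → x *ℚ (1ℚ +ℚ 1ℚ) ≡
      ((v +ℚ x) +ℚ -ℚ (1ℚ +ℚ -ℚ v)) +ℚ ((((v +ℚ x) +ℚ y) +ℚ -ℚ (1ℚ +ℚ -ℚ (v +ℚ x))) +ℚ -ℚ ((v +ℚ y) +ℚ -ℚ (1ℚ +ℚ -ℚ v))) +ℚ -ℚ ((v +ℚ x) +ℚ -ℚ (1ℚ +ℚ -ℚ v))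
    lemma = solve-∀ ℚ-ring
    diff : ∀ {a b} → a ≡ b → a +ℚ -ℚ b ≡ 0ℚ
    diff {a} refl = ℚ.+-inverseʳ a
    two-x : x *ℚ (1ℚ +ℚ 1ℚ) ≡ 0ℚ
    two-x = trans (lemma v x y) (cong₂ _+ℚ_ (cong₂ _+ℚ_ (diff ex) (cong₂ (λ a b → a +ℚ -ℚ b) (diff exy) (diff ey))) (cong -ℚ_ (diff ex)))

affine-value : ∀ {m} → ℚ → Vec ℚ m → Vec Bool m → ℚ
affine-value c β y = c +ℚ β ∙ Vec.map ⟦_⟧ y

-- Averaging over the flips of two coordinates on which the affine function depends:
-- it is not two-valued on any of the resulting squares.
affine-count : ∀ {m} c (β : Vec ℚ m) {i j} → i ≢ j → lookup β i ≢ 0ℚ → lookup β j ≢ 0ℚ →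
  4 * count m (λ y → does (bin? (affine-value c β y))) ≤ 3 * 2 ^ m
affine-count {m} c β {i} {j} i≢j βi βj = subst (_≤ 3 * 2 ^ m) total
  (count-four m P (P ∘ flip i) (P ∘ flip j) (P ∘ flip j ∘ flip i) no4)
  where
  P : Vec Bool m → Bool
  P y = does (bin? (affine-value c β y))
  sum4 : ∀ x → (x + x) + (x + x) ≡ 4 * x
  sum4 = ℕSolver.solve-∀
  total : (count m P + count m (P ∘ flip i)) + (count m (P ∘ flip j) + count m (P ∘ flip j ∘ flip i)) ≡ 4 * count m P
  total = trans (cong₂ _+_ (cong (count m P +_) (count-flip m i P))
    (cong₂ _+_ (count-flip m j P) (trans (count-flip m i (P ∘ flip j)) (count-flip m j P)))) (sum4 (count m P))
  good : ∀ y → P y ≡ true → affine-value c β y ≡ 0ℚ ⊎ affine-value c β y ≡ 1ℚ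
  good y = does-true (bin? (affine-value c β y))
  step : ∀ y i → affine-value c β (flip i y) ≡ affine-value c β y +ℚ signed (lookup y i) (lookup β i)
  step y i = trans (cong (c +ℚ_) (∙-flip β y i)) (sym (ℚ.+-assoc c _ _))
  no4 : ∀ y → P y ≡ true → P (flip i y) ≡ true → P (flip j y) ≡ true → P (flip j (flip i y)) ≡ true → ⊥
  no4 y p q r s = no-binary-square (affine-value c β y) (signed (lookup y i) (lookup β i)) (signed (lookup y j) (lookup β j))
    (signed≢0 (lookup y i) βi) (signed≢0 (lookup y j) βj) (good y p)
    (subst bin-at (step y i) (good (flip i y) q)) (subst bin-at (step y j) (good (flip j y) r))
    (subst bin-at (trans (step (flip i y) j) (cong₂ _+ℚ_ (step y i) (cong (λ b → signed b (lookup β j)) (lookup-flip-other y i≢j))))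
      (good (flip j (flip i y)) s))
    where
    bin-at : ℚ → Set
    bin-at x = x ≡ 0ℚ ⊎ x ≡ 1ℚ

data Support {m} (β : Vec ℚ m) : Set where
  no-support : β ≡ 0v → Support β
  one-support : ∀ i → (∀ (x : Vec ℚ m) → β ∙ x ≡ lookup β i *ℚ lookup x i) → lookup β i ≢ 0ℚ → Support β
  many-support : ∀ i j → i ≢ j → lookup β i ≢ 0ℚ → lookup β j ≢ 0ℚ → Support β

support : ∀ {m} (β : Vec ℚ m) → Support β
support [] = no-support refl
support (b ∷ β) with b ℚ.≟ 0ℚ | support β
... | yes refl | no-support refl = no-support refl
... | yes refl | one-support i eq ≢0 = one-support (suc i) (λ where
        (x ∷ xs) → trans (∙-∷ 0ℚ β x xs) (trans (cong (_+ℚ β ∙ xs) (ℚ.*-zeroˡ x)) (trans (ℚ.+-identityˡ _) (eq xs)))) ≢0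
... | yes refl | many-support i j i≢j p q = many-support (suc i) (suc j) (λ { refl → i≢j refl }) p q
... | no b≢0 | no-support refl = one-support zero (λ where
        (x ∷ xs) → trans (∙-∷ b 0v x xs) (trans (cong (b *ℚ x +ℚ_) (∙-zeroˡ xs)) (ℚ.+-identityʳ _))) b≢0
... | no b≢0 | one-support i _ ≢0 = many-support zero (suc i) (λ ()) b≢0 ≢0
... | no b≢0 | many-support i _ _ p _ = many-support zero (suc i) (λ ()) b≢0 p

-- Independence, complements and interpolation

module _ {M : ℕ} where

  ind-comb : ∀ {k} {T : Vec (Vec ℚ M) k} → Ind T → ∀ c → comb c T ≡ 0v → c ≡ 0v
  ind-comb {T = []} _ [] _ = refl
  ind-comb {T = t ∷ T} (t∉ , ind) (c ∷ cs) eq with c ℚ.≟ 0ℚ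
  ... | yes refl = cong (0ℚ ∷_) (ind-comb ind cs (trans (ext∙ λ f → lemma (f ∙ comb cs T) (f ∙ t) (∙-linʳ f (comb cs T) 0ℚ t)) eq))
    where
    lemma : ∀ {z} x y → z ≡ x +ℚ 0ℚ *ℚ y → x ≡ z
    lemma x y refl = simplify x y
      where
      simplify : ∀ x y → x ≡ x +ℚ 0ℚ *ℚ y
      simplify = solve-∀ ℚ-ring
  ... | no c≢0 = ⊥-elim (t∉ (subst (Span T) solved (span-scale (-ℚ r) (cs , refl))))
    where
    r = proj₁ (inverse c c≢0)
    solved : (-ℚ r) • comb cs T ≡ t
    solved = ext∙ λ f → begin
      f ∙ ((-ℚ r) • comb cs T)                           ≡⟨ ∙-scaleʳ f (-ℚ r) _ ⟩
      (-ℚ r) *ℚ f ∙ comb cs T                             ≡⟨ lemma r (f ∙ comb cs T) c (f ∙ t) ⟩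
      (r *ℚ c) *ℚ f ∙ t +ℚ (-ℚ r) *ℚ (f ∙ comb cs T +ℚ c *ℚ f ∙ t)
        ≡⟨ cong₂ (λ u v → u *ℚ f ∙ t +ℚ (-ℚ r) *ℚ v) (proj₂ (inverse c c≢0))
             (trans (sym (∙-linʳ f (comb cs T) c t)) (trans (cong (f ∙_) eq) (∙-zeroʳ f))) ⟩
      1ℚ *ℚ f ∙ t +ℚ (-ℚ r) *ℚ 0ℚ                         ≡⟨ lemma' r (f ∙ t) ⟩
      f ∙ t                                              ∎
      where
      open ≡-Reasoning
      lemma : ∀ r x c t → (-ℚ r) *ℚ x ≡ (r *ℚ c) *ℚ t +ℚ (-ℚ r) *ℚ (x +ℚ c *ℚ t)
      lemma = solve-∀ ℚ-ring
      lemma' : ∀ r t → 1ℚ *ℚ t +ℚ (-ℚ r) *ℚ 0ℚ ≡ t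
      lemma' = solve-∀ ℚ-ring

  span-++ʳ : ∀ {k m} (S : Vec (Vec ℚ M) k) {T : Vec (Vec ℚ M) m} {x} → Span T x → Span (S Vec.++ T) x
  span-++ʳ [] s = s
  span-++ʳ (_ ∷ S) s = span-there (span-++ʳ S s)

  -- The coefficients are chosen before the functional: modulo the span of `T`, the point `x` is one
  -- fixed combination of `S`.
  span-++ : ∀ {k m} (S : Vec (Vec ℚ M) k) {T : Vec (Vec ℚ M) m} {x} → Span (S Vec.++ T) x →
    Σ (Vec ℚ k) λ β → ∀ f → Kills f T → f ∙ x ≡ β ∙ values f S
  span-++ [] s = [] , λ f kills → trans (kills-span kills s) (sym (∙-zeroʳ []))
  span-++ (s ∷ S) {T} ((c ∷ cs) , refl) with span-++ S {T} (cs , refl)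
  ... | β , eq = (c ∷ β) , λ f kills → trans (∙-linʳ f (comb cs (S Vec.++ T)) c s)
        (trans (ℚ.+-comm (f ∙ comb cs (S Vec.++ T)) (c *ℚ f ∙ s)) (trans (cong (c *ℚ f ∙ s +ℚ_) (eq f kills)) (sym (∙-∷ c β _ _))))

  span-snoc : ∀ {k} (S : Vec (Vec ℚ M) k) {z x} → Span (S Vec.++ z ∷ []) x →
    Σ ℚ λ c → Σ (Vec ℚ k) λ β → comb β S ⊕ c • z ≡ x
  span-snoc [] ((c ∷ []) , eq) = c , [] , eq
  span-snoc (s ∷ S) {z} ((b ∷ cs) , refl) with span-snoc S {z} (cs , refl)
  ... | c , β , eq = c , (b ∷ β) , ext∙ λ f → begin
      f ∙ ((comb β S ⊕ b • s) ⊕ c • z)            ≡⟨ ∙-linʳ f _ c z ⟩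
      f ∙ (comb β S ⊕ b • s) +ℚ c *ℚ f ∙ z         ≡⟨ cong (_+ℚ c *ℚ f ∙ z) (∙-linʳ f (comb β S) b s) ⟩
      (f ∙ comb β S +ℚ b *ℚ f ∙ s) +ℚ c *ℚ f ∙ z   ≡⟨ lemma (f ∙ comb β S) (b *ℚ f ∙ s) (c *ℚ f ∙ z) ⟩
      (f ∙ comb β S +ℚ c *ℚ f ∙ z) +ℚ b *ℚ f ∙ s   ≡⟨ cong (_+ℚ b *ℚ f ∙ s) (trans (sym (∙-linʳ f (comb β S) c z)) (cong (f ∙_) eq)) ⟩
      f ∙ comb cs (S Vec.++ z ∷ []) +ℚ b *ℚ f ∙ s  ≡⟨ sym (∙-linʳ f _ b s) ⟩
      f ∙ (comb cs (S Vec.++ z ∷ []) ⊕ b • s)      ∎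
    where
    open ≡-Reasoning
    lemma : ∀ x y z → (x +ℚ y) +ℚ z ≡ (x +ℚ z) +ℚ y
    lemma = solve-∀ ℚ-ring

  values-comb : ∀ {k m} (β : Vec ℚ m) (fs : Vec (Vec ℚ M) m) (T : Vec (Vec ℚ M) k) →
    values (comb β fs) T ≡ comb β (Vec.map (λ f → values f T) fs)
  values-comb [] [] T = zeros T
    where
    zeros : ∀ {k} (T : Vec (Vec ℚ M) k) → values 0v T ≡ 0v
    zeros [] = refl
    zeros (t ∷ T) = cong₂ _∷_ (∙-zeroˡ t) (zeros T)
  values-comb (b ∷ β) (f ∷ fs) T = trans (values-lin (comb β fs) b f T) (cong (_⊕ b • values f T) (values-comb β fs T))

  values-agree : ∀ {k f g} {T : Vec (Vec ℚ M) k} → values f T ≡ values g T → AllV (λ t → f ∙ t ≡ g ∙ t) T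
  values-agree {T = []} _ = []
  values-agree {T = t ∷ T} eq = Vec.∷-injectiveˡ eq ∷ values-agree (Vec.∷-injectiveʳ eq)

  opp : Vec ℚ M → Vec ℚ M → Vec ℚ M
  opp h f = h ⊕ (-ℚ 1ℚ) • f

  opp-value : ∀ {h f a u v} → h ∙ a ≡ u → f ∙ a ≡ v → opp h f ∙ a ≡ u +ℚ -ℚ v
  opp-value {h} {f} {a} refl refl = trans (∙-linˡ h (-ℚ 1ℚ) f a) (lemma (h ∙ a) (f ∙ a))
    where
    lemma : ∀ x y → x +ℚ (-ℚ 1ℚ) *ℚ y ≡ x +ℚ -ℚ y
    lemma = solve-∀ ℚ-ring

  Homogeneous : Vec ℚ M → List (Vec ℚ M) → Set
  Homogeneous h A = ∀ a → a ∈ A → h ∙ a ≡ 1ℚ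

  opp-bin : ∀ {h A f} → Homogeneous h A → Bin A f → Bin A (opp h f)
  opp-bin hom bin a a∈ with bin a a∈
  ... | inj₁ eq = inj₂ (opp-value (hom a a∈) eq)
  ... | inj₂ eq = inj₁ (opp-value (hom a a∈) eq)

private
  std : ∀ n → Vec (Vec ℚ n) n
  std zero = []
  std (suc n) = (1ℚ ∷ 0v) ∷ Vec.map (0ℚ ∷_) (std n)

  opaque
    unfolding _⊕_

    ⊕-zero-cons : ∀ {n} c (x t : Vec ℚ n) → (0ℚ ∷ x) ⊕ c • (0ℚ ∷ t) ≡ 0ℚ ∷ (x ⊕ c • t)
    ⊕-zero-cons c x t = cong (_∷ (x ⊕ c • t)) (trans (ℚ.+-identityˡ _) (ℚ.*-zeroʳ c))

    ⊕-unit-cons : ∀ {n} c (x : Vec ℚ n) → (0ℚ ∷ x) ⊕ c • (1ℚ ∷ 0v) ≡ c ∷ x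
    ⊕-unit-cons c x = cong₂ _∷_ (trans (ℚ.+-identityˡ _) (ℚ.*-identityʳ c)) (tail x)
      where
      tail : ∀ {n} (y : Vec ℚ n) → y ⊕ c • 0v ≡ y
      tail [] = refl
      tail (y ∷ ys) = cong₂ _∷_ (trans (cong (y +ℚ_) (ℚ.*-zeroʳ c)) (ℚ.+-identityʳ y)) (tail ys)

  std-comb : ∀ {n k} (c : Vec ℚ k) (T : Vec (Vec ℚ n) k) → comb c (Vec.map (0ℚ ∷_) T) ≡ 0ℚ ∷ comb c T
  std-comb [] [] = refl
  std-comb (c ∷ cs) (t ∷ T) = trans (cong (_⊕ c • (0ℚ ∷ t)) (std-comb cs T)) (⊕-zero-cons c (comb cs T) t)

  std-ind : ∀ n → Ind (std n)
  std-ind zero = tt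
  std-ind (suc n) = head∉ , shifted (std n) (std-ind n)
    where
    head∉ : ¬ Span (Vec.map (0ℚ ∷_) (std n)) (1ℚ ∷ 0v)
    head∉ (c , eq) = 1≢0ℚ (sym (Vec.∷-injectiveˡ (trans (sym (std-comb c (std n))) eq)))
    shifted : ∀ {n k} (T : Vec (Vec ℚ n) k) → Ind T → Ind (Vec.map (0ℚ ∷_) T)
    shifted [] _ = tt
    shifted (t ∷ T) (t∉ , ind) = (λ s → t∉ (proj₁ s , Vec.∷-injectiveʳ (trans (sym (std-comb (proj₁ s) T)) (proj₂ s)))) , shifted T ind

  std-spans : ∀ n (x : Vec ℚ n) → Span (std n) x
  std-spans zero [] = [] , refl
  std-spans (suc n) (x ∷ xs) with std-spans n xs
  ... | c , refl = (x ∷ c) , trans (cong (_⊕ x • (1ℚ ∷ 0v)) (std-comb c (std n))) (⊕-unit-cons x (comb c (std n)))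

full-span : ∀ {M} {T : Vec (Vec ℚ M) M} → Ind T → ∀ x → Span T x
full-span {M} {T} ind x with span? T x
... | yes s = s
... | no x∉ = ⊥-elim (ℕ.<-irrefl refl (steinitz {T = x ∷ T} (x∉ , ind) (AllV.universal (std-spans M) (x ∷ T))))

interpolate : ∀ {M k} {T : Vec (Vec ℚ M) k} → Ind T → ∀ y → Σ (Vec ℚ M) λ f → values f T ≡ y
interpolate {T = []} _ [] = 0v , refl
interpolate {T = t ∷ T} (t∉ , ind) (y ∷ ys) = g , cong₂ _∷_ at-t (at-T T φT (proj₂ rec))
  where
  rec = interpolate ind ys
  f = proj₁ rec
  φ = proj₁ (separate t∉)
  φT = proj₁ (proj₂ (separate t∉))
  g = f ⊕ (y +ℚ -ℚ (f ∙ t)) • φ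
  lemma : ∀ x y → x +ℚ (y +ℚ -ℚ x) *ℚ 1ℚ ≡ y
  lemma = solve-∀ ℚ-ring
  lemma' : ∀ x v → x +ℚ v *ℚ 0ℚ ≡ x
  lemma' = solve-∀ ℚ-ring
  at-t : g ∙ t ≡ y
  at-t = trans (∙-linˡ f _ φ t) (trans (cong (λ u → f ∙ t +ℚ (y +ℚ -ℚ (f ∙ t)) *ℚ u) (proj₂ (proj₂ (separate t∉)))) (lemma (f ∙ t) y))
  at-T : ∀ {k} {ys} (T : Vec _ k) → Kills φ T → values f T ≡ ys → values g T ≡ ys
  at-T [] [] eq = eq
  at-T (s ∷ T) (p ∷ ps) refl = cong₂ _∷_
    (trans (∙-linˡ f _ φ s) (trans (cong (λ u → f ∙ s +ℚ (y +ℚ -ℚ (f ∙ t)) *ℚ u) p) (lemma' (f ∙ s) (y +ℚ -ℚ (f ∙ t))))) (at-T T ps refl)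

-- Coordinates chosen among two-valued functionals

module _ {M : ℕ} where

  -- Together with h, the coordinates form a basis of the functionals on the span of G.
  record DualBasis (h : Vec ℚ M) (G : List (Vec ℚ M)) (R : ℕ) (L : List (Vec ℚ M)) : Set where
    field
      size : ℕ
      size≡ : suc size ≡ R
      coords : Vec (Vec ℚ M) size
      coords⊆ : AllV (_∈ L) coords
      expand : ∀ g → Σ ℚ λ c → Σ (Vec ℚ size) λ β → ∀ x → x ∈ G → g ∙ x ≡ c +ℚ β ∙ Vec.map (_∙ x) coords
      realise : ∀ c y → Σ (Vec ℚ M) λ x → InSpan G x × h ∙ x ≡ c × Vec.map (_∙ x) coords ≡ y

  -- Functionals enter through their values on the basis `T` of `G`. The values of `h` and of a
  -- greedy choice from `L` span the whole value space: a vector `φ` orthogonal to them yields the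
  -- point `comb φ T`, at which all of `L` vanishes, so this point is 0 and `φ` with it.
  dual-basis : ∀ {h G R L} → Homogeneous h G → Rank G (suc R) →
    (∀ w → InSpan G w → (∀ g → g ∈ L → g ∙ w ≡ 0ℚ) → w ≡ 0v) → DualBasis h G (suc R) L
  dual-basis {h} {G} {R} {L} hom r@(rank T@(t ∷ _) T⊆@(t∈ ∷ _) indT spansT) sep = record
    { size = m
    ; size≡ = trans (sym (ℕ.+-comm m 1)) (ℕ.≤-antisym
        (steinitz ind (AllV.universal (std-spans (suc R)) W)) (steinitz (std-ind (suc R)) (AllV.universal all-span (std (suc R)))))
    ; coords = fs
    ; coords⊆ = proj₁ (proj₂ (proj₂ ext))
    ; expand = expand
    ; realise = realise }
    where
    ev : Vec ℚ M → Vec ℚ (suc R)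
    ev f = values f T
    base-ind : Ind (ev h ∷ [])
    base-ind = (λ s → 1≢0ℚ (trans (sym (hom t t∈)) (sym (Vec.∷-injectiveˡ (trans (span[] s) refl))))) , tt
      where
      span[] : ∀ {n} {x : Vec ℚ n} → Span [] x → 0v ≡ x
      span[] ([] , eq) = eq
    ext = extend ev L (ev h ∷ []) base-ind
    m = proj₁ ext
    fs = proj₁ (proj₂ ext)
    W = Vec.map ev fs Vec.++ ev h ∷ []
    ind : Ind W
    ind = proj₁ (proj₂ (proj₂ (proj₂ ext)))
    inspan : ∀ c → InSpan G (comb c T)
    inspan c ψ kills = kills-span (basis-kills r kills) (c , refl)
    all-span : ∀ x → Span W x
    all-span x with fredholm W x
    ... | inj₁ s = s
    ... | inj₂ (φ , φW , φx) = ⊥-elim (1≢0ℚ (trans (sym φx) (trans (cong (_∙ x) φ≡0) (∙-zeroˡ x))))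
      where
      φ≡0 : φ ≡ 0v
      φ≡0 = ind-comb indT φ (sep (comb φ T) (inspan φ) λ g g∈ →
        trans (∙-combʳ g φ T) (kills-span φW (proj₂ (proj₂ (proj₂ (proj₂ ext))) g g∈)))
    expand : ∀ g → Σ ℚ λ c → Σ (Vec ℚ m) λ β → ∀ x → x ∈ G → g ∙ x ≡ c +ℚ β ∙ Vec.map (_∙ x) fs
    expand g with span-snoc (Vec.map ev fs) (all-span (ev g))
    ... | c , β , eq = c , β , λ x x∈ → trans (agree-span {f = g} {comb β fs ⊕ c • h} (values-agree same) (spansT x x∈))
          (trans (∙-linˡ (comb β fs) c h x) (trans (ℚ.+-comm (comb β fs ∙ x) (c *ℚ h ∙ x))
            (cong₂ _+ℚ_ (trans (cong (c *ℚ_) (hom x x∈)) (ℚ.*-identityʳ c)) (∙-combˡ β fs x))))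
      where
      same : values g T ≡ values (comb β fs ⊕ c • h) T
      same = trans (sym eq) (sym (trans (values-lin (comb β fs) c h T) (cong (_⊕ c • ev h) (values-comb β fs T))))
    realise : ∀ c y → Σ (Vec ℚ M) λ x → InSpan G x × h ∙ x ≡ c × Vec.map (_∙ x) fs ≡ y
    realise c y with interpolate ind (y Vec.++ c ∷ [])
    ... | γ , eq = comb γ T , inspan γ , proj₂ (parts fs y eq) , proj₁ (parts fs y eq)
      where
      parts : ∀ {k} (fs : Vec (Vec ℚ M) k) (y : Vec ℚ k) → values γ (Vec.map ev fs Vec.++ ev h ∷ []) ≡ y Vec.++ c ∷ [] →
        Vec.map (_∙ comb γ T) fs ≡ y × h ∙ comb γ T ≡ c
      parts [] [] e = refl , trans (∙-combʳ h γ T) (Vec.∷-injectiveˡ e)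
      parts (f ∷ fs) (v ∷ y) e with parts fs y (Vec.∷-injectiveʳ e)
      ... | p , q = cong₂ _∷_ (trans (∙-combʳ f γ T) (Vec.∷-injectiveˡ e)) p , q

bit-value : ∀ {v} → v ≡ 0ℚ ⊎ v ≡ 1ℚ → ⟦ does (v ℚ.≟ 1ℚ) ⟧ ≡ v
bit-value (inj₁ refl) = refl
bit-value (inj₂ refl) = refl

module _ {M : ℕ} where

  agree? : ∀ G (f g : Vec ℚ M) → Dec (Agree G f g)
  agree? G f g = all-dec (λ a → f ∙ a ℚ.≟ g ∙ a) G

  agree-inspan : ∀ {G x} {f g : Vec ℚ M} → Agree G f g → InSpan G x → f ∙ x ≡ g ∙ x
  agree-inspan {G} {x} {f} {g} agree x∈ = zero-difference (f ∙ x) (g ∙ x) (trans (sym (∙-linˡ f (-ℚ 1ℚ) g x))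
    (x∈ (f ⊕ (-ℚ 1ℚ) • g) λ a a∈ → trans (∙-linˡ f (-ℚ 1ℚ) g a) (trans (cong (_+ℚ (-ℚ 1ℚ) *ℚ g ∙ a) (agree a a∈)) (cancel (g ∙ a)))))
    where
    cancel : ∀ x → x +ℚ (-ℚ 1ℚ) *ℚ x ≡ 0ℚ
    cancel = solve-∀ ℚ-ring
    rearrange : ∀ x y → x ≡ (x +ℚ (-ℚ 1ℚ) *ℚ y) +ℚ y
    rearrange = solve-∀ ℚ-ring
    zero-difference : ∀ x y → x +ℚ (-ℚ 1ℚ) *ℚ y ≡ 0ℚ → x ≡ y
    zero-difference x y e = trans (rearrange x y) (trans (cong (_+ℚ y) e) (ℚ.+-identityˡ y))

  code : ∀ {k} → Vec (Vec ℚ M) k → Vec ℚ M → Vec Bool k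
  code fs x = Vec.map (λ f → does (f ∙ x ℚ.≟ 1ℚ)) fs

  code-value : ∀ {k x} {fs : Vec (Vec ℚ M) k} → AllV (λ f → f ∙ x ≡ 0ℚ ⊎ f ∙ x ≡ 1ℚ) fs →
    Vec.map ⟦_⟧ (code fs x) ≡ Vec.map (_∙ x) fs
  code-value [] = refl
  code-value (b ∷ bs) = cong₂ _∷_ (bit-value b) (code-value bs)

  signs : ∀ {k} → Vec ℚ M → Vec (Vec ℚ M) k → List (Vec ℚ M) → List (Vec ℚ M)
  signs h [] tail = tail
  signs h (f ∷ fs) tail = f ∷ opp h f ∷ signs h fs tail

  length-signs : ∀ {k} h (fs : Vec (Vec ℚ M) k) tail → length (signs h fs tail) ≡ 2 * k + length tail
  length-signs h [] tail = refl
  length-signs {suc k} h (f ∷ fs) tail = trans (cong (λ u → suc (suc u)) (length-signs h fs tail)) (cong (λ u → suc u + length tail) (sym (ℕ.+-suc k (k + 0))))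

  signs-tail : ∀ {k h tail x} (fs : Vec (Vec ℚ M) k) → x ∈ tail → x ∈ signs h fs tail
  signs-tail [] x∈ = x∈
  signs-tail (f ∷ fs) x∈ = there (there (signs-tail fs x∈))

  signs-coord : ∀ {k h tail} (fs : Vec (Vec ℚ M) k) i → lookup fs i ∈ signs h fs tail
  signs-coord (f ∷ fs) zero = here refl
  signs-coord (f ∷ fs) (suc i) = there (there (signs-coord fs i))

  signs-opp : ∀ {k h tail} (fs : Vec (Vec ℚ M) k) i → opp h (lookup fs i) ∈ signs h fs tail
  signs-opp (f ∷ fs) zero = there (here refl)
  signs-opp (f ∷ fs) (suc i) = there (there (signs-opp fs i))

  signs-elim : ∀ {k h tail x} {P : Vec ℚ M → Set} (fs : Vec (Vec ℚ M) k) → (∀ {x} → x ∈ tail → P x) →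
    AllV P fs → AllV (P ∘ opp h) fs → x ∈ signs h fs tail → P x
  signs-elim [] pt _ _ x∈ = pt x∈
  signs-elim (f ∷ fs) pt (p ∷ ps) _ (here refl) = p
  signs-elim (f ∷ fs) pt _ (q ∷ qs) (there (here refl)) = q
  signs-elim (f ∷ fs) pt (_ ∷ ps) (_ ∷ qs) (there (there x∈)) = signs-elim fs pt ps qs x∈

  module _ {h : Vec ℚ M} {G : List (Vec ℚ M)} where

    Realises : ∀ {k} → Vec (Vec ℚ M) k → Set
    Realises {k} fs = ∀ c y → Σ (Vec ℚ M) λ x → InSpan G x × h ∙ x ≡ c × Vec.map (_∙ x) fs ≡ y

    realises-tail : ∀ {k f} {fs : Vec (Vec ℚ M) k} → Realises (f ∷ fs) → Realises fs
    realises-tail real c y = let x , x∈ , hx , eq = real c (0ℚ ∷ y) in x , x∈ , hx , Vec.∷-injectiveʳ eq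

    private
      zeros-all : ∀ {k w} {fs : Vec (Vec ℚ M) k} → Vec.map (_∙ w) fs ≡ 0v → AllV (λ f → f ∙ w ≡ 0ℚ) fs
      zeros-all {fs = []} _ = []
      zeros-all {fs = f ∷ fs} eq = Vec.∷-injectiveˡ eq ∷ zeros-all (Vec.∷-injectiveʳ eq)

      opp-zero : ∀ {f w} → h ∙ w ≡ 0ℚ → f ∙ w ≡ 0ℚ → opp h f ∙ w ≡ 0ℚ
      opp-zero hw fw = opp-value hw fw

    VanishWith : List (Vec ℚ M) → Set
    VanishWith tail = ∀ {g w} → g ∈ tail → InSpan G w → h ∙ w ≡ 0ℚ → g ∙ w ≡ 0ℚ

    signs-vanish : ∀ {k tail w g} (fs : Vec (Vec ℚ M) k) → VanishWith tail → InSpan G w → h ∙ w ≡ 0ℚ → Vec.map (_∙ w) fs ≡ 0v →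
      g ∈ signs h fs tail → g ∙ w ≡ 0ℚ
    signs-vanish fs van w∈ hw fsw = signs-elim fs (λ g∈ → van g∈ w∈ hw) (zeros-all fsw) (AllV.map (opp-zero hw) (zeros-all fsw))

    -- Tested on a direction `w` with `h ∙ w ≡ 0` that is dual to the first coordinate: this
    -- coordinate is 1 there, its complement -1, and every later entry 0.
    signs-distinct : ∀ {k tail} (fs : Vec (Vec ℚ M) k) → Realises fs → VanishWith tail →
      AllPairs (λ f g → ¬ Agree G f g) tail → AllPairs (λ f g → ¬ Agree G f g) (signs h fs tail)
    signs-distinct [] real van pairs = pairs
    signs-distinct (f ∷ fs) real van pairs with real 0ℚ (1ℚ ∷ 0v)
    ... | w , w∈ , hw , eq =
        (differ (λ ()) fw ow ∷ All.tabulate (λ g∈ → differ (λ ()) fw (vanish g∈)))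
      ∷ All.tabulate (λ g∈ → differ (λ ()) ow (vanish g∈))
      ∷ signs-distinct fs (realises-tail real) van pairs
      where
      fw : f ∙ w ≡ 1ℚ
      fw = Vec.∷-injectiveˡ eq
      ow : opp h f ∙ w ≡ -ℚ 1ℚ
      ow = opp-value hw fw
      vanish : ∀ {g} → g ∈ signs h fs _ → g ∙ w ≡ 0ℚ
      vanish = signs-vanish fs van w∈ hw (Vec.∷-injectiveʳ eq)
      differ : ∀ {f g u v} → u ≢ v → f ∙ w ≡ u → g ∙ w ≡ v → ¬ Agree G f g
      differ u≢v fu gv agree = u≢v (trans (sym fu) (trans (agree-inspan agree w∈) gv))

    signs-nonconstant : ∀ {k} (fs : Vec (Vec ℚ M) k) → Realises fs → ∀ {g} → g ∈ signs h fs [] → ∀ κ → ¬ Agree G g (κ • h)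
    signs-nonconstant (f ∷ fs) real {g} g∈ κ agree with real 0ℚ (1ℚ ∷ 0v) | g∈
    ... | w , w∈ , hw , eq | here refl = 1≢0ℚ (trans (sym (Vec.∷-injectiveˡ eq)) (trans (agree-inspan agree w∈)
          (trans (∙-scaleˡ κ h w) (trans (cong (κ *ℚ_) hw) (ℚ.*-zeroʳ κ)))))
    ... | w , w∈ , hw , eq | there (here refl) = case trans (sym (opp-value {f = f} hw (Vec.∷-injectiveˡ eq))) (trans (agree-inspan agree w∈)
          (trans (∙-scaleˡ κ h w) (trans (cong (κ *ℚ_) hw) (ℚ.*-zeroʳ κ)))) of λ ()
    ... | _ | there (there g∈') = signs-nonconstant fs (realises-tail real) g∈' κ agree

  module Coordinates {h : Vec ℚ M} {G L : List (Vec ℚ M)} {R : ℕ} (hom : Homogeneous h G) (uniq : Unique G) (db : DualBasis h G R L) (bin : ∀ f → f ∈ L → Bin G f) where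
    open DualBasis db public

    coords-bin : AllV (Bin G) coords
    coords-bin = AllV.map (λ {f} → bin f) coords⊆

    code-at : ∀ x → x ∈ G → Vec.map ⟦_⟧ (code coords x) ≡ Vec.map (_∙ x) coords
    code-at x x∈ = code-value (AllV.map (λ b → b x x∈) coords-bin)

    constants : List (Vec ℚ M)
    constants = 0v ∷ h ∷ []

    -- The two-valued functionals that are always present: 0, `h`, the coordinates and their
    -- complements. A cube will be recognised by having no others.
    all-signs : List (Vec ℚ M)
    all-signs = signs h coords constants

    length-all-signs : length all-signs ≡ 2 * R
    length-all-signs = trans (length-signs h coords constants) (trans (ℕ.+-comm (2 * size) 2)
      (trans (sym (ℕ.*-suc 2 size)) (cong (2 *_) size≡)))

    -- Every functional is on `G` an affine function of the coordinates, so a point of `G` is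
    -- determined by its bits.
    points-bound : (P : Vec Bool size → Bool) → (∀ x → x ∈ G → P (code coords x) ≡ true) → length G ≤ count size P
    points-bound P good = code-bound size P (code coords) uniq good λ {x} {x'} x∈ x'∈ x≢x' eq → x≢x' (ext∙ λ g →
      let c , β , ex = expand g in trans (ex x x∈) (trans (cong (λ v → c +ℚ β ∙ v)
        (trans (sym (code-at x x∈)) (trans (cong (Vec.map ⟦_⟧) eq) (code-at x' x'∈)))) (sym (ex x' x'∈))))

    points-bound₂ : length G ≤ 2 ^ size
    points-bound₂ = subst (length G ≤_) (count-true size) (points-bound (λ _ → true) λ _ _ → refl)

    private
      vanish : VanishWith {h} {G} constants
      vanish {w = w} (here refl) w∈ hw = ∙-zeroˡ w
      vanish (there (here refl)) w∈ hw = hw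

    all-signs-distinct : ∀ {x} → x ∈ G → AllPairs (λ f g → ¬ Agree G f g) all-signs
    all-signs-distinct {x} x∈ = signs-distinct coords realise vanish
      (((λ agree → 1≢0ℚ (trans (sym (hom x x∈)) (trans (sym (agree x x∈)) (∙-zeroˡ x)))) ∷ []) ∷ [] ∷ [])

    all-signs-bin : ∀ {A f} → Homogeneous h A → (∀ f → f ∈ L → Bin A f) → f ∈ all-signs → Bin A f
    all-signs-bin {A} homA binA = signs-elim coords (λ where
        (here refl) a a∈ → inj₁ (∙-zeroˡ a)
        (there (here refl)) a a∈ → inj₂ (homA a a∈))
      (AllV.map (λ {f} → binA f) coords⊆) (AllV.map (λ {f} f∈ → opp-bin homA (binA f f∈)) coords⊆)

    -- A two-valued functional depending on at least two coordinates takes values in {0,1} on at most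
    -- three quarters of the codes; one depending on a single coordinate is a coordinate or its complement.
    points-three-quarters : ∀ g → Bin G g → (∀ f → f ∈ all-signs → ¬ Agree G g f) → 4 * length G ≤ 3 * 2 ^ size
    points-three-quarters g gbin new = by-support (support β)
      where
      c = proj₁ (expand g)
      β = proj₁ (proj₂ (expand g))
      ex = proj₂ (proj₂ (expand g))
      by-code : ∀ x → x ∈ G → g ∙ x ≡ affine-value c β (code coords x)
      by-code x x∈ = trans (ex x x∈) (cong (λ v → c +ℚ β ∙ v) (sym (code-at x x∈)))
      P : Vec Bool size → Bool
      P y = does (bin? (affine-value c β y))
      value-one : Σ (Vec ℚ M) λ x → x ∈ G × g ∙ x ≡ 1ℚ
      value-one with ¬all⇒any (λ x → g ∙ x ℚ.≟ 0v ∙ x) G (new 0v (signs-tail coords (here refl)))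
      ... | x , x∈ , ≢0 = x , x∈ , bin-nonzero gbin x∈ (λ eq → ≢0 (trans eq (sym (∙-zeroˡ x))))
      value-zero : Σ (Vec ℚ M) λ x → x ∈ G × g ∙ x ≡ 0ℚ
      value-zero with ¬all⇒any (λ x → g ∙ x ℚ.≟ h ∙ x) G (new h (signs-tail coords (there (here refl))))
      ... | x , x∈ , ≢1 with gbin x x∈
      ...   | inj₁ eq = x , x∈ , eq
      ...   | inj₂ eq = ⊥-elim (≢1 (trans eq (sym (hom x x∈))))
      by-support : Support β → 4 * length G ≤ 3 * 2 ^ size
      by-support (many-support i j i≢j βi βj) = ℕ.≤-trans (ℕ.*-monoʳ-≤ 4 (points-bound P λ x x∈ →
        dec-true (bin? _) (subst (λ v → v ≡ 0ℚ ⊎ v ≡ 1ℚ) (by-code x x∈) (gbin x x∈)))) (affine-count c β i≢j βi βj)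
      by-support (no-support β≡0) = ⊥-elim (1≢0ℚ (trans (sym (proj₂ (proj₂ value-one))) (trans (constant (proj₁ value-one) (proj₁ (proj₂ value-one)))
          (trans (sym (constant (proj₁ value-zero) (proj₁ (proj₂ value-zero)))) (proj₂ (proj₂ value-zero))))))
        where
        constant : ∀ x → x ∈ G → g ∙ x ≡ c
        constant x x∈ = trans (ex x x∈) (trans (cong (λ b → c +ℚ b ∙ Vec.map (_∙ x) coords) β≡0)
          (trans (cong (c +ℚ_) (∙-zeroˡ _)) (ℚ.+-identityʳ c)))
      by-support (one-support i eq βi) = ⊥-elim (resolve (gbin x₀ x₀∈) (gbin x₁ x₁∈))
        where
        f = lookup coords i
        b = lookup β i
        value : ∀ x → x ∈ G → ∀ {v} → f ∙ x ≡ v → g ∙ x ≡ c +ℚ b *ℚ v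
        value x x∈ refl = trans (ex x x∈) (cong (c +ℚ_) (trans (eq _) (cong (b *ℚ_) (Vec.lookup-map i (_∙ x) coords))))
        fbin : Bin G f
        fbin = AllV.lookup⁺ coords-bin i
        nonconstant : ∀ κ → ¬ Agree G f (κ • h)
        nonconstant = signs-nonconstant coords realise (signs-coord coords i)
        find₁ : Σ (Vec ℚ M) λ x → x ∈ G × f ∙ x ≢ (0ℚ • h) ∙ x
        find₁ = ¬all⇒any (λ x → f ∙ x ℚ.≟ (0ℚ • h) ∙ x) G (nonconstant 0ℚ)
        find₀ : Σ (Vec ℚ M) λ x → x ∈ G × f ∙ x ≢ (1ℚ • h) ∙ x
        find₀ = ¬all⇒any (λ x → f ∙ x ℚ.≟ (1ℚ • h) ∙ x) G (nonconstant 1ℚ)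
        x₀ = proj₁ find₀
        x₀∈ = proj₁ (proj₂ find₀)
        x₁ = proj₁ find₁
        x₁∈ = proj₁ (proj₂ find₁)
        f₁ : f ∙ x₁ ≡ 1ℚ
        f₁ = bin-nonzero fbin x₁∈ λ e → proj₂ (proj₂ find₁) (trans e (sym (trans (∙-scaleˡ 0ℚ h x₁) (ℚ.*-zeroˡ (h ∙ x₁)))))
        f₀ : f ∙ x₀ ≡ 0ℚ
        f₀ with fbin x₀ x₀∈
        ... | inj₁ e = e
        ... | inj₂ e = ⊥-elim (proj₂ (proj₂ find₀) (trans e (sym (trans (∙-scaleˡ 1ℚ h x₀) (trans (ℚ.*-identityˡ (h ∙ x₀)) (hom x₀ x₀∈))))))
        g₀ : g ∙ x₀ ≡ c
        g₀ = trans (value x₀ x₀∈ f₀) (trans (cong (c +ℚ_) (ℚ.*-zeroʳ b)) (ℚ.+-identityʳ c))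
        g₁ : g ∙ x₁ ≡ c +ℚ b
        g₁ = trans (value x₁ x₁∈ f₁) (cong (c +ℚ_) (ℚ.*-identityʳ b))
        solve : ∀ c b → b ≡ (c +ℚ b) +ℚ -ℚ c
        solve = solve-∀ ℚ-ring
        b≡ : ∀ {u v} → g ∙ x₀ ≡ u → g ∙ x₁ ≡ v → b ≡ v +ℚ -ℚ u
        b≡ refl refl = trans (solve c b) (sym (cong₂ (λ p q → p +ℚ -ℚ q) g₁ g₀))
        agree-with : ∀ {u v} → g ∙ x₀ ≡ u → g ∙ x₁ ≡ v → ∀ x → x ∈ G → g ∙ x ≡ u +ℚ (v +ℚ -ℚ u) *ℚ f ∙ x
        agree-with p q x x∈ = trans (value x x∈ refl) (cong₂ (λ c b → c +ℚ b *ℚ f ∙ x) (trans (sym g₀) p) (b≡ p q))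
        lemma₁ : ∀ x → 0ℚ +ℚ (1ℚ +ℚ -ℚ 0ℚ) *ℚ x ≡ x
        lemma₁ = solve-∀ ℚ-ring
        lemma₂ : ∀ x → 1ℚ +ℚ (0ℚ +ℚ -ℚ 1ℚ) *ℚ x ≡ 1ℚ +ℚ -ℚ x
        lemma₂ = solve-∀ ℚ-ring
        resolve : g ∙ x₀ ≡ 0ℚ ⊎ g ∙ x₀ ≡ 1ℚ → g ∙ x₁ ≡ 0ℚ ⊎ g ∙ x₁ ≡ 1ℚ → ⊥
        resolve (inj₁ p) (inj₁ q) = βi (b≡ p q)
        resolve (inj₂ p) (inj₂ q) = βi (b≡ p q)
        resolve (inj₁ p) (inj₂ q) = new f (signs-coord coords i) λ x x∈ → trans (agree-with p q x x∈) (lemma₁ (f ∙ x))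
        resolve (inj₂ p) (inj₁ q) = new (opp h f) (signs-opp coords i) λ x x∈ →
          trans (agree-with p q x x∈) (trans (lemma₂ (f ∙ x)) (sym (opp-value (hom x x∈) refl)))

-- Bounds from bases, codes and supports

∈-toList : ∀ {X : Set} {P : X → Set} {k x} {T : Vec X k} → AllV P T → x ∈ Vec.toList T → P x
∈-toList (p ∷ ps) (here refl) = p
∈-toList (p ∷ ps) (there x∈) = ∈-toList ps x∈

lookup∈ : ∀ {X : Set} {k} (T : Vec X k) i → lookup T i ∈ Vec.toList T
lookup∈ (t ∷ T) zero = here refl
lookup∈ (t ∷ T) (suc i) = there (lookup∈ T i)

filter-filter-length : ∀ {X : Set} {P Q : X → Set} (P? : Decidable P) (Q? : Decidable Q) xs →
  (∀ x → x ∈ xs → P x → Q x) → length (filter P? xs) ≤ length (filter P? (filter Q? xs))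
filter-filter-length P? Q? [] sub = z≤n
filter-filter-length P? Q? (x ∷ xs) sub with Q? x
... | yes q with P? x
...   | yes p = s≤s (filter-filter-length P? Q? xs (λ y → sub y ∘ there))
...   | no _ = filter-filter-length P? Q? xs (λ y → sub y ∘ there)
filter-filter-length P? Q? (x ∷ xs) sub | no ¬q with P? x
...   | yes p = ⊥-elim (¬q (sub x (here refl) p))
...   | no _ = filter-filter-length P? Q? xs (λ y → sub y ∘ there)

unit-gap : ∀ {x y} → x ≡ 0ℚ ⊎ x ≡ 1ℚ → y ≡ 0ℚ ⊎ y ≡ 1ℚ → y ≡ x +ℚ 1ℚ → y ≡ 1ℚ × x ≡ 0ℚ
unit-gap (inj₁ refl) (inj₂ refl) _ = refl , refl
unit-gap (inj₁ refl) (inj₁ refl) ()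
unit-gap (inj₂ refl) (inj₁ refl) ()
unit-gap (inj₂ refl) (inj₂ refl) ()

length-toList : ∀ {X : Set} {k} (T : Vec X k) → length (Vec.toList T) ≡ k
length-toList [] = refl
length-toList (_ ∷ T) = cong suc (length-toList T)

unique-⊆ : ∀ {X : Set} {xs ys : List X} → Unique xs → (∀ x → x ∈ xs → x ∈ ys) → length xs ≤ length ys
unique-⊆ uniq sub = pigeonhole {R = _≡_} uniq (λ x x∈ → x , sub x x∈ , refl) λ { _ _ ≢ refl refl → ≢ refl }

module _ {M : ℕ} where

  -- Each support is removed from `A` before the next one is counted; disjointness leaves the
  -- remaining supports untouched.
  disjoint-supports : ∀ {k} q (ξ : Vec (Vec ℚ M) k) A →
    (∀ i j a → a ∈ A → lookup ξ i ∙ a ≢ 0ℚ → lookup ξ j ∙ a ≢ 0ℚ → i ≡ j) →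
    (∀ i → q ≤ length (NonZeros A (lookup ξ i))) → k * q ≤ length A
  disjoint-supports q [] A disj large = z≤n
  disjoint-supports q (x ∷ ξ) A disj large = subst (_ ≤_) (sym (filter-split (¬? ∘ zero? x) A))
    (ℕ.+-mono-≤ (large zero) (disjoint-supports q ξ (filter (¬? ∘ (¬? ∘ zero? x)) A)
      (λ i j a a∈ p q → Fin.suc-injective (disj (suc i) (suc j) a (proj₁ (∈-filter⁻ (¬? ∘ (¬? ∘ zero? x)) {xs = A} a∈)) p q))
      λ i → ℕ.≤-trans (large (suc i)) (filter-filter-length (¬? ∘ zero? (lookup ξ i)) (¬? ∘ (¬? ∘ zero? x)) A
        λ a a∈ p q → case disj (suc i) zero a a∈ p q of λ ())))

  ind-distinct : ∀ {k} {T : Vec (Vec ℚ M) k} → Ind T → Unique (Vec.toList T)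
  ind-distinct {T = []} _ = []
  ind-distinct {T = t ∷ T} (t∉ , ind) = All.tabulate (λ { x∈ refl → t∉ (∈-toList (allSpan T) x∈) }) ∷ ind-distinct ind

  rank-≤ : ∀ {G : List (Vec ℚ M)} {R} → Rank G R → R ≤ length G
  rank-≤ (rank T T⊆ ind _) = subst (_≤ _) (length-toList T) (unique-⊆ (ind-distinct ind) λ x → ∈-toList T⊆)

  inspan-mono : ∀ {G A : List (Vec ℚ M)} {w} → (∀ a → a ∈ G → a ∈ A) → InSpan G w → InSpan A w
  inspan-mono sub w∈ ψ kills = w∈ ψ λ a a∈ → kills a (sub a a∈)

  ∈⇒inspan : ∀ {A : List (Vec ℚ M)} {a} → a ∈ A → InSpan A a
  ∈⇒inspan a∈ ψ kills = kills _ a∈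

  sys-separates : ∀ {A L : List (Vec ℚ M)} {h w} → TL A → Homogeneous h A → Sys A L → InSpan A w →
    (∀ g → g ∈ L → g ∙ w ≡ 0ℚ) → w ≡ 0v
  sys-separates tl hom sys w∈ kills = bin-separate tl hom w∈ λ g gbin →
    let g' , g'∈ , agree = Sys.complete sys g gbin in trans (agree-inspan agree w∈) (kills g' g'∈)

  code-agree : ∀ {k g g'} {T : Vec (Vec ℚ M) k} → AllV (λ t → g ∙ t ≡ 0ℚ ⊎ g ∙ t ≡ 1ℚ) T → AllV (λ t → g' ∙ t ≡ 0ℚ ⊎ g' ∙ t ≡ 1ℚ) T →
    Vec.map (λ t → does (g ∙ t ℚ.≟ 1ℚ)) T ≡ Vec.map (λ t → does (g' ∙ t ℚ.≟ 1ℚ)) T → AllV (λ t → g ∙ t ≡ g' ∙ t) T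
  code-agree [] [] _ = []
  code-agree (b ∷ bs) (b' ∷ bs') eq =
    trans (sym (bit-value b)) (trans (cong ⟦_⟧ (Vec.∷-injectiveˡ eq)) (bit-value b')) ∷ code-agree bs bs' (Vec.∷-injectiveʳ eq)

  sys-bound : ∀ {A L : List (Vec ℚ M)} {D} → Rank A D → Sys A L → length L ≤ 2 ^ D
  sys-bound {A} {L} {D} (rank T T⊆ _ spans) sys = subst (length L ≤_) (count-true D)
    (code-bound D (λ _ → true) (λ g → Vec.map (λ t → does (g ∙ t ℚ.≟ 1ℚ)) T) (Sys.distinct sys) (λ _ _ → refl)
      λ {g} {g'} g∈ g'∈ ¬agree eq → ¬agree λ a a∈ → agree-span {f = g} {g'}
        (code-agree (AllV.map (λ {t} → Sys.bin sys g g∈ t) T⊆) (AllV.map (λ {t} → Sys.bin sys g' g'∈ t) T⊆) eq) (spans a a∈))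

  rank-one : ∀ {h x y} {G : List (Vec ℚ M)} → Homogeneous h G → Rank G 1 → x ∈ G → y ∈ G → x ≡ y
  rank-one {h} {x} {y} {G} hom (rank (t ∷ []) (t∈ ∷ []) _ spans) x∈ y∈ = trans (is-t x x∈ (spans x x∈)) (sym (is-t y y∈ (spans y y∈)))
    where
    unit : ∀ x → 0ℚ +ℚ 1ℚ *ℚ x ≡ x
    unit = solve-∀ ℚ-ring
    unit' : ∀ c → 0ℚ +ℚ c *ℚ 1ℚ ≡ c
    unit' = solve-∀ ℚ-ring
    is-t : ∀ x → x ∈ G → Span (t ∷ []) x → x ≡ t
    is-t x x∈ ((c ∷ []) , eq) = ext∙ λ g → trans (at g) (trans (cong (λ c → 0ℚ +ℚ c *ℚ g ∙ t) c≡1) (unit (g ∙ t)))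
      where
      at : ∀ g → g ∙ x ≡ 0ℚ +ℚ c *ℚ g ∙ t
      at g = trans (cong (g ∙_) (sym eq)) (trans (∙-linʳ g 0v c t) (cong (_+ℚ c *ℚ g ∙ t) (∙-zeroʳ g)))
      c≡1 : c ≡ 1ℚ
      c≡1 = trans (sym (unit' c)) (trans (cong (λ u → 0ℚ +ℚ c *ℚ u) (sym (hom t t∈))) (trans (sym (at h)) (hom x x∈)))

  sys-coordinates : ∀ {A L : List (Vec ℚ M)} {h R} → TL A → Homogeneous h A → Sys A L → Rank A (suc R) → DualBasis h A (suc R) L
  sys-coordinates tl hom sys rk = dual-basis hom rk λ w → sys-separates tl hom sys

  -- There are `2 * suc R` sign functionals. If `L` is longer, it contains one that agrees with none
  -- of them, hence depends on two coordinates, and that excludes a quarter of the codes.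
  points-bound-sys : ∀ {A L : List (Vec ℚ M)} {h R} → Unique A → TL A → Homogeneous h A → Sys A L → Rank A (suc R) →
    length A ≤ 2 ^ R × (2 * suc R < length L → 4 * length A ≤ 3 * 2 ^ R)
  points-bound-sys {A} {L} {h} {R} uniq tl hom sys rk =
    subst (λ m → length A ≤ 2 ^ m) (ℕ.suc-injective size≡) points-bound₂ ,
    λ large → subst (λ m → 4 * length A ≤ 3 * 2 ^ m) (ℕ.suc-injective size≡) (dense large)
    where
    open Coordinates hom uniq (sys-coordinates tl hom sys rk) (Sys.bin sys)
    dense : 2 * suc R < length L → 4 * length A ≤ 3 * 2 ^ size
    dense large = points-three-quarters (proj₁ fresh) (Sys.bin sys (proj₁ fresh) (proj₁ (proj₂ fresh)))
        λ f f∈ agree → proj₂ (proj₂ fresh) (lose f∈ agree)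
      where
      covered : (∀ g → g ∈ L → Any (Agree A g) all-signs) → length L ≤ 2 * suc R
      covered all = subst (length L ≤_) length-all-signs (pigeonhole {R = Agree A} (Sys.distinct sys) (λ g g∈ → find (all g g∈))
        λ _ _ ¬agree p q → ¬agree λ a a∈ → trans (p a a∈) (sym (q a a∈)))
      fresh : Σ (Vec ℚ M) λ g → g ∈ L × ¬ Any (Agree A g) all-signs
      fresh = ¬all⇒any (λ g → any? (agree? A g) all-signs) L (λ all → ℕ.<-irrefl refl (ℕ.<-≤-trans large (covered all)))

-- Splitting along a facet

module Split {M : ℕ} {h : Vec ℚ M} {A L : List (Vec ℚ M)} {D : ℕ} {f : Vec ℚ M}
  (hom : Homogeneous h A) (uniq : Unique A) (tl : TL A) (rk : Rank A (suc D)) (sys : Sys A L)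
  (fbin : Bin A f) (facet : Facet A f) where

  open Sys sys

  A₀ A₁ : List (Vec ℚ M)
  A₀ = Zeros A f
  A₁ = NonZeros A f

  A₀⊆ : ∀ a → a ∈ A₀ → a ∈ A
  A₀⊆ a a∈ = proj₁ (∈-zeros⁻ {A = A} {f} a∈)

  A₁⊆ : ∀ a → a ∈ A₁ → a ∈ A
  A₁⊆ a a∈ = proj₁ (∈-nonzeros⁻ {A = A} {f} a∈)

  on-A₀ : ∀ a → a ∈ A₀ → f ∙ a ≡ 0ℚ
  on-A₀ a a∈ = proj₂ (∈-zeros⁻ {A = A} {f} a∈)

  on-A₁ : ∀ a → a ∈ A₁ → f ∙ a ≡ 1ℚ
  on-A₁ a a∈ = let a∈A , ≢0 = ∈-nonzeros⁻ {A = A} {f} a∈ in bin-nonzero fbin a∈A ≢0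

  side : ∀ {P : Vec ℚ M → Set} → (∀ a → a ∈ A₀ → P a) → (∀ a → a ∈ A₁ → P a) → ∀ a → a ∈ A → P a
  side p₀ p₁ a a∈ with zero? f a
  ... | yes fa = p₀ a (∈-zeros⁺ a∈ fa)
  ... | no ¬fa = p₁ a (∈-nonzeros⁺ a∈ ¬fa)

  p q : ℕ
  p = length A₀
  q = length A₁

  p+q : length A ≡ p + q
  p+q = filter-split (zero? f) A

  z : Vec ℚ M
  z = proj₁ (proj₁ facet)

  z∈ : z ∈ A₁
  z∈ = ∈-nonzeros⁺ (proj₁ (proj₂ (proj₁ facet))) (proj₂ (proj₂ (proj₁ facet)))

  rank₀ : Rank A₀ D
  rank₀ = facet-rank rk facet

  tl₀ : TL A₀
  tl₀ = facet-TL tl fbin facet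

  hom₀ : Homogeneous h A₀
  hom₀ a a∈ = hom a (A₀⊆ a a∈)

  hom₁ : Homogeneous h A₁
  hom₁ a a∈ = hom a (A₁⊆ a a∈)

  uniq₀ : Unique A₀
  uniq₀ = AllPairs.filter⁺ (zero? f) uniq

  uniq₁ : Unique A₁
  uniq₁ = AllPairs.filter⁺ (¬? ∘ zero? f) uniq

  ZeroOn OneOn : Vec ℚ M → Set
  ZeroOn g = ∀ a → a ∈ A₁ → g ∙ a ≡ 0ℚ
  OneOn g = ∀ a → a ∈ A₁ → g ∙ a ≡ 1ℚ

  zeroOn? : ∀ g → Dec (ZeroOn g)
  zeroOn? g = all-dec (λ a → g ∙ a ℚ.≟ 0ℚ) A₁

  oneOn? : ∀ g → Dec (OneOn g)
  oneOn? g = all-dec (λ a → g ∙ a ℚ.≟ 1ℚ) A₁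

  -- The difference `g - k` vanishes on `A₀` and is therefore a multiple of `f`, so it is constant
  -- on `A₁`. If the constant is 1 or -1, it forces both functionals to be constant on `A₁`.
  extend-agreement : ∀ {g k} → Bin A g → Bin A k → Agree A₀ g k → Agree A g k ⊎ (OneOn g × ZeroOn k) ⊎ (ZeroOn g × OneOn k)
  extend-agreement {g} {k} gbin kbin agree = cases (gbin z z∈A) (kbin z z∈A)
    where
    z∈A = A₁⊆ z z∈
    det = facet-determined facet (g ⊕ (-ℚ 1ℚ) • k) λ a a∈ → trans (∙-linˡ g (-ℚ 1ℚ) k a)
      (trans (cong (_+ℚ (-ℚ 1ℚ) *ℚ k ∙ a) (agree a a∈)) (cancel (k ∙ a)))
      where
      cancel : ∀ x → x +ℚ (-ℚ 1ℚ) *ℚ x ≡ 0ℚ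
      cancel = solve-∀ ℚ-ring
    κ = proj₁ det
    difference : ∀ a → a ∈ A → g ∙ a ≡ k ∙ a +ℚ κ *ℚ f ∙ a
    difference a a∈ = trans (rearrange (g ∙ a) (k ∙ a)) (cong (k ∙ a +ℚ_) (trans (sym (∙-linˡ g (-ℚ 1ℚ) k a)) (proj₂ det a a∈)))
      where
      rearrange : ∀ x y → x ≡ y +ℚ (x +ℚ (-ℚ 1ℚ) *ℚ y)
      rearrange = solve-∀ ℚ-ring
    difference₁ : ∀ a → a ∈ A₁ → g ∙ a ≡ k ∙ a +ℚ κ
    difference₁ a a∈ = trans (difference a (A₁⊆ a a∈)) (cong (k ∙ a +ℚ_) (trans (cong (κ *ℚ_) (on-A₁ a a∈)) (ℚ.*-identityʳ κ)))
    κ≡ : ∀ {u v} → g ∙ z ≡ u → k ∙ z ≡ v → κ ≡ u +ℚ -ℚ v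
    κ≡ refl refl = trans (rearrange (k ∙ z) κ) (cong (_+ℚ -ℚ (k ∙ z)) (sym (difference₁ z z∈)))
      where
      rearrange : ∀ y x → x ≡ (y +ℚ x) +ℚ -ℚ y
      rearrange = solve-∀ ℚ-ring
    same : κ ≡ 0ℚ → Agree A g k
    same κ≡0 a a∈ = trans (difference a a∈) (trans (cong (λ c → k ∙ a +ℚ c *ℚ f ∙ a) κ≡0) (trans (cong (k ∙ a +ℚ_) (ℚ.*-zeroˡ (f ∙ a))) (ℚ.+-identityʳ _)))
    cases : g ∙ z ≡ 0ℚ ⊎ g ∙ z ≡ 1ℚ → k ∙ z ≡ 0ℚ ⊎ k ∙ z ≡ 1ℚ → Agree A g k ⊎ (OneOn g × ZeroOn k) ⊎ (ZeroOn g × OneOn k)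
    cases (inj₁ gz) (inj₁ kz) = inj₁ (same (κ≡ gz kz))
    cases (inj₂ gz) (inj₂ kz) = inj₁ (same (κ≡ gz kz))
    cases (inj₂ gz) (inj₁ kz) = inj₂ (inj₁ ((λ a a∈ → proj₁ (up a a∈)) , λ a a∈ → proj₂ (up a a∈)))
      where
      up : ∀ a → a ∈ A₁ → g ∙ a ≡ 1ℚ × k ∙ a ≡ 0ℚ
      up a a∈ = unit-gap (kbin a (A₁⊆ a a∈)) (gbin a (A₁⊆ a a∈)) (trans (difference₁ a a∈) (cong (k ∙ a +ℚ_) (κ≡ gz kz)))
    cases (inj₁ gz) (inj₂ kz) = inj₂ (inj₂ ((λ a a∈ → proj₂ (down a a∈)) , λ a a∈ → proj₁ (down a a∈)))
      where
      back : ∀ y → y ≡ (y +ℚ (-ℚ 1ℚ)) +ℚ 1ℚ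
      back = solve-∀ ℚ-ring
      down : ∀ a → a ∈ A₁ → k ∙ a ≡ 1ℚ × g ∙ a ≡ 0ℚ
      down a a∈ = unit-gap (gbin a (A₁⊆ a a∈)) (kbin a (A₁⊆ a a∈))
        (trans (back (k ∙ a)) (cong (_+ℚ 1ℚ) (sym (trans (difference₁ a a∈) (cong (k ∙ a +ℚ_) (κ≡ gz kz))))))

  -- The letters refer to the values on `A₁`: constantly one, not constantly one, constantly zero,
  -- not constant.
  Lo Ln Lz Lc : List (Vec ℚ M)
  Lo = filter oneOn? L
  Ln = filter (¬? ∘ oneOn?) L
  Lz = filter zeroOn? Ln
  Lc = filter (¬? ∘ zeroOn?) Ln

  v c : ℕ
  v = length Lz
  c = length Lc

  ∈-Ln⁻ : ∀ {g} → g ∈ Ln → g ∈ L × ¬ OneOn g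
  ∈-Ln⁻ = ∈-filter⁻ (¬? ∘ oneOn?) {xs = L}

  ∈-Lz⁻ : ∀ {g} → g ∈ Lz → g ∈ L × ZeroOn g
  ∈-Lz⁻ g∈ = let g∈' , zeroOn = ∈-filter⁻ zeroOn? {xs = Ln} g∈ in proj₁ (∈-Ln⁻ g∈') , zeroOn

  zero⇒¬one : ∀ {g} → ZeroOn g → ¬ OneOn g
  zero⇒¬one zeroOn oneOn = 1≢0ℚ (trans (sym (oneOn z z∈)) (zeroOn z z∈))

  -- Subtracting `f` turns a functional equal to 1 on `A₁` into one equal to 0 there and changes
  -- nothing on `A₀`.
  Lo≤Lz : length Lo ≤ v
  Lo≤Lz = pigeonhole {R = λ g k → Agree A (g ⊕ (-ℚ 1ℚ) • f) k} (AllPairs.filter⁺ oneOn? distinct) hits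
    λ {g} {g'} _ _ ¬agree p q → ¬agree λ a a∈ → cancel (g ∙ a) (g' ∙ a) (f ∙ a)
      (trans (sym (∙-linˡ g _ f a)) (trans (p a a∈) (trans (sym (q a a∈)) (∙-linˡ g' _ f a))))
    where
    cancel : ∀ x y t → x +ℚ (-ℚ 1ℚ) *ℚ t ≡ y +ℚ (-ℚ 1ℚ) *ℚ t → x ≡ y
    cancel x y t e = trans (lemma x t) (trans (cong (_+ℚ t) e) (sym (lemma y t)))
      where
      lemma : ∀ x t → x ≡ (x +ℚ (-ℚ 1ℚ) *ℚ t) +ℚ t
      lemma = solve-∀ ℚ-ring
    hits : ∀ g → g ∈ Lo → Σ (Vec ℚ M) λ k → k ∈ Lz × Agree A (g ⊕ (-ℚ 1ℚ) • f) k
    hits g g∈ = k , ∈-filter⁺ zeroOn? (∈-filter⁺ (¬? ∘ oneOn?) k∈ (zero⇒¬one k-zero)) k-zero , agree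
      where
      g∈L = proj₁ (∈-filter⁻ oneOn? {xs = L} g∈)
      oneOn = proj₂ (∈-filter⁻ oneOn? {xs = L} g∈)
      value : ∀ a {x y} → g ∙ a ≡ x → f ∙ a ≡ y → (g ⊕ (-ℚ 1ℚ) • f) ∙ a ≡ x +ℚ (-ℚ 1ℚ) *ℚ y
      value a refl refl = ∙-linˡ g (-ℚ 1ℚ) f a
      bin₀ : ∀ a → a ∈ A₀ → (g ⊕ (-ℚ 1ℚ) • f) ∙ a ≡ 0ℚ ⊎ (g ⊕ (-ℚ 1ℚ) • f) ∙ a ≡ 1ℚ
      bin₀ a a∈ with bin g g∈L a (A₀⊆ a a∈)
      ... | inj₁ e = inj₁ (value a e (on-A₀ a a∈))
      ... | inj₂ e = inj₂ (value a e (on-A₀ a a∈))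
      zero₁ : ∀ a → a ∈ A₁ → (g ⊕ (-ℚ 1ℚ) • f) ∙ a ≡ 0ℚ
      zero₁ a a∈ = value a (oneOn a a∈) (on-A₁ a a∈)
      found = complete (g ⊕ (-ℚ 1ℚ) • f) (side bin₀ λ a a∈ → inj₁ (zero₁ a a∈))
      k = proj₁ found
      k∈ = proj₁ (proj₂ found)
      agree = proj₂ (proj₂ found)
      k-zero : ZeroOn k
      k-zero a a∈ = trans (sym (agree a (A₁⊆ a a∈))) (zero₁ a a∈)

  sys₀ : Σ (List (Vec ℚ M)) (Sys A₀)
  sys₀ = sys-exists A₀

  L₀ : List (Vec ℚ M)
  L₀ = proj₁ sys₀

  U : ℕ
  U = length L₀

  L≤ : length L ≤ v + (v + c)
  L≤ = subst (_≤ v + (v + c)) (sym (trans (filter-split oneOn? L) (cong (length Lo +_) (filter-split zeroOn? Ln)))) (ℕ.+-monoˡ-≤ (v + c) Lo≤Lz)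

  -- By `extend-agreement`, restriction to `A₀` can identify two distinct functionals only if one of
  -- them is constantly 1 on `A₁`, and `Ln` omits these.
  v+c≤U : v + c ≤ U
  v+c≤U = subst (_≤ U) (filter-split zeroOn? Ln) (pigeonhole {R = Agree A₀} (AllPairs.filter⁺ (¬? ∘ oneOn?) distinct)
    (λ g g∈ → Sys.complete (proj₂ sys₀) g λ a a∈ → bin g (proj₁ (∈-Ln⁻ g∈)) a (A₀⊆ a a∈)) inj)
    where
    inj : ∀ {g g' k} → g ∈ Ln → g' ∈ Ln → ¬ Agree A g g' → Agree A₀ g k → Agree A₀ g' k → ⊥
    inj {g} {g'} g∈ g'∈ ¬agree p q with extend-agreement (bin g (proj₁ (∈-Ln⁻ g∈))) (bin g' (proj₁ (∈-Ln⁻ g'∈))) (λ a a∈ → trans (p a a∈) (sym (q a a∈)))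
    ... | inj₁ agree = ¬agree agree
    ... | inj₂ (inj₁ (g-one , _)) = proj₂ (∈-Ln⁻ g∈) g-one
    ... | inj₂ (inj₂ (_ , g'-one)) = proj₂ (∈-Ln⁻ g'∈) g'-one

  U≤ : U ≤ 2 ^ D
  U≤ = sys-bound rank₀ (proj₂ sys₀)

  private
    nonempty-rank : ∀ {G : List (Vec ℚ M)} {k x} → Homogeneous h G → x ∈ G → Rank G k → Σ ℕ λ R → k ≡ suc R
    nonempty-rank {k = suc R} _ _ _ = R , refl
    nonempty-rank {k = zero} {x} homG x∈ (rank [] _ _ spans) = ⊥-elim (1≢0ℚ (trans (sym (homG x x∈)) (kills-span {φ = h} [] (spans x x∈))))

  R : ℕ
  R = proj₁ (nonempty-rank hom₁ z∈ (proj₂ (rank-of A₁)))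

  rank₁ : Rank A₁ (suc R)
  rank₁ = subst (Rank A₁) (proj₂ (nonempty-rank hom₁ z∈ (proj₂ (rank-of A₁)))) (proj₂ (rank-of A₁))

  open Rank rank₁ public using () renaming (basis to T₁; basis⊆ to T₁⊆; basis-ind to T₁-ind; basis-spans to T₁-spans)

  private
    extension = extend id A T₁ T₁-ind

  -- The codimension of the span of `A₁` in the span of `A`. Since `R` is the dimension of `A₁`, the
  -- bounds `q ≤ 2 ^ R` and `v ≤ 2 ^ S` multiply to `2 ^ D`.
  S : ℕ
  S = proj₁ extension

  T₂ : Vec (Vec ℚ M) S
  T₂ = proj₁ (proj₂ extension)

  T₂⊆ : AllV (_∈ A) T₂
  T₂⊆ = proj₁ (proj₂ (proj₂ extension))

  T₂₁-ind : Ind (T₂ Vec.++ T₁)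
  T₂₁-ind = subst (λ T → Ind (T Vec.++ T₁)) (Vec.map-id T₂) (proj₁ (proj₂ (proj₂ (proj₂ extension))))

  T₂₁-spans : ∀ a → a ∈ A → Span (T₂ Vec.++ T₁) a
  T₂₁-spans = subst (λ T → ∀ a → a ∈ A → Span (T Vec.++ T₁) a) (Vec.map-id T₂) (proj₂ (proj₂ (proj₂ (proj₂ extension))))

  S+R : S + suc R ≡ suc D
  S+R = rank-unique (rank (T₂ Vec.++ T₁) (AllV.++⁺ T₂⊆ (AllV.map (λ {a} → A₁⊆ a) T₁⊆)) T₂₁-ind T₂₁-spans) rk

  coordinates₁ : DualBasis h A₁ (suc R) L
  coordinates₁ = dual-basis hom₁ rank₁ λ w w∈ → sys-separates tl hom sys (inspan-mono A₁⊆ w∈)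

  module C₁ = Coordinates hom₁ uniq₁ coordinates₁ (λ g g∈ a a∈ → bin g g∈ a (A₁⊆ a a∈))

  q≤ : q ≤ 2 ^ R
  q≤ = subst (λ m → q ≤ 2 ^ m) (ℕ.suc-injective C₁.size≡) C₁.points-bound₂

  q≥ : suc R ≤ q
  q≥ = rank-≤ rank₁

  -- The coordinates of `A₁` and their complements are not constant on `A₁`. They are two-valued on
  -- all of `A`, since the coordinates were drawn from `L`.
  c≥ : 2 * R ≤ c
  c≥ = subst (_≤ c) (trans (length-signs h C₁.coords []) (trans (ℕ.+-identityʳ (2 * C₁.size)) (cong (2 *_) (ℕ.suc-injective C₁.size≡))))
    (pigeonhole {R = Agree A} (signs-distinct C₁.coords C₁.realise (λ ()) []) hits
      λ {g} {g'} _ _ ¬agree p q → ¬agree λ a a∈ → trans (p a (A₁⊆ a a∈)) (sym (q a (A₁⊆ a a∈))))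
    where
    hits : ∀ g → g ∈ signs h C₁.coords [] → Σ (Vec ℚ M) λ k → k ∈ Lc × Agree A g k
    hits g g∈ = k , ∈-filter⁺ (¬? ∘ zeroOn?) (∈-filter⁺ (¬? ∘ oneOn?) k∈ ¬one) ¬zero , agree
      where
      gbin : Bin A g
      gbin = signs-elim C₁.coords (λ ()) (AllV.map (λ {f} → bin f) C₁.coords⊆) (AllV.map (λ {f} f∈ → opp-bin hom (bin f f∈)) C₁.coords⊆) g∈
      found = complete g gbin
      k = proj₁ found
      k∈ = proj₁ (proj₂ found)
      agree = proj₂ (proj₂ found)
      nonconstant : ∀ κ → ¬ (∀ a → a ∈ A₁ → k ∙ a ≡ κ)
      nonconstant κ const = signs-nonconstant C₁.coords C₁.realise g∈ κ λ a a∈ → trans (agree a (A₁⊆ a a∈))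
        (trans (const a a∈) (sym (trans (∙-scaleˡ κ h a) (trans (cong (κ *ℚ_) (hom₁ a a∈)) (ℚ.*-identityʳ κ)))))
      ¬one : ¬ OneOn k
      ¬one = nonconstant 1ℚ
      ¬zero : ¬ ZeroOn k
      ¬zero = nonconstant 0ℚ

  zero-kills : ∀ {g} → ZeroOn g → Kills g T₁
  zero-kills zeroOn = AllV.map (λ {a} → zeroOn a) T₁⊆

  code₂ : Vec ℚ M → Vec Bool S
  code₂ g = Vec.map (λ t → does (g ∙ t ℚ.≟ 1ℚ)) T₂

  code₂-value : ∀ {g} → Bin A g → Vec.map ⟦_⟧ (code₂ g) ≡ values g T₂
  code₂-value {g} gbin = go T₂⊆
    where
    go : ∀ {k} {T : Vec (Vec ℚ M) k} → AllV (_∈ A) T → Vec.map ⟦_⟧ (Vec.map (λ t → does (g ∙ t ℚ.≟ 1ℚ)) T) ≡ values g T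
    go [] = refl
    go (t∈ ∷ ts) = cong₂ _∷_ (bit-value (gbin _ t∈)) (go ts)

  -- The dual of `points-bound`: a functional vanishing on `A₁` is determined by its bits on `T₂`,
  -- because `T₂` and `T₁` together span `A`.
  zeros-bound : (P : Vec Bool S → Bool) → (∀ g → g ∈ Lz → P (code₂ g) ≡ true) → v ≤ count S P
  zeros-bound P good = code-bound S P code₂ (AllPairs.filter⁺ zeroOn? (AllPairs.filter⁺ (¬? ∘ oneOn?) distinct)) good
    λ {g} {g'} g∈ g'∈ ¬agree eq → ¬agree λ a a∈ →
      let g∈L , gz = ∈-Lz⁻ g∈
          g'∈L , g'z = ∈-Lz⁻ g'∈
      in agree-span {f = g} {g'} (AllV.++⁺ (code-agree (AllV.map (λ {t} → bin g g∈L t) T₂⊆) (AllV.map (λ {t} → bin g' g'∈L t) T₂⊆) eq)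
           (AllV.map (λ (x , y) → trans x (sym y)) (AllV.zip (zero-kills gz , zero-kills g'z)))) (T₂₁-spans a a∈)

  v≤ : v ≤ 2 ^ S
  v≤ = subst (v ≤_) (count-true S) (zeros-bound (λ _ → true) λ _ _ → refl)

  scaled-zero : ∀ {ψ g a : Vec ℚ M} {c} → 0ℚ <ℚ c → ψ ∙ a ≡ c *ℚ g ∙ a → ψ ∙ a ≡ 0ℚ → g ∙ a ≡ 0ℚ
  scaled-zero {g = g} {a} {c} 0<c eq ψa = *-cancel-zero {g ∙ a} {c} (trans (ℚ.*-comm (g ∙ a) c) (trans (sym eq) ψa)) (0<⇒≢0 0<c)

  opp-A₁ : ∀ a → a ∈ A₁ → opp h f ∙ a ≡ 0ℚ
  opp-A₁ a a∈ = opp-value (hom₁ a a∈) (on-A₁ a a∈)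

  opp-A₀ : ∀ a → a ∈ A₀ → opp h f ∙ a ≡ 1ℚ
  opp-A₀ a a∈ = opp-value (hom₀ a a∈) (on-A₀ a a∈)

  opaque
    -- The complement of `f` is nonnegative and vanishes on `A₁`; rotating it while its value at
    -- `x₀` is kept yields a facet that contains `A₁`.
    covering-facet : ∀ {x₀} → x₀ ∈ A₀ → Σ (Vec ℚ M) λ ψ → Bin A ψ × Facet A ψ × ZeroOn ψ
    covering-facet {x₀} x₀∈ = finish (rotate A x₀ (∈⇒inspan (A₀⊆ x₀ x₀∈)) (opp h f) (bin-nonneg (opp-bin hom fbin))
        λ e → 1≢0ℚ (trans (sym (opp-A₀ x₀ x₀∈)) e))
      where
      finish : Rotated A (opp h f) x₀ → Σ (Vec ℚ M) λ ψ → Bin A ψ × Facet A ψ × ZeroOn ψ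
      finish (ψ' , nonneg , ψ'-facet , _ , sub) =
        let ψ , ψ-bin , ψ-facet , k , 0<k , eq = normalise tl nonneg ψ'-facet
        in ψ , ψ-bin , ψ-facet , λ a a∈ → scaled-zero 0<k (eq a) (sub a (A₁⊆ a a∈) (opp-A₁ a a∈))

  S≥1 : ∀ {x₀} → x₀ ∈ A₀ → 1 ≤ S
  S≥1 {x₀} x₀∈ = nonempty T₂ (T₂₁-spans x₀ (A₀⊆ x₀ x₀∈))
    where
    nonempty : ∀ {k} (T : Vec (Vec ℚ M) k) → Span (T Vec.++ T₁) x₀ → 1 ≤ k
    nonempty (_ ∷ _) _ = s≤s z≤n
    nonempty [] s = ⊥-elim (1≢0ℚ (trans (sym (opp-A₀ x₀ x₀∈)) (kills-span {φ = opp h f} (zero-kills opp-A₁) s)))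

  -- A face of a simplex is a simplex. `E` completes the basis `T₁` to a basis of the facet by
  -- points outside `A₁`; as the facet has rank `D` and at most `D` vertices, at most `suc R` of
  -- them remain for `A₁`.
  face-simplex : ∀ ψ → Facet A ψ → ZeroOn ψ → length (Zeros A ψ) ≤ D → q ≤ suc R
  face-simplex ψ ψ-facet ψ-zero few = ℕ.+-cancelˡ-≤ m q (suc R) (subst (_≤ m + suc R) lengths (ℕ.≤-trans
      (unique-⊆ (AllPairs.++⁺ (ind-distinct left) uniq₁ (All.tabulate λ x∈ → All.tabulate λ { y∈ refl → apart x∈ y∈ })) included)
      (subst (length (Zeros A ψ) ≤_) (sym size) few)))
    where
    A₁⊆ψ : ∀ a → a ∈ A₁ → a ∈ Zeros A ψ
    A₁⊆ψ a a∈ = ∈-zeros⁺ (A₁⊆ a a∈) (ψ-zero a a∈)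
    ext = extend id (Zeros A ψ) T₁ T₁-ind
    m = proj₁ ext
    E = proj₁ (proj₂ ext)
    E⊆ : AllV (_∈ Zeros A ψ) E
    E⊆ = proj₁ (proj₂ (proj₂ ext))
    E-ind : Ind (E Vec.++ T₁)
    E-ind = subst (λ T → Ind (T Vec.++ T₁)) (Vec.map-id E) (proj₁ (proj₂ (proj₂ (proj₂ ext))))
    E-spans : ∀ a → a ∈ Zeros A ψ → Span (E Vec.++ T₁) a
    E-spans = subst (λ T → ∀ a → a ∈ Zeros A ψ → Span (T Vec.++ T₁) a) (Vec.map-id E) (proj₂ (proj₂ (proj₂ (proj₂ ext))))
    size : m + suc R ≡ D
    size = rank-unique (rank (E Vec.++ T₁) (AllV.++⁺ E⊆ (AllV.map (λ {a} → A₁⊆ψ a) T₁⊆)) E-ind E-spans)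
      (facet-rank rk ψ-facet)
    weaken : ∀ {k m} {S : Vec (Vec ℚ M) k} {T : Vec (Vec ℚ M) m} {x} → Span S x → Span (S Vec.++ T) x
    weaken {S = []} {T} ([] , refl) = span-zero T
    weaken {S = s ∷ S} {T} ((c ∷ cs) , refl) = span-lin c (span-there (weaken (cs , refl))) span-here
    split-ind : ∀ {k} (E : Vec (Vec ℚ M) k) → Ind (E Vec.++ T₁) → Ind E × (∀ x → x ∈ Vec.toList E → ¬ Span T₁ x)
    split-ind [] _ = tt , λ _ ()
    split-ind (e ∷ E) (e∉ , ind) = ((λ s → e∉ (weaken s)) , proj₁ (split-ind E ind)) , λ where
      _ (here refl) s → e∉ (span-++ʳ E s)
      x (there x∈) → proj₂ (split-ind E ind) x x∈
    left : Ind E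
    left = proj₁ (split-ind E E-ind)
    apart : ∀ {x} → x ∈ Vec.toList E → x ∈ A₁ → ⊥
    apart x∈ x∈A₁ = proj₂ (split-ind E E-ind) _ x∈ (T₁-spans _ x∈A₁)
    included : ∀ x → x ∈ Vec.toList E ++ A₁ → x ∈ Zeros A ψ
    included x x∈ with ∈-++⁻ (Vec.toList E) x∈
    ... | inj₁ x∈E = ∈-toList E⊆ x∈E
    ... | inj₂ x∈A₁ = A₁⊆ψ x x∈A₁
    lengths : length (Vec.toList E ++ A₁) ≡ m + q
    lengths = trans (List.length-++ (Vec.toList E)) (cong (_+ q) (length-toList E))

  module Maximal {x₀} (x₀∈ : x₀ ∈ A₀) (max : ∀ ψ → Bin A ψ → Facet A ψ → length (Zeros A ψ) ≤ p) where

    private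
      cover = covering-facet x₀∈
      ψ = proj₁ cover

    A₁⊆cover : ∀ a → a ∈ A₁ → a ∈ Zeros A ψ
    A₁⊆cover a a∈ = ∈-zeros⁺ (A₁⊆ a a∈) (proj₂ (proj₂ (proj₂ cover)) a a∈)

    -- `A₁` lies in the covering facet, which has at most as many vertices as the maximal facet
    -- `A₀`.
    q≤p : q ≤ p
    q≤p = ℕ.≤-trans (unique-⊆ uniq₁ A₁⊆cover) (max ψ (proj₁ (proj₂ cover)) (proj₁ (proj₂ (proj₂ cover))))

    simplicial : p ≤ D → q ≤ suc R
    simplicial p≤D = face-simplex ψ (proj₁ (proj₂ (proj₂ cover))) (proj₂ (proj₂ (proj₂ cover)))
      (ℕ.≤-trans (max ψ (proj₁ (proj₂ cover)) (proj₁ (proj₂ (proj₂ cover)))) p≤D)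

    -- If many functionals vanish on A₁, then A₀ maps onto the vertices of a simplex modulo the span of A₁,
    -- and the complement of each of its fibres is a facet.
    module Classes (large : ¬ (4 * v ≤ 3 * 2 ^ S)) where

      T₂-opp : values (opp h f) T₂ ≡ Vec.replicate S 1ℚ
      T₂-opp = go T₂ T₂⊆ T₂₁-ind
        where
        go : ∀ {k} (T : Vec (Vec ℚ M) k) → AllV (_∈ A) T → Ind (T Vec.++ T₁) → values (opp h f) T ≡ Vec.replicate k 1ℚ
        go [] _ _ = refl
        go (t ∷ T) (t∈ ∷ T⊆) (t∉ , ind) = cong₂ _∷_ (side {λ t → ¬ Span (T Vec.++ T₁) t → opp h f ∙ t ≡ 1ℚ}
          (λ a a∈ _ → opp-A₀ a a∈) (λ a a∈ a∉ → ⊥-elim (a∉ (span-++ʳ T (T₁-spans a a∈)))) t t∈ t∉) (go T T⊆ ind)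

      -- Modulo the span of `A₁`, the point `a` is a combination of `T₂`. Two nonzero coefficients
      -- would confine the codes of the functionals vanishing on `A₁` to three quarters, against
      -- `large`. A single coefficient must be 1, as the complement of `f` is 1 at `a` and on `T₂`.
      fibre : ∀ a → a ∈ A₀ → Σ (Fin S) λ i → ∀ g → Kills g T₁ → g ∙ a ≡ g ∙ lookup T₂ i
      fibre a a∈ = by-support (support β)
        where
        β = proj₁ (span-++ T₂ (T₂₁-spans a (A₀⊆ a a∈)))
        combination : ∀ g → Kills g T₁ → g ∙ a ≡ β ∙ values g T₂
        combination = proj₂ (span-++ T₂ (T₂₁-spans a (A₀⊆ a a∈)))
        total : β ∙ Vec.replicate S 1ℚ ≡ 1ℚ
        total = trans (cong (β ∙_) (sym T₂-opp)) (trans (sym (combination (opp h f) (zero-kills opp-A₁))) (opp-A₀ a a∈))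
        by-support : Support β → Σ (Fin S) λ i → ∀ g → Kills g T₁ → g ∙ a ≡ g ∙ lookup T₂ i
        by-support (no-support β≡0) = ⊥-elim (1≢0ℚ (trans (sym total) (trans (cong (_∙ Vec.replicate S 1ℚ) β≡0) (∙-zeroˡ (Vec.replicate S 1ℚ)))))
        by-support (one-support i eq _) = i , λ g kills → trans (combination g kills) (trans (eq (values g T₂))
          (trans (cong₂ _*ℚ_ coefficient (Vec.lookup-map i (g ∙_) T₂)) (ℚ.*-identityˡ _)))
          where
          coefficient : lookup β i ≡ 1ℚ
          coefficient = trans (sym (ℚ.*-identityʳ (lookup β i))) (trans (cong (lookup β i *ℚ_) (sym (Vec.lookup-replicate i 1ℚ)))
            (trans (sym (eq (Vec.replicate S 1ℚ))) total))
        by-support (many-support i j i≢j βi βj) = ⊥-elim (large (ℕ.≤-trans (ℕ.*-monoʳ-≤ 4 (zeros-bound P good)) (affine-count 0ℚ β i≢j βi βj)))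
          where
          P : Vec Bool S → Bool
          P y = does (bin? (affine-value 0ℚ β y))
          good : ∀ g → g ∈ Lz → P (code₂ g) ≡ true
          good g g∈ = dec-true (bin? (affine-value 0ℚ β (code₂ g))) (subst (λ v → v ≡ 0ℚ ⊎ v ≡ 1ℚ)
            (trans (combination g (zero-kills (proj₂ (∈-Lz⁻ g∈)))) (trans (cong (β ∙_) (sym (code₂-value (bin g (proj₁ (∈-Lz⁻ g∈))))))
              (sym (ℚ.+-identityˡ _))))
            (bin g (proj₁ (∈-Lz⁻ g∈)) a (A₀⊆ a a∈)))

      opaque
        indicator-exists : ∀ j → Σ (Vec ℚ M) λ ξ → Kills ξ T₁ × (∀ i → ξ ∙ lookup T₂ i ≡ (if does (i Fin.≟ j) then 1ℚ else 0ℚ))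
        indicator-exists j = finish (interpolate T₂₁-ind (unit Vec.++ 0v))
          where
          unit : Vec ℚ S
          unit = Vec.tabulate λ i → if does (i Fin.≟ j) then 1ℚ else 0ℚ
          parts : ∀ {k m ξ} (T : Vec (Vec ℚ M) k) {T' : Vec (Vec ℚ M) m} (y : Vec ℚ k) {y'} → values ξ (T Vec.++ T') ≡ y Vec.++ y' →
            values ξ T ≡ y × values ξ T' ≡ y'
          parts [] [] e = refl , e
          parts (t ∷ T) (y ∷ ys) e =
            let p , q = parts T ys (Vec.∷-injectiveʳ e) in cong₂ _∷_ (Vec.∷-injectiveˡ e) p , q
          zeros : ∀ {k ξ} (T : Vec (Vec ℚ M) k) → values ξ T ≡ 0v → Kills ξ T
          zeros [] _ = []
          zeros (t ∷ T) e = Vec.∷-injectiveˡ e ∷ zeros T (Vec.∷-injectiveʳ e)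
          finish : Σ (Vec ℚ M) (λ ξ → values ξ (T₂ Vec.++ T₁) ≡ unit Vec.++ 0v) →
            Σ (Vec ℚ M) λ ξ → Kills ξ T₁ × (∀ i → ξ ∙ lookup T₂ i ≡ (if does (i Fin.≟ j) then 1ℚ else 0ℚ))
          finish (ξ , eq) = let on-T₂ , on-T₁ = parts T₂ unit eq in ξ , zeros T₁ on-T₁ , λ i →
            trans (sym (Vec.lookup-map i (ξ ∙_) T₂)) (trans (cong (λ w → lookup w i) on-T₂) (Vec.lookup∘tabulate _ i))

      ξ : Fin S → Vec ℚ M
      ξ j = proj₁ (indicator-exists j)

      ξ-kills : ∀ j → Kills (ξ j) T₁
      ξ-kills j = proj₁ (proj₂ (indicator-exists j))

      ξ-T₂ : ∀ j i → ξ j ∙ lookup T₂ i ≡ (if does (i Fin.≟ j) then 1ℚ else 0ℚ)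
      ξ-T₂ j = proj₂ (proj₂ (indicator-exists j))

      ξ-A₁ : ∀ j a → a ∈ A₁ → ξ j ∙ a ≡ 0ℚ
      ξ-A₁ j a a∈ = kills-span (ξ-kills j) (T₁-spans a a∈)

      ξ-A₀ : ∀ j a (a∈ : a ∈ A₀) → ξ j ∙ a ≡ (if does (proj₁ (fibre a a∈) Fin.≟ j) then 1ℚ else 0ℚ)
      ξ-A₀ j a a∈ = trans (proj₂ (fibre a a∈) (ξ j) (ξ-kills j)) (ξ-T₂ j (proj₁ (fibre a a∈)))

      ξ-diagonal : ∀ j → ξ j ∙ lookup T₂ j ≡ 1ℚ
      ξ-diagonal j = trans (ξ-T₂ j j) (cong (λ b → if b then 1ℚ else 0ℚ) (dec-true (j Fin.≟ j) refl))

      ξ-bin : ∀ j → Bin A (ξ j)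
      ξ-bin j = side (λ a a∈ → subst (λ v → v ≡ 0ℚ ⊎ v ≡ 1ℚ) (sym (ξ-A₀ j a a∈)) (bit (does (proj₁ (fibre a a∈) Fin.≟ j)))) λ a a∈ → inj₁ (ξ-A₁ j a a∈)
        where
        bit : ∀ b → (if b then 1ℚ else 0ℚ) ≡ 0ℚ ⊎ (if b then 1ℚ else 0ℚ) ≡ 1ℚ
        bit true = inj₂ refl
        bit false = inj₁ refl

      T₂∈ : ∀ j → lookup T₂ j ∈ A
      T₂∈ j = AllV.lookup⁺ T₂⊆ j

      -- All members of the basis formed by `T₂` and `T₁` except the j-th point of `T₂` are zeros of
      -- `ξ j`.
      ξ-facet : ∀ j → Facet A (ξ j)
      ξ-facet j = (lookup T₂ j , T₂∈ j , λ e → 1≢0ℚ (trans (sym (ξ-diagonal j)) e)) , λ g kills →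
        let κ = g ∙ lookup T₂ j
            at : ∀ x → ξ j ∙ x ≡ 0ℚ → x ∈ A → g ∙ x ≡ (κ • ξ j) ∙ x
            at x ξx x∈ = trans (kills x x∈ ξx) (sym (trans (∙-scaleˡ κ (ξ j) x) (trans (cong (κ *ℚ_) ξx) (ℚ.*-zeroʳ κ))))
            diagonal : g ∙ lookup T₂ j ≡ (κ • ξ j) ∙ lookup T₂ j
            diagonal = sym (trans (∙-scaleˡ κ (ξ j) (lookup T₂ j)) (trans (cong (κ *ℚ_) (ξ-diagonal j)) (ℚ.*-identityʳ κ)))
            at₂ : ∀ i → g ∙ lookup T₂ i ≡ (κ • ξ j) ∙ lookup T₂ i
            at₂ i = case i Fin.≟ j of λ where
              (yes e) → subst (λ i → g ∙ lookup T₂ i ≡ (κ • ξ j) ∙ lookup T₂ i) (sym e) diagonal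
              (no i≢j) → at (lookup T₂ i) (trans (ξ-T₂ j i) (cong (λ b → if b then 1ℚ else 0ℚ) (dec-false (i Fin.≟ j) i≢j))) (T₂∈ i)
        in κ , λ a a∈ → trans (agree-span {f = g} {κ • ξ j} (AllV.++⁺ (AllV.lookup⁻ at₂)
             (AllV.map (λ {t} t∈ → at t (ξ-A₁ j t t∈) (A₁⊆ t t∈)) T₁⊆)) (T₂₁-spans a a∈)) (∙-scaleˡ κ (ξ j) a)

      -- Maximality of `A₀` leaves at most `p` zeros to `ξ j`, hence at least `|A| - p = q` points
      -- to its fibre.
      fibre-large : ∀ j → q ≤ length (NonZeros A (ξ j))
      fibre-large j = ℕ.+-cancelˡ-≤ (length (Zeros A (ξ j))) q _ (ℕ.≤-trans (ℕ.+-monoˡ-≤ q (max (ξ j) (ξ-bin j) (ξ-facet j)))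
        (ℕ.≤-reflexive (trans (sym p+q) (filter-split (zero? (ξ j)) A))))

      fibre-of : ∀ j a (a∈ : a ∈ A₀) → ξ j ∙ a ≢ 0ℚ → proj₁ (fibre a a∈) ≡ j
      fibre-of j a a∈ ≢0 = indicated (proj₁ (fibre a a∈) Fin.≟ j) (≢0 ∘ trans (ξ-A₀ j a a∈))
        where
        indicated : ∀ {i} (d : Dec (i ≡ j)) → (if does d then 1ℚ else 0ℚ) ≢ 0ℚ → i ≡ j
        indicated (yes e) _ = e
        indicated (no _) ≢0 = ⊥-elim (≢0 refl)

      -- The `S` fibres and `A₁` are pairwise disjoint sets of at least `q` points each, so
      -- `suc S * q ≤ p + q`.
      Sq≤p : S * q ≤ p
      Sq≤p = ℕ.+-cancelˡ-≤ q (S * q) p (subst (suc S * q ≤_) (trans p+q (ℕ.+-comm p q)) (disjoint-supports q (f ∷ Vec.tabulate ξ) A disjoint sizes))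
        where
        ξ≡ : ∀ j → lookup (Vec.tabulate ξ) j ≡ ξ j
        ξ≡ = Vec.lookup∘tabulate ξ
        not-both : ∀ {X : Set} j a → a ∈ A → f ∙ a ≢ 0ℚ → ξ j ∙ a ≢ 0ℚ → X
        not-both j a a∈ fa ξa = ⊥-elim (ξa (ξ-A₁ j a (∈-nonzeros⁺ a∈ fa)))
        disjoint : ∀ i j a → a ∈ A → lookup (f ∷ Vec.tabulate ξ) i ∙ a ≢ 0ℚ → lookup (f ∷ Vec.tabulate ξ) j ∙ a ≢ 0ℚ → i ≡ j
        disjoint zero zero a a∈ _ _ = refl
        disjoint zero (suc j) a a∈ fa ξa = not-both j a a∈ fa (subst (λ g → g ∙ a ≢ 0ℚ) (ξ≡ j) ξa)
        disjoint (suc i) zero a a∈ ξa fa = not-both i a a∈ fa (subst (λ g → g ∙ a ≢ 0ℚ) (ξ≡ i) ξa)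
        disjoint (suc i) (suc j) a a∈ ξi ξj = side {λ a → ξ i ∙ a ≢ 0ℚ → ξ j ∙ a ≢ 0ℚ → Fin.suc i ≡ suc j}
          (λ a a∈ p q → cong suc (trans (sym (fibre-of i a a∈ p)) (fibre-of j a a∈ q))) (λ a a∈ p _ → ⊥-elim (p (ξ-A₁ i a a∈))) a a∈
          (subst (λ g → g ∙ a ≢ 0ℚ) (ξ≡ i) ξi) (subst (λ g → g ∙ a ≢ 0ℚ) (ξ≡ j) ξj)
        sizes : ∀ i → q ≤ length (NonZeros A (lookup (f ∷ Vec.tabulate ξ) i))
        sizes zero = ℕ.≤-refl
        sizes (suc j) = subst (λ g → q ≤ length (NonZeros A g)) (sym (ξ≡ j)) (fibre-large j)

      -- `A₁` is then a single apex `z`. Replacing `g` by `g - (g ∙ z) h` makes it vanish at `z` and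
      -- shifts it by a constant on `A`, so no functional distinguishes two points of one fibre, and
      -- each fibre is a single point.
      pyramid : R ≡ 0 → p ≤ S
      pyramid R≡0 = subst (p ≤_) (length-toList T₂) (unique-⊆ uniq₀ λ a a∈ → subst (_∈ Vec.toList T₂) (sym (point a a∈)) (lookup∈ T₂ (proj₁ (fibre a a∈))))
        where
        apex : ∀ g → Kills (g ⊕ (-ℚ (g ∙ z)) • h) T₁
        apex g = kills-all T₁ T₁⊆ R≡0
          where
          cancel : ∀ x → x +ℚ (-ℚ x) *ℚ 1ℚ ≡ 0ℚ
          cancel = solve-∀ ℚ-ring
          kills-all : ∀ {k} (T : Vec (Vec ℚ M) k) → AllV (_∈ A₁) T → R ≡ 0 → Kills (g ⊕ (-ℚ (g ∙ z)) • h) T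
          kills-all [] [] _ = []
          kills-all (t ∷ T) (t∈ ∷ ts) e = trans (∙-linˡ g (-ℚ (g ∙ z)) h t)
            (trans (cong₂ (λ u v → u +ℚ (-ℚ (g ∙ z)) *ℚ v) (cong (g ∙_) (rank-one hom₁ (subst (λ r → Rank A₁ (suc r)) e rank₁) t∈ z∈)) (hom₁ t t∈)) (cancel (g ∙ z))) ∷ kills-all T ts e
        point : ∀ a (a∈ : a ∈ A₀) → a ≡ lookup T₂ (proj₁ (fibre a a∈))
        point a a∈ = ext∙ λ g → cancel (g ∙ a) (g ∙ x) (g ∙ z) (trans (sym (value g a (hom₀ a a∈)))
            (trans (proj₂ (fibre a a∈) (g ⊕ (-ℚ (g ∙ z)) • h) (apex g)) (value g x (hom x (T₂∈ (proj₁ (fibre a a∈)))))))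
          where
          x = lookup T₂ (proj₁ (fibre a a∈))
          value : ∀ g y → h ∙ y ≡ 1ℚ → (g ⊕ (-ℚ (g ∙ z)) • h) ∙ y ≡ g ∙ y +ℚ (-ℚ (g ∙ z)) *ℚ 1ℚ
          value g y hy = trans (∙-linˡ g (-ℚ (g ∙ z)) h y) (cong (λ u → g ∙ y +ℚ (-ℚ (g ∙ z)) *ℚ u) hy)
          cancel : ∀ x y c → x +ℚ (-ℚ c) *ℚ 1ℚ ≡ y +ℚ (-ℚ c) *ℚ 1ℚ → x ≡ y
          cancel x y c e = trans (lemma x c) (trans (cong (_+ℚ c) e) (sym (lemma y c)))
            where
            lemma : ∀ x c → x ≡ (x +ℚ (-ℚ c) *ℚ 1ℚ) +ℚ c
            lemma = solve-∀ ℚ-ring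

-- Numerical estimates

private
  slack : ∀ {m n} k → m + k ≡ n → m ≤ n
  slack {m} k refl = ℕ.m≤m+n m k

n<2^n : ∀ n → suc n ≤ 2 ^ n
n<2^n zero = ℕ.≤-refl
n<2^n (suc n) = ℕ.≤-trans (slack n (lemma n)) (ℕ.*-monoʳ-≤ 2 (n<2^n n))
  where
  lemma : ∀ n → suc (suc n) + n ≡ 2 * suc n
  lemma = ℕSolver.solve-∀

4n≤2^n+4 : ∀ n → 4 * n ≤ 2 ^ n + 4
4n≤2^n+4 0 = z≤n
4n≤2^n+4 1 = slack 2 refl
4n≤2^n+4 2 = slack 0 refl
4n≤2^n+4 (suc (suc (suc n))) = ℕ.≤-trans (slack (4 * n) (lemma n)) (ℕ.+-monoˡ-≤ 4 (ℕ.*-monoʳ-≤ 2 (ℕ.*-monoʳ-≤ 2 (ℕ.*-monoʳ-≤ 2 (n<2^n n)))))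
  where
  lemma : ∀ n → 4 * (3 + n) + 4 * n ≡ 2 * (2 * (2 * suc n)) + 4
  lemma = ℕSolver.solve-∀

-- Common to the two exceptional cases: with `R - 1` and `S - 1` when `A₀` is a simplex, with
-- `S - 2` and `R` when it is a cube, points and functionals exchanging roles. Equality holds for
-- `s = 0`, and for `r = 0` with `s = 1` or `s = 2`, which is why small cases are separated.
key-inequality : ∀ r s → (2 * suc r + s + 2) * 2 ^ s ≤ s * 2 ^ s * 2 ^ suc r + 2 * (suc r + s + 1)
key-inequality r 0 = slack 0 (lemma r)
  where
  lemma : ∀ r → (2 * suc r + 0 + 2) * 1 + 0 ≡ 2 * (suc r + 0 + 1)
  lemma = ℕSolver.solve-∀
key-inequality r 1 = ℕ.≤-trans (slack 0 (lemma r)) (ℕ.+-monoˡ-≤ (2 * (suc r + 1 + 1)) (ℕ.*-monoʳ-≤ 2 (n<2^n (suc r))))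
  where
  lemma : ∀ r → (2 * suc r + 1 + 2) * 2 + 0 ≡ 2 * suc (suc r) + 2 * (suc r + 1 + 1)
  lemma = ℕSolver.solve-∀
key-inequality 0 2 = ℕ.≤-refl
key-inequality (suc r) 2 = ℕ.≤-trans (slack (10 * r + 10) (lemma r)) (ℕ.+-monoˡ-≤ (2 * (suc (suc r) + 2 + 1)) (ℕ.*-monoʳ-≤ 8 (ℕ.*-monoʳ-≤ 2 (n<2^n (suc r)))))
  where
  lemma : ∀ r → (2 * suc (suc r) + 2 + 2) * 4 + (10 * r + 10) ≡ 8 * (2 * suc (suc r)) + 2 * (suc (suc r) + 2 + 1)
  lemma = ℕSolver.solve-∀
key-inequality 0 3 = slack 2 refl
key-inequality (suc r) (suc (suc (suc s))) = begin
  (2 * suc (suc r) + (3 + s) + 2) * X                 ≤⟨ ℕ.*-monoˡ-≤ X (slack {2 * suc (suc r) + (3 + s) + 2} (r + s * suc (suc r)) (lemma r s)) ⟩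
  ((3 + s) * suc (suc (suc r))) * X                   ≤⟨ ℕ.*-monoˡ-≤ X (ℕ.*-monoʳ-≤ (3 + s) (n<2^n (suc (suc r)))) ⟩
  ((3 + s) * 2 ^ suc (suc r)) * X                     ≡⟨ swap (3 + s) (2 ^ suc (suc r)) X ⟩
  (3 + s) * X * 2 ^ suc (suc r)                       ≤⟨ ℕ.m≤m+n _ _ ⟩
  (3 + s) * X * 2 ^ suc (suc r) + 2 * (suc (suc r) + (3 + s) + 1) ∎
  where
  open ℕ.≤-Reasoning
  X = 2 ^ (3 + s)
  lemma : ∀ r s → (2 * suc (suc r) + (3 + s) + 2) + (r + s * suc (suc r)) ≡ (3 + s) * suc (suc (suc r))
  lemma = ℕSolver.solve-∀
  swap : ∀ a b x → a * b * x ≡ a * x * b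
  swap = ℕSolver.solve-∀
key-inequality 0 (suc (suc (suc (suc s)))) = begin
  (2 + (4 + s) + 2) * X        ≤⟨ ℕ.*-monoˡ-≤ X (slack s (lemma s)) ⟩
  ((4 + s) * 2) * X            ≡⟨ swap (4 + s) 2 X ⟩
  (4 + s) * X * 2              ≤⟨ ℕ.m≤m+n _ _ ⟩
  (4 + s) * X * 2 + 2 * (1 + (4 + s) + 1) ∎
  where
  open ℕ.≤-Reasoning
  X = 2 ^ (4 + s)
  lemma : ∀ s → (2 + (4 + s) + 2) + s ≡ (4 + s) * 2
  lemma = ℕSolver.solve-∀
  swap : ∀ a b x → a * b * x ≡ a * x * b
  swap = ℕSolver.solve-∀

-- n and β stand for the number of points and of two-valued functionals (β counts a functional and its complement).
Bound : ℕ → ℕ → ℕ → Set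
Bound n β D = n ≤ D ⊎ β ≤ 2 * D ⊎ n * β ≤ (D ∸ 1) * (2 ^ D + 4)

bound? : ∀ n β D → Dec (Bound n β D)
bound? n β D = (n ℕ.≤? D) ⊎-dec ((β ℕ.≤? 2 * D) ⊎-dec (n * β ℕ.≤? (D ∸ 1) * (2 ^ D + 4)))

-- Here `D` is the dimension of the facet `A₀`, one less than that of `A`, whereas the last argument
-- of `Bound` is a rank.
module Numerics (p q v c U R S D : ℕ)
  (S+R : S + R ≡ suc D) (S≥1 : 1 ≤ S) (q≤p : q ≤ p) (v+c≤U : v + c ≤ U) (q≤ : q ≤ 2 ^ R) (q≥ : suc R ≤ q) (c≥ : 2 * R ≤ c)
  (v≤ : v ≤ 2 ^ S) (U≤ : U ≤ 2 ^ suc D) (p≤ : p ≤ 2 ^ D) (dense : 2 * suc D < U → 4 * p ≤ 3 * 2 ^ D)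
  (simplicial : p ≤ suc D → q ≤ suc R)
  (classes : 4 * v ≤ 3 * 2 ^ S ⊎ (S * q ≤ p × (R ≡ 0 → p ≤ S))) where

  private
    2^S2^R : 2 ^ S * 2 ^ R ≡ 2 ^ suc D
    2^S2^R = trans (sym (ℕ.^-distribˡ-+-* 2 S R)) (cong (2 ^_) S+R)

    2v+c≤ : v + (v + c) ≤ v + U
    2v+c≤ = ℕ.+-monoʳ-≤ v v+c≤U

  -- `A₀` is a simplex. If `R` is 0, a pyramid over it is again a simplex, the first alternative;
  -- otherwise the separate bounds on `p`, `q`, `v` and `U` multiply to the third.
  few-points : ∀ R S → S + R ≡ suc D → 1 ≤ S → (q ≤ suc R) → v ≤ 2 ^ S → p ≤ suc D → Bound (p + q) (v + (v + c)) (suc (suc D))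
  few-points zero S _ _ q≤1 _ p≤D = inj₁ (ℕ.≤-trans (ℕ.+-mono-≤ p≤D q≤1) (ℕ.≤-reflexive (ℕ.+-comm (suc D) 1)))
  few-points (suc r) (suc s) S+R _ q≤R v≤ p≤D = inj₂ (inj₂ (begin
    (p + q) * (v + (v + c))                            ≤⟨ ℕ.*-mono-≤ (ℕ.+-mono-≤ p≤D q≤R) (ℕ.≤-trans 2v+c≤ (ℕ.+-mono-≤ v≤ U≤)) ⟩
    (suc D + suc (suc r)) * (2 ^ suc s + 2 ^ suc D)    ≡⟨ cong₂ (λ a b → (a + suc (suc r)) * (2 ^ suc s + b)) D≡ 2^D ⟩
    (suc s + suc r + suc (suc r)) * (2 * X + 2 * X * Y) ≡⟨ lemma₁ s r X Y ⟩
    2 * ((2 * suc r + s + 2) * X) + 2 * (2 * suc r + s + 2) * X * Y ≤⟨ ℕ.+-monoˡ-≤ _ (ℕ.*-monoʳ-≤ 2 (key-inequality r s)) ⟩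
    2 * (s * X * Y + 2 * (suc r + s + 1)) + 2 * (2 * suc r + s + 2) * X * Y ≡⟨ lemma₂ s r X Y ⟩
    (suc s + suc r) * (2 * (2 * X * Y) + 4)            ≡⟨ cong₂ (λ a b → a * (2 * b + 4)) (sym D≡) (sym 2^D) ⟩
    suc D * (2 ^ suc (suc D) + 4)                      ∎))
    where
    open ℕ.≤-Reasoning
    X = 2 ^ s
    Y = 2 ^ suc r
    D≡ : suc D ≡ suc s + suc r
    D≡ = sym S+R
    2^D : 2 ^ suc D ≡ 2 * X * Y
    2^D = trans (cong (2 ^_) D≡) (ℕ.^-distribˡ-+-* 2 (suc s) (suc r))
    lemma₁ : ∀ s r X Y → (suc s + suc r + suc (suc r)) * (2 * X + 2 * X * Y) ≡ 2 * ((2 * suc r + s + 2) * X) + 2 * (2 * suc r + s + 2) * X * Y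
    lemma₁ = ℕSolver.solve-∀
    lemma₂ : ∀ s r X Y → 2 * (s * X * Y + 2 * (suc r + s + 1)) + 2 * (2 * suc r + s + 2) * X * Y ≡ (suc s + suc r) * (2 * (2 * X * Y) + 4)
    lemma₂ = ℕSolver.solve-∀

  -- `A₀` is a cube. If `S` is 1, then `v ≤ 2` and the second alternative persists. Otherwise at
  -- least `2 * R` of the `2 * suc D` functionals on `A₀` are used up by `c`, which leaves
  -- `v ≤ 2 * S`.
  few-functionals : ∀ R S → S + R ≡ suc D → 1 ≤ S → q ≤ 2 ^ R → 2 * R ≤ c → v ≤ 2 ^ S → U ≤ 2 * suc D → Bound (p + q) (v + (v + c)) (suc (suc D))
  few-functionals R 1 _ _ _ _ v≤ U≤D = inj₂ (inj₁ (ℕ.≤-trans 2v+c≤ (ℕ.≤-trans (ℕ.+-mono-≤ v≤ U≤D) (ℕ.≤-reflexive (lemma D)))))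
    where
    lemma : ∀ D → 2 + 2 * suc D ≡ 2 * suc (suc D)
    lemma = ℕSolver.solve-∀
  few-functionals R (suc (suc s)) S+R _ q≤ c≥ _ U≤D = inj₂ (inj₂ (begin
    (p + q) * (v + (v + c))                    ≤⟨ ℕ.*-mono-≤ (ℕ.+-mono-≤ p≤ q≤) (ℕ.≤-trans 2v+c≤ (ℕ.+-mono-≤ v≤2S U≤D)) ⟩
    (2 ^ D + Y) * (2 * suc (suc s) + 2 * suc D) ≡⟨ cong₂ (λ a b → (a + Y) * (2 * suc (suc s) + 2 * b)) 2^D (sym S+R) ⟩
    (X * Y + Y) * (2 * suc (suc s) + 2 * (suc (suc s) + R)) ≡⟨ lemma₁ s R X Y ⟩
    2 * ((2 * suc s + R + 2) * Y) + 2 * (2 * suc s + R + 2) * (X * Y) ≤⟨ ℕ.+-monoˡ-≤ _ (ℕ.*-monoʳ-≤ 2 (key-inequality s R)) ⟩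
    2 * (R * Y * X + 2 * (suc s + R + 1)) + 2 * (2 * suc s + R + 2) * (X * Y) ≡⟨ lemma₂ s R X Y ⟩
    (suc (suc s) + R) * (2 * (2 * (X * Y)) + 4) ≡⟨ cong₂ (λ a b → a * (2 * (2 * b) + 4)) S+R (sym 2^D) ⟩
    suc D * (2 ^ suc (suc D) + 4)               ∎))
    where
    open ℕ.≤-Reasoning
    X = 2 ^ suc s
    Y = 2 ^ R
    2^D : 2 ^ D ≡ X * Y
    2^D = trans (cong (2 ^_) (ℕ.suc-injective (sym S+R))) (ℕ.^-distribˡ-+-* 2 (suc s) R)
    v≤2S : v ≤ 2 * suc (suc s)
    v≤2S = ℕ.+-cancelʳ-≤ (2 * R) v (2 * suc (suc s)) (ℕ.≤-trans (ℕ.+-monoʳ-≤ v c≥) (ℕ.≤-trans v+c≤U (ℕ.≤-trans U≤D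
      (ℕ.≤-reflexive (trans (cong (2 *_) (sym S+R)) (ℕ.*-distribˡ-+ 2 (suc (suc s)) R))))))
    lemma₁ : ∀ s R X Y → (X * Y + Y) * (2 * suc (suc s) + 2 * (suc (suc s) + R)) ≡ 2 * ((2 * suc s + R + 2) * Y) + 2 * (2 * suc s + R + 2) * (X * Y)
    lemma₁ = ℕSolver.solve-∀
    lemma₂ : ∀ s R X Y → 2 * (R * Y * X + 2 * (suc s + R + 1)) + 2 * (2 * suc s + R + 2) * (X * Y) ≡ (suc (suc s) + R) * (2 * (2 * (X * Y)) + 4)
    lemma₂ = ℕSolver.solve-∀

  -- (p + q)(2v + c) = 2p(v + c) + 2qv - (p - q)c
  product-split : ∀ x → p ≡ q + x → (p + q) * (v + (v + c)) + x * c ≡ 2 * (p * (v + c)) + 2 * (q * v)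
  product-split x refl = lemma q x v c
    where
    lemma : ∀ q x v c → (q + x + q) * (v + (v + c)) + x * c ≡ 2 * ((q + x) * (v + c)) + 2 * (q * v)
    lemma = ℕSolver.solve-∀

  -- The quarter missing from `2 * (q * v)` is worth `2 ^ D`. It pays for the additive terms:
  -- doubling the inductive bound gives 8D, the new bound has only 4(D+1), and 4D - 4 is at most
  -- `2 ^ D`.
  product-deficit : p * U ≤ D * (2 ^ suc D + 4) → 4 * (q * v) ≤ 3 * 2 ^ suc D → (p + q) * (v + (v + c)) ≤ suc D * (2 ^ suc (suc D) + 4)
  product-deficit pU qv = ℕ.*-cancelˡ-≤ 2 (begin
    2 * ((p + q) * (v + (v + c)))                        ≤⟨ ℕ.*-monoʳ-≤ 2 (slack {(p + q) * (v + (v + c))} ((p ∸ q) * c) (product-split (p ∸ q) (sym (ℕ.m+[n∸m]≡n q≤p)))) ⟩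
    2 * (2 * (p * (v + c)) + 2 * (q * v))                ≡⟨ lemma₁ (p * (v + c)) (q * v) ⟩
    4 * (p * (v + c)) + 4 * (q * v)                      ≤⟨ ℕ.+-mono-≤ (ℕ.*-monoʳ-≤ 4 (ℕ.≤-trans (ℕ.*-monoʳ-≤ p v+c≤U) pU)) qv ⟩
    4 * (D * (2 * X + 4)) + 3 * (2 * X)                  ≡⟨ lemma₂ D X ⟩
    8 * (D * X) + 6 * X + (8 * D + 2 * (4 * D))          ≤⟨ ℕ.+-monoʳ-≤ (8 * (D * X) + 6 * X) (ℕ.+-monoʳ-≤ (8 * D) (ℕ.*-monoʳ-≤ 2 (4n≤2^n+4 D))) ⟩
    8 * (D * X) + 6 * X + (8 * D + 2 * (X + 4))          ≡⟨ lemma₃ D X ⟩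
    2 * (suc D * (2 * (2 * X) + 4))                      ∎)
    where
    open ℕ.≤-Reasoning
    X = 2 ^ D
    lemma₁ : ∀ a b → 2 * (2 * a + 2 * b) ≡ 4 * a + 4 * b
    lemma₁ = ℕSolver.solve-∀
    lemma₂ : ∀ D X → 4 * (D * (2 * X + 4)) + 3 * (2 * X) ≡ 8 * (D * X) + 6 * X + (8 * D + 2 * (4 * D))
    lemma₂ = ℕSolver.solve-∀
    lemma₃ : ∀ D X → 8 * (D * X) + 6 * X + (8 * D + 2 * (X + 4)) ≡ 2 * (suc D * (2 * (2 * X) + 4))
    lemma₃ = ℕSolver.solve-∀

  -- Now `q * v` may reach `2 ^ suc D`, and the excess 4D - 4 = 4(S+R-2) is paid by the term (p-q)c
  -- instead. It is at least 4(S-1)R because p - q ≥ (S-1)q, q ≥ 2 and c ≥ 2R; the difference is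
  -- 4(S-2)(R-1).
  product-classes : ∀ r s → R ≡ suc r → S ≡ suc (suc s) → S * q ≤ p → p * U ≤ D * (2 ^ suc D + 4) →
    (p + q) * (v + (v + c)) ≤ suc D * (2 ^ suc (suc D) + 4)
  product-classes r s refl refl Sq≤p pU = ℕ.+-cancelʳ-≤ (4 * (suc s * suc r)) _ _ (begin
    (p + q) * (v + (v + c)) + 4 * (suc s * suc r)      ≤⟨ ℕ.+-monoʳ-≤ ((p + q) * (v + (v + c))) xc ⟩
    (p + q) * (v + (v + c)) + x * c                    ≡⟨ product-split x (sym (ℕ.m+[n∸m]≡n q≤p)) ⟩
    2 * (p * (v + c)) + 2 * (q * v)                    ≤⟨ ℕ.+-mono-≤ (ℕ.*-monoʳ-≤ 2 (ℕ.≤-trans (ℕ.*-monoʳ-≤ p v+c≤U) pU)) (ℕ.*-monoʳ-≤ 2 qv) ⟩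
    2 * (D * (2 ^ suc D + 4)) + 2 * 2 ^ suc D          ≡⟨ cong (λ d → 2 * (d * (2 ^ suc D + 4)) + 2 * 2 ^ suc D) D≡ ⟩
    2 * ((suc s + suc r) * (2 ^ suc D + 4)) + 2 * 2 ^ suc D ≤⟨ slack (4 * (s * r)) (lemma s r (2 ^ suc D)) ⟩
    suc (suc s + suc r) * (2 * 2 ^ suc D + 4) + 4 * (suc s * suc r) ≡⟨ cong (λ d → suc d * (2 * 2 ^ suc D + 4) + 4 * (suc s * suc r)) (sym D≡) ⟩
    suc D * (2 ^ suc (suc D) + 4) + 4 * (suc s * suc r) ∎)
    where
    open ℕ.≤-Reasoning
    x = p ∸ q
    D≡ : D ≡ suc s + suc r
    D≡ = ℕ.suc-injective (sym S+R)
    qv : q * v ≤ 2 ^ suc D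
    qv = ℕ.≤-trans (ℕ.*-mono-≤ q≤ v≤) (ℕ.≤-reflexive (trans (ℕ.*-comm (2 ^ R) (2 ^ S)) 2^S2^R))
    sq≤x : suc s * q ≤ x
    sq≤x = ℕ.≤-trans (ℕ.≤-reflexive (sym (ℕ.m+n∸m≡n q (suc s * q)))) (ℕ.∸-monoˡ-≤ q Sq≤p)
    xc : 4 * (suc s * suc r) ≤ x * c
    xc = ℕ.≤-trans (ℕ.≤-reflexive (regroup (suc s) (suc r))) (ℕ.*-mono-≤ (ℕ.≤-trans (ℕ.*-monoʳ-≤ (suc s) (ℕ.≤-trans (s≤s (s≤s z≤n)) q≥)) sq≤x) c≥)
      where
      regroup : ∀ a b → 4 * (a * b) ≡ a * 2 * (2 * b)
      regroup = ℕSolver.solve-∀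
    lemma : ∀ s r X → 2 * ((suc s + suc r) * (X + 4)) + 2 * X + 4 * (s * r) ≡ suc (suc s + suc r) * (2 * X + 4) + 4 * (suc s * suc r)
    lemma = ℕSolver.solve-∀

  few-zeros : 4 * v ≤ 3 * 2 ^ S → 4 * (q * v) ≤ 3 * 2 ^ suc D
  few-zeros 4v = begin
    4 * (q * v)            ≡⟨ regroup q v ⟩
    (4 * v) * q            ≤⟨ ℕ.*-mono-≤ 4v q≤ ⟩
    (3 * 2 ^ S) * 2 ^ R    ≡⟨ ℕ.*-assoc 3 (2 ^ S) (2 ^ R) ⟩
    3 * (2 ^ S * 2 ^ R)    ≡⟨ cong (3 *_) 2^S2^R ⟩
    3 * 2 ^ suc D          ∎
    where
    open ℕ.≤-Reasoning
    regroup : ∀ q v → 4 * (q * v) ≡ (4 * v) * q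
    regroup = ℕSolver.solve-∀

  step : Bound p U (suc D) → Bound (p + q) (v + (v + c)) (suc (suc D))
  step (inj₁ p≤D) = few-points R S S+R S≥1 (simplicial p≤D) v≤ p≤D
  step (inj₂ (inj₁ U≤D)) = few-functionals R S S+R S≥1 q≤ c≥ v≤ U≤D
  step (inj₂ (inj₂ pU)) = by-classes classes
    where
    by-classes : 4 * v ≤ 3 * 2 ^ S ⊎ (S * q ≤ p × (R ≡ 0 → p ≤ S)) → Bound (p + q) (v + (v + c)) (suc (suc D))
    by-classes (inj₁ 4v) = inj₂ (inj₂ (product-deficit pU (few-zeros 4v)))
    by-classes (inj₂ (Sq≤p , pyramid)) = by-size R S refl refl S≥1
      where
      open ℕ.≤-Reasoning
      regroup : ∀ X → 3 * X * 2 ≡ 3 * (2 * X)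
      regroup = ℕSolver.solve-∀
      p≤D : R ≡ 0 → p ≤ suc D
      p≤D R≡ = ℕ.≤-trans (pyramid R≡) (subst (S ≤_) S+R (ℕ.m≤m+n S R))
      by-size : ∀ R' S' → R ≡ R' → S ≡ S' → 1 ≤ S' → Bound (p + q) (v + (v + c)) (suc (suc D))
      by-size zero _ R≡ S≡ _ = few-points R S S+R S≥1 (simplicial (p≤D R≡)) v≤ (p≤D R≡)
      by-size (suc r) (suc (suc s)) R≡ S≡ _ = inj₂ (inj₂ (product-classes r s R≡ S≡ Sq≤p pU))
      -- With `S` equal to 1 the term (p-q)c may vanish, so the missing quarter is taken from the
      -- points: unless `A₀` has few functionals, `q ≤ p` is at most three quarters of `2 ^ D`, and
      -- `v ≤ 2`.
      by-size (suc r) 1 R≡ S≡ _ with 2 * suc D ℕ.<? U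
      ... | no U≤D = few-functionals R S S+R S≥1 q≤ c≥ v≤ (ℕ.≮⇒≥ U≤D)
      ... | yes U>D = inj₂ (inj₂ (product-deficit pU (begin
        4 * (q * v)     ≤⟨ ℕ.*-monoʳ-≤ 4 (ℕ.*-mono-≤ q≤p (subst (λ S → v ≤ 2 ^ S) S≡ v≤)) ⟩
        4 * (p * 2)     ≡⟨ sym (ℕ.*-assoc 4 p 2) ⟩
        4 * p * 2       ≤⟨ ℕ.*-monoˡ-≤ 2 (dense U>D) ⟩
        3 * 2 ^ D * 2   ≡⟨ regroup (2 ^ D) ⟩
        3 * 2 ^ suc D   ∎)))

-- The size bound by induction on the dimension

module _ {M : ℕ} {h : Vec ℚ M} where

  opaque
    some-facet : ∀ {A D} → Homogeneous h A → TL A → Rank A (suc D) → Σ (Vec ℚ M) λ f → Bin A f × Facet A f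
    some-facet {A} hom tl (rank (t ∷ _) (t∈ ∷ _) _ _) =
      let ψ , nonneg , ψ-facet , _ = rotate A t (∈⇒inspan t∈) h (λ a a∈ → subst (0ℚ ≤ℚ_) (sym (hom a a∈)) 0≤1ℚ)
                                       (λ e → 1≢0ℚ (trans (sym (hom t t∈)) e))
          f , fbin , facet , _ = normalise tl nonneg ψ-facet
      in f , fbin , facet

  -- Induction on the dimension, splitting along a facet with the largest number of vertices.
  size-bound : ∀ D {A L} → Homogeneous h A → Unique A → TL A → Rank A (suc D) → Sys A L → Bound (length A) (length L) (suc D)
  size-bound zero hom uniq tl rk sys = inj₁ (proj₁ (points-bound-sys uniq tl hom sys rk))
  size-bound (suc D) {A} {L} hom uniq tl rk sys = start (some-facet hom tl rk)
    where
    n = length A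
    zeros≤ : ∀ f → length (Zeros A f) ≤ n
    zeros≤ f = List.length-filter (zero? f) A

    from-maximal : ∀ f → Bin A f → Facet A f → (∀ ψ → Bin A ψ → Facet A ψ → length (Zeros A ψ) ≤ length (Zeros A f)) →
      Bound n (length L) (suc (suc D))
    from-maximal f fbin facet max = weaken (Numerics.step p q v c U R S D
        (ℕ.suc-injective (trans (sym (ℕ.+-suc S R)) S+R)) (S≥1 x₀∈) q≤p v+c≤U q≤ q≥ c≥ v≤ U≤ (proj₁ points₀) (proj₂ points₀) simplicial classes
        (size-bound D hom₀ uniq₀ tl₀ rank₀ (proj₂ sys₀)))
      where
      open Split hom uniq tl rk sys fbin facet
      points₀ : p ≤ 2 ^ D × (2 * suc D < U → 4 * p ≤ 3 * 2 ^ D)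
      points₀ = points-bound-sys uniq₀ tl₀ hom₀ (proj₂ sys₀) rank₀
      head : ∀ {G k} → Rank G (suc k) → Σ (Vec ℚ M) (_∈ G)
      head (rank (t ∷ _) (t∈ ∷ _) _ _) = t , t∈
      x₀∈ = proj₂ (head rank₀)
      open Maximal x₀∈ max
      classes : 4 * v ≤ 3 * 2 ^ S ⊎ (S * q ≤ p × (R ≡ 0 → p ≤ S))
      classes = by-density (4 * v ℕ.≤? 3 * 2 ^ S)
        where
        by-density : Dec (4 * v ≤ 3 * 2 ^ S) → 4 * v ≤ 3 * 2 ^ S ⊎ (S * q ≤ p × (R ≡ 0 → p ≤ S))
        by-density (yes few) = inj₁ few
        by-density (no large) = inj₂ (Classes.Sq≤p large , Classes.pyramid large)
      weaken : Bound (p + q) (v + (v + c)) (suc (suc D)) → Bound n (length L) (suc (suc D))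
      weaken (inj₁ few) = inj₁ (subst (_≤ suc (suc D)) (sym p+q) few)
      weaken (inj₂ (inj₁ few)) = inj₂ (inj₁ (ℕ.≤-trans L≤ few))
      weaken (inj₂ (inj₂ few)) = inj₂ (inj₂ (ℕ.≤-trans (ℕ.*-mono-≤ (ℕ.≤-reflexive p+q) L≤) few))

    -- Existence of a facet with more vertices is not decided. The bound itself is decidable, so it
    -- may be assumed to fail, and then every larger facet, from which the bound would follow by
    -- recursion, is excluded. `k` limits the number of ascents.
    climb : ∀ k f → Bin A f → Facet A f → n ≤ k + length (Zeros A f) → Bound n (length L) (suc (suc D))
    climb k f fbin facet n≤ = decidable-stable (bound? n (length L) (suc (suc D))) λ ¬bound →
      ¬bound (from-maximal f fbin facet λ ψ ψ-bin ψ-facet → ℕ.≮⇒≥ λ lt → ¬bound (larger k n≤ ψ ψ-bin ψ-facet lt))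
      where
      larger : ∀ k → n ≤ k + length (Zeros A f) → ∀ ψ → Bin A ψ → Facet A ψ → length (Zeros A f) < length (Zeros A ψ) →
        Bound n (length L) (suc (suc D))
      larger zero n≤ ψ _ _ lt = ⊥-elim (ℕ.<-irrefl refl (ℕ.<-≤-trans lt (ℕ.≤-trans (zeros≤ ψ) n≤)))
      larger (suc k) n≤ ψ ψ-bin ψ-facet lt = climb k ψ ψ-bin ψ-facet
        (ℕ.≤-trans n≤ (ℕ.≤-trans (ℕ.≤-reflexive (sym (ℕ.+-suc k _))) (ℕ.+-monoʳ-≤ k lt)))

    start : Σ (Vec ℚ M) (λ f → Bin A f × Facet A f) → Bound n (length L) (suc (suc D))
    start (f , fbin , facet) = climb n f fbin facet (ℕ.m≤m+n n _)

-- Recognising the cube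

private
  bit-mismatch : ∀ {u b} → u ≡ 0ℚ ⊎ u ≡ 1ℚ → (u ≡ ⟦ b ⟧ × (if b then 1ℚ +ℚ -ℚ u else u) ≡ 0ℚ) ⊎ (u ≢ ⟦ b ⟧ × (if b then 1ℚ +ℚ -ℚ u else u) ≡ 1ℚ)
  bit-mismatch {b = true} (inj₁ refl) = inj₂ ((λ ()) , refl)
  bit-mismatch {b = true} (inj₂ refl) = inj₁ (refl , refl)
  bit-mismatch {b = false} (inj₁ refl) = inj₁ (refl , refl)
  bit-mismatch {b = false} (inj₂ refl) = inj₂ ((λ ()) , refl)

module _ {M : ℕ} where

  record Facets (A fl : List (Vec ℚ M)) : Set where
    field
      bin : ∀ f → f ∈ fl → Bin A f
      facet : ∀ f → f ∈ fl → Facet A f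
      distinct : AllPairs (λ f g → ¬ Agree A f g) fl
      complete : ∀ f → Bin A f → Facet A f → Σ (Vec ℚ M) λ g → g ∈ fl × Agree A f g

  facet-cong : ∀ {A} {f g : Vec ℚ M} → Agree A f g → Facet A f → Facet A g
  facet-cong agree ((a , a∈ , fa≢0) , det) = (a , a∈ , λ e → fa≢0 (trans (agree a a∈) e)) , λ k kills →
    let κ , eq = det k (λ x x∈ fx → kills x x∈ (trans (sym (agree x x∈)) fx))
    in κ , λ x x∈ → trans (eq x x∈) (cong (κ *ℚ_) (agree x x∈))

  -- `realise` expresses the independence of `h` and the axes on the span of `A`; at height 0 it
  -- supplies the columns of the inverse coordinate matrix.
  record Cube (h : Vec ℚ M) (A : List (Vec ℚ M)) (d : ℕ) : Set where
    field
      axes : Vec (Vec ℚ M) d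
      axes-bin : AllV (Bin A) axes
      realise : Realises {h = h} {A} axes
      attained : ∀ y → Σ (Vec ℚ M) λ a → a ∈ A × Vec.map (_∙ a) axes ≡ Vec.map ⟦_⟧ y

  -- The Hamming distance to the pattern `y`, as a functional: at a point of height 1 whose
  -- coordinates are bits it counts the coordinates that differ from `y`.
  mismatch : ∀ {k} → Vec ℚ M → Vec (Vec ℚ M) k → Vec Bool k → Vec ℚ M
  mismatch h [] [] = 0v
  mismatch h (f ∷ fs) (b ∷ y) = mismatch h fs y ⊕ 1ℚ • (if b then opp h f else f)

  private
    mismatch-step : ∀ {h f x : Vec ℚ M} {u b} → h ∙ x ≡ 1ℚ → f ∙ x ≡ u → (if b then opp h f else f) ∙ x ≡ (if b then 1ℚ +ℚ -ℚ u else u)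
    mismatch-step {b = true} hx fx = opp-value hx fx
    mismatch-step {b = false} _ fx = fx

    mismatch-∷ : ∀ {k h f x u b} {fs : Vec (Vec ℚ M) k} y → h ∙ x ≡ 1ℚ → f ∙ x ≡ u →
      mismatch h (f ∷ fs) (b ∷ y) ∙ x ≡ mismatch h fs y ∙ x +ℚ (if b then 1ℚ +ℚ -ℚ u else u)
    mismatch-∷ {h = h} {f} {x} {u} {b} {fs} y hx fx = trans (∙-linˡ (mismatch h fs y) 1ℚ (if b then opp h f else f) x)
      (cong (mismatch h fs y ∙ x +ℚ_) (trans (ℚ.*-identityˡ _) (mismatch-step {b = b} hx fx)))

  mismatch-zero : ∀ {k h x} {fs : Vec (Vec ℚ M) k} y → h ∙ x ≡ 1ℚ → Vec.map (_∙ x) fs ≡ Vec.map ⟦_⟧ y → mismatch h fs y ∙ x ≡ 0ℚ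
  mismatch-zero {x = x} {[]} [] _ _ = ∙-zeroˡ x
  mismatch-zero {x = x} {f ∷ fs} (b ∷ y) hx eq = trans (mismatch-∷ {b = b} {fs} y hx (Vec.∷-injectiveˡ eq))
    (cong₂ _+ℚ_ (mismatch-zero y hx (Vec.∷-injectiveʳ eq)) (no-mismatch b))
    where
    no-mismatch : ∀ b → (if b then 1ℚ +ℚ -ℚ ⟦ b ⟧ else ⟦ b ⟧) ≡ 0ℚ
    no-mismatch true = refl
    no-mismatch false = refl

  mismatch-positive : ∀ {k h x} {fs : Vec (Vec ℚ M) k} y → h ∙ x ≡ 1ℚ → AllV (λ f → f ∙ x ≡ 0ℚ ⊎ f ∙ x ≡ 1ℚ) fs →
    0ℚ ≤ℚ mismatch h fs y ∙ x × (Vec.map (_∙ x) fs ≢ Vec.map ⟦_⟧ y → 1ℚ ≤ℚ mismatch h fs y ∙ x)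
  mismatch-positive {x = x} {[]} [] _ _ = ℚ.≤-reflexive (sym (∙-zeroˡ x)) , λ ne → ⊥-elim (ne refl)
  mismatch-positive {h = h} {x} {f ∷ fs} (b ∷ y) hx (fb ∷ fsb) = combine (bit-mismatch {b = b} fb) (mismatch-positive {fs = fs} y hx fsb)
    where
    Δ = mismatch h fs y ∙ x
    total : ∀ {w} → (if b then 1ℚ +ℚ -ℚ (f ∙ x) else f ∙ x) ≡ w → mismatch h (f ∷ fs) (b ∷ y) ∙ x ≡ Δ +ℚ w
    total e = trans (mismatch-∷ {b = b} {fs} y hx refl) (cong (Δ +ℚ_) e)
    combine : (f ∙ x ≡ ⟦ b ⟧ × (if b then 1ℚ +ℚ -ℚ (f ∙ x) else f ∙ x) ≡ 0ℚ) ⊎ (f ∙ x ≢ ⟦ b ⟧ × (if b then 1ℚ +ℚ -ℚ (f ∙ x) else f ∙ x) ≡ 1ℚ) →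
      0ℚ ≤ℚ Δ × (Vec.map (_∙ x) fs ≢ Vec.map ⟦_⟧ y → 1ℚ ≤ℚ Δ) →
      0ℚ ≤ℚ mismatch h (f ∷ fs) (b ∷ y) ∙ x × (Vec.map (_∙ x) (f ∷ fs) ≢ Vec.map ⟦_⟧ (b ∷ y) → 1ℚ ≤ℚ mismatch h (f ∷ fs) (b ∷ y) ∙ x)
    combine (inj₁ (same , matched)) (nonneg , pos) = subst (0ℚ ≤ℚ_) (sym Δ≡) nonneg ,
        λ ne → subst (1ℚ ≤ℚ_) (sym Δ≡) (pos λ e → ne (cong₂ _∷_ same e))
      where
      Δ≡ = trans (total matched) (ℚ.+-identityʳ Δ)
    combine (inj₂ (_ , one)) (nonneg , _) = ℚ.≤-trans 0≤1ℚ ge , λ _ → ge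
      where
      ge : 1ℚ ≤ℚ mismatch h (f ∷ fs) (b ∷ y) ∙ x
      ge = subst (1ℚ ≤ℚ_) (sym (total one)) (subst (_≤ℚ Δ +ℚ 1ℚ) (ℚ.+-identityˡ 1ℚ) (ℚ.+-monoˡ-≤ 1ℚ nonneg))

  -- With so few two-valued functionals, a missing vertex of the cube would be cut off by a further facet.
  cube : ∀ {h A L d} → Homogeneous h A → Unique A → TL A → Rank A (suc d) → Sys A L → length L ≤ 2 * suc d → Cube h A d
  cube {h} {A} {L} {d} hom uniq tl rk sys few = subst (Cube h A) (ℕ.suc-injective size≡) (record
      { axes = coords ; axes-bin = coords-bin ; realise = realise ; attained = attained })
    where
    open Coordinates hom uniq (sys-coordinates tl hom sys rk) (Sys.bin sys)
    x₀ : Σ (Vec ℚ M) (_∈ A)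
    x₀ = head rk
      where
      head : ∀ {k} → Rank A (suc k) → Σ (Vec ℚ M) (_∈ A)
      head (rank (t ∷ _) (t∈ ∷ _) _ _) = t , t∈
    only-signs : ∀ g → Bin A g → Σ (Vec ℚ M) λ f → f ∈ all-signs × Agree A g f
    only-signs g gbin = by-search (any? (agree? A g) all-signs)
      where
      hits : ∀ f → f ∈ g ∷ all-signs → Σ (Vec ℚ M) λ k → k ∈ L × Agree A f k
      hits f (here refl) = Sys.complete sys f gbin
      hits f (there f∈) = Sys.complete sys f (all-signs-bin hom (Sys.bin sys) f∈)
      too-many : ¬ Any (Agree A g) all-signs → suc (2 * suc d) ≤ length L
      too-many new = subst (λ k → suc k ≤ length L) length-all-signs
        (pigeonhole {R = Agree A} {xs = g ∷ all-signs} (All.tabulate (λ f∈ agree → new (lose f∈ agree)) ∷ all-signs-distinct (proj₂ x₀))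
          hits λ _ _ ¬agree p q → ¬agree λ a a∈ → trans (p a a∈) (sym (q a a∈)))
      by-search : Dec (Any (Agree A g) all-signs) → Σ (Vec ℚ M) λ f → f ∈ all-signs × Agree A g f
      by-search (yes found) = find found
      by-search (no new) = ⊥-elim (ℕ.<-irrefl refl (ℕ.<-≤-trans (s≤s few) (too-many new)))
    Attained : Vec Bool size → Set
    Attained y = Σ (Vec ℚ M) λ a → a ∈ A × Vec.map (_∙ a) coords ≡ Vec.map ⟦_⟧ y
    attained : ∀ y → Attained y
    attained y = by-search (any? (λ a → Vec.≡-dec ℚ._≟_ (Vec.map (_∙ a) coords) (Vec.map ⟦_⟧ y)) A)
      where
      cut-off : ¬ Any (λ a → Vec.map (_∙ a) coords ≡ Vec.map ⟦_⟧ y) A → Σ (Vec ℚ M) (λ z → InSpan A z × h ∙ z ≡ 1ℚ × Vec.map (_∙ z) coords ≡ Vec.map ⟦_⟧ y) → ⊥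
      cut-off missing (z , z∈ , hz , zy) = violated (rotate A z z∈ φ nonneg λ e → case trans (sym φz) e of λ ())
        where
        -- Hamming distance to `y` minus 1: nonnegative on `A` when `y` is not attained, but -1 at
        -- the missing vertex `z`.
        φ : Vec ℚ M
        φ = mismatch h coords y ⊕ (-ℚ 1ℚ) • h
        value : ∀ {x} → h ∙ x ≡ 1ℚ → φ ∙ x ≡ mismatch h coords y ∙ x +ℚ -ℚ 1ℚ
        value {x} hx = trans (∙-linˡ (mismatch h coords y) (-ℚ 1ℚ) h x) (cong (λ u → mismatch h coords y ∙ x +ℚ (-ℚ 1ℚ) *ℚ u) hx)
        φz : φ ∙ z ≡ -ℚ 1ℚ
        φz = trans (value hz) (cong (_+ℚ -ℚ 1ℚ) (mismatch-zero y hz zy))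
        nonneg : Nonneg A φ
        nonneg a a∈ = subst (0ℚ ≤ℚ_) (sym (value (hom a a∈))) (≤⇒0≤- (proj₂ (mismatch-positive y (hom a a∈)
          (AllV.map (λ b → b a a∈) coords-bin)) λ e → missing (lose a∈ e)))
        bits : ∀ {k} {fs : Vec (Vec ℚ M) k} {y} → Vec.map (_∙ z) fs ≡ Vec.map ⟦_⟧ y → AllV (λ f → f ∙ z ≡ 0ℚ ⊎ f ∙ z ≡ 1ℚ) fs
        bits {fs = []} _ = []
        bits {fs = f ∷ fs} {true ∷ y} e = inj₂ (Vec.∷-injectiveˡ e) ∷ bits {y = y} (Vec.∷-injectiveʳ e)
        bits {fs = f ∷ fs} {false ∷ y} e = inj₁ (Vec.∷-injectiveˡ e) ∷ bits {y = y} (Vec.∷-injectiveʳ e)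
        opp-bit : ∀ {f} → f ∙ z ≡ 0ℚ ⊎ f ∙ z ≡ 1ℚ → opp h f ∙ z ≡ 0ℚ ⊎ opp h f ∙ z ≡ 1ℚ
        opp-bit (inj₁ e) = inj₂ (opp-value hz e)
        opp-bit (inj₂ e) = inj₁ (opp-value hz e)
        sign-at-z : ∀ {f} → f ∈ all-signs → f ∙ z ≡ 0ℚ ⊎ f ∙ z ≡ 1ℚ
        sign-at-z = signs-elim coords (λ where
            (here refl) → inj₁ (∙-zeroˡ z)
            (there (here refl)) → inj₂ hz)
          (bits {y = y} zy) (AllV.map opp-bit (bits {y = y} zy))
        nonneg-bit : ∀ {v} → v ≡ 0ℚ ⊎ v ≡ 1ℚ → 0ℚ ≤ℚ v
        nonneg-bit (inj₁ refl) = ℚ.≤-refl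
        nonneg-bit (inj₂ refl) = 0≤1ℚ
        negative : ¬ (0ℚ ≤ℚ -ℚ 1ℚ)
        negative le = ℚ.<-irrefl refl (ℚ.<-≤-trans 0<1ℚ (subst (1ℚ ≤ℚ_) refl (ℚ.neg-antimono-≤ le)))
        -- Rotation keeps the value -1 at `z`, but the resulting facet functional is a positive
        -- multiple of one that agrees with a sign functional, and those are 0 or 1 at `z`.
        violated : Rotated A φ z → ⊥
        violated (ψ , nonnegψ , facetψ , ψz , _) =
          let g , gbin , _ , c , 0<c , eq = normalise tl nonnegψ facetψ
              f , f∈ , agree = only-signs g gbin
          in negative (subst (0ℚ ≤ℚ_) (trans (sym (eq z)) (trans ψz φz)) (*-nonneg (ℚ.<⇒≤ 0<c)
               (subst (0ℚ ≤ℚ_) (sym (agree-inspan agree z∈)) (nonneg-bit (sign-at-z f∈)))))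
      by-search : Dec (Any (λ a → Vec.map (_∙ a) coords ≡ Vec.map ⟦_⟧ y) A) → Attained y
      by-search (yes found) = find found
      by-search (no missing) = ⊥-elim (cut-off missing (realise 1ℚ (Vec.map ⟦_⟧ y)))

module _ {M : ℕ} {h : Vec ℚ M} where

  -- With d = `suc D`, the first alternative is combined with β ≤ 2^(d+1), the second with at most
  -- 2^d points, and the third with d ≤ 2^(d-1).
  product-bound : ∀ {D A L} → Homogeneous h A → Unique A → TL A → Rank A (suc (suc D)) → Sys A L → length A * length L ≤ suc (suc D) * 2 ^ suc (suc D)
  product-bound {D} {A} {L} hom uniq tl rk sys = by-cases (size-bound (suc D) hom uniq tl rk sys)
    where
    by-cases : Bound (length A) (length L) (suc (suc D)) → length A * length L ≤ suc (suc D) * 2 ^ suc (suc D)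
    by-cases (inj₁ few) = ℕ.*-mono-≤ few (sys-bound rk sys)
    by-cases (inj₂ (inj₁ few)) = ℕ.≤-trans (ℕ.*-mono-≤ (proj₁ (points-bound-sys uniq tl hom sys rk)) few)
      (ℕ.≤-reflexive (swap (2 ^ suc D) (suc (suc D))))
      where
      swap : ∀ X D → X * (2 * D) ≡ D * (2 * X)
      swap = ℕSolver.solve-∀
    by-cases (inj₂ (inj₂ few)) = ℕ.≤-trans few (ℕ.≤-trans (ℕ.≤-reflexive (expand D (2 ^ D)))
      (ℕ.≤-trans (ℕ.+-monoʳ-≤ (4 * (suc D * 2 ^ D)) (ℕ.*-monoʳ-≤ 4 (n<2^n D))) (ℕ.≤-reflexive (collect D (2 ^ D)))))
      where
      expand : ∀ D X → suc D * (2 * (2 * X) + 4) ≡ 4 * (suc D * X) + 4 * suc D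
      expand = ℕSolver.solve-∀
      collect : ∀ D X → 4 * (suc D * X) + 4 * X ≡ suc (suc D) * (2 * (2 * X))
      collect = ℕSolver.solve-∀

-- Integrality and sums of bits

ι : ℕ → ℚ
ι zero = 0ℚ
ι (suc n) = 1ℚ +ℚ ι n

ι-nonneg : ∀ n → 0ℚ ≤ℚ ι n
ι-nonneg zero = ℚ.≤-refl
ι-nonneg (suc n) = +-nonneg 0≤1ℚ (ι-nonneg n)

ι-suc≢0 : ∀ n → ι (suc n) ≢ 0ℚ
ι-suc≢0 n = 0<⇒≢0 (ℚ.<-≤-trans 0<1ℚ (subst (_≤ℚ 1ℚ +ℚ ι n) (ℚ.+-identityʳ 1ℚ) (ℚ.+-monoʳ-≤ 1ℚ (ι-nonneg n))))

ι-injective : ∀ m n → ι m ≡ ι n → m ≡ n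
ι-injective zero zero _ = refl
ι-injective zero (suc n) e = ⊥-elim (ι-suc≢0 n (sym e))
ι-injective (suc m) zero e = ⊥-elim (ι-suc≢0 m e)
ι-injective (suc m) (suc n) e = cong suc (ι-injective m n (trans (lemma (ι m)) (trans (cong (-ℚ 1ℚ +ℚ_) e) (sym (lemma (ι n))))))
  where
  lemma : ∀ x → x ≡ -ℚ 1ℚ +ℚ (1ℚ +ℚ x)
  lemma = solve-∀ ℚ-ring

ι-+ : ∀ m n → ι (m + n) ≡ ι m +ℚ ι n
ι-+ zero n = sym (ℚ.+-identityˡ _)
ι-+ (suc m) n = trans (cong (1ℚ +ℚ_) (ι-+ m n)) (sym (ℚ.+-assoc 1ℚ (ι m) (ι n)))

ι-* : ∀ m n → ι (m * n) ≡ ι m *ℚ ι n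
ι-* zero n = sym (ℚ.*-zeroˡ (ι n))
ι-* (suc m) n = trans (ι-+ n (m * n)) (trans (cong (ι n +ℚ_) (ι-* m n)) (lemma (ι n) (ι m)))
  where
  lemma : ∀ x y → x +ℚ y *ℚ x ≡ (1ℚ +ℚ y) *ℚ x
  lemma = solve-∀ ℚ-ring

-- An integer is presented as a difference of two natural numbers, so that divisibility questions
-- move to ℕ through the injectivity of `ι`.
record Integral (x : ℚ) : Set where
  constructor integral
  field
    below above : ℕ
    equation : x +ℚ ι below ≡ ι above

integral-bit : ∀ {x} → x ≡ 0ℚ ⊎ x ≡ 1ℚ → Integral x
integral-bit (inj₁ refl) = integral 0 0 refl
integral-bit (inj₂ refl) = integral 0 1 refl

integral-+ : ∀ {x y} → Integral x → Integral y → Integral (x +ℚ y)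
integral-+ {x} {y} (integral a b p) (integral a' b' q) = integral (a + a') (b + b') (trans (cong (x +ℚ y +ℚ_) (ι-+ a a'))
  (trans (lemma x y (ι a) (ι a')) (trans (cong₂ _+ℚ_ p q) (sym (ι-+ b b')))))
  where
  lemma : ∀ x y a b → (x +ℚ y) +ℚ (a +ℚ b) ≡ (x +ℚ a) +ℚ (y +ℚ b)
  lemma = solve-∀ ℚ-ring

integral-neg : ∀ {x} → Integral x → Integral ((-ℚ 1ℚ) *ℚ x)
integral-neg {x} (integral a b p) = integral b a (trans (cong ((-ℚ 1ℚ) *ℚ x +ℚ_) (sym p)) (lemma x (ι a)))
  where
  lemma : ∀ x a → (-ℚ 1ℚ) *ℚ x +ℚ (x +ℚ a) ≡ a
  lemma = solve-∀ ℚ-ring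

-- The integer x = o / (d+1) lies in (0,1], hence is 1.
integral-unit : ∀ {x} d o → Integral x → x *ℚ ι (suc d) ≡ ι o → 1 ≤ o → o ≤ suc d → o ≡ suc d
integral-unit {x} d o (integral a b p) xd 1≤o o≤d = conclude (ℕ.≤-total b a)
  where
  lemma : ∀ x a d → (x +ℚ a) *ℚ d ≡ x *ℚ d +ℚ a *ℚ d
  lemma = solve-∀ ℚ-ring
  product : b * suc d ≡ o + a * suc d
  product = ι-injective _ _ (trans (ι-* b (suc d)) (trans (cong (_*ℚ ι (suc d)) (sym p)) (trans (lemma x (ι a) (ι (suc d)))
    (trans (cong₂ _+ℚ_ xd (sym (ι-* a (suc d)))) (sym (ι-+ o (a * suc d)))))))
  multiple : ∀ k → b ≡ a + k → k * suc d ≡ o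
  multiple k refl = ℕ.+-cancelˡ-≡ (a * suc d) (k * suc d) o (trans (sym (ℕ.*-distribʳ-+ (suc d) a k)) (trans product (ℕ.+-comm o (a * suc d))))
  conclude : b ≤ a ⊎ a ≤ b → o ≡ suc d
  conclude (inj₁ b≤a) = ⊥-elim (ℕ.<-irrefl refl (ℕ.<-≤-trans (ℕ.+-monoˡ-≤ (a * suc d) 1≤o)
    (ℕ.≤-trans (ℕ.≤-reflexive (sym product)) (ℕ.*-monoˡ-≤ (suc d) b≤a))))
  conclude (inj₂ a≤b) = from-factor (b ∸ a) (multiple (b ∸ a) (sym (ℕ.m+[n∸m]≡n a≤b)))
    where
    from-factor : ∀ k → k * suc d ≡ o → o ≡ suc d
    from-factor zero e = ⊥-elim (ℕ.<-irrefl e 1≤o)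
    from-factor (suc k) e = ℕ.≤-antisym o≤d (subst (suc d ≤_) e (ℕ.m≤m+n (suc d) (k * suc d)))

∙-unit : ∀ {k} (c : Vec ℚ k) j → c ∙ Vec.tabulate (λ i → if does (j Fin.≟ i) then 1ℚ else 0ℚ) ≡ lookup c j
∙-unit (c ∷ cs) zero = trans (∙-∷ c cs 1ℚ _) (trans (cong (c *ℚ 1ℚ +ℚ_) (trans (cong (cs ∙_) (zeros cs)) (∙-zeroʳ cs))) (lemma c))
  where
  zeros : ∀ {k} (cs : Vec ℚ k) → Vec.tabulate {n = k} (λ _ → 0ℚ) ≡ 0v
  zeros [] = refl
  zeros (_ ∷ cs) = cong (0ℚ ∷_) (zeros cs)
  lemma : ∀ c → c *ℚ 1ℚ +ℚ 0ℚ ≡ c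
  lemma = solve-∀ ℚ-ring
∙-unit (c ∷ cs) (suc j) = trans (∙-∷ c cs 0ℚ _) (trans (cong (c *ℚ 0ℚ +ℚ_) (∙-unit cs j)) (lemma c (lookup cs j)))
  where
  lemma : ∀ c x → c *ℚ 0ℚ +ℚ x ≡ x
  lemma = solve-∀ ℚ-ring

Bits : ∀ {k} → Vec ℚ k → Set
Bits = AllV (λ v → v ≡ 0ℚ ⊎ v ≡ 1ℚ)

integral-∙ : ∀ {k} {c x : Vec ℚ k} → Bits c → AllV Integral x → Integral (c ∙ x)
integral-∙ [] [] = subst Integral (sym (∙-zeroʳ [])) (integral-bit (inj₁ refl))
integral-∙ {c = c ∷ cs} {x ∷ xs} (b ∷ bs) (i ∷ is) = subst Integral (sym (∙-∷ c cs x xs)) (integral-+ {c *ℚ x} {cs ∙ xs} (term b) (integral-∙ bs is))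
  where
  term : c ≡ 0ℚ ⊎ c ≡ 1ℚ → Integral (c *ℚ x)
  term (inj₁ refl) = subst Integral (sym (ℚ.*-zeroˡ x)) (integral-bit (inj₁ refl))
  term (inj₂ refl) = subst Integral (sym (ℚ.*-identityˡ x)) i

private
  ones : ∀ k → Vec ℚ k
  ones k = Vec.replicate k 1ℚ

  ones-∷ : ∀ {k} c (cs : Vec ℚ k) → (c ∷ cs) ∙ ones (suc k) ≡ c +ℚ cs ∙ ones k
  ones-∷ c cs = trans (∙-∷ c cs 1ℚ _) (cong (_+ℚ cs ∙ ones _) (ℚ.*-identityʳ c))

  bits-sum-nonneg : ∀ {k} {c : Vec ℚ k} → Bits c → 0ℚ ≤ℚ c ∙ ones k
  bits-sum-nonneg [] = ℚ.≤-reflexive (sym (∙-zeroʳ []))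
  bits-sum-nonneg {c = c ∷ cs} (b ∷ bs) = subst (0ℚ ≤ℚ_) (sym (ones-∷ c cs)) (+-nonneg (nonneg b) (bits-sum-nonneg bs))
    where
    nonneg : ∀ {c} → c ≡ 0ℚ ⊎ c ≡ 1ℚ → 0ℚ ≤ℚ c
    nonneg (inj₁ refl) = ℚ.≤-refl
    nonneg (inj₂ refl) = 0≤1ℚ

  bits-sum-zero : ∀ {k} {c : Vec ℚ k} → Bits c → c ∙ ones k ≡ 0ℚ → c ≡ 0v
  bits-sum-zero [] _ = refl
  bits-sum-zero {c = c ∷ cs} (inj₁ refl ∷ bs) e = cong (0ℚ ∷_) (bits-sum-zero bs (trans (sym (ℚ.+-identityˡ _)) (trans (sym (ones-∷ 0ℚ cs)) e)))
  bits-sum-zero {c = c ∷ cs} (inj₂ refl ∷ bs) e = ⊥-elim (0<⇒≢0 (ℚ.<-≤-trans 0<1ℚ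
    (subst (_≤ℚ 1ℚ +ℚ cs ∙ ones _) (ℚ.+-identityʳ 1ℚ) (ℚ.+-monoʳ-≤ 1ℚ (bits-sum-nonneg bs)))) (trans (sym (ones-∷ 1ℚ cs)) e))

comb-zero : ∀ {M k} (T : Vec (Vec ℚ M) k) → comb 0v T ≡ 0v
comb-zero [] = refl
comb-zero (t ∷ T) = ext∙ λ f → trans (∙-linʳ f (comb 0v T) 0ℚ t) (trans (cong (λ u → f ∙ u +ℚ 0ℚ *ℚ f ∙ t) (comb-zero T)) (lemma (f ∙ 0v) (f ∙ t)))
  where
  lemma : ∀ x y → x +ℚ 0ℚ *ℚ y ≡ x
  lemma = solve-∀ ℚ-ring

-- Bits with sum 1 contain exactly one 1, and the combination picks out the vector at its index.
bits-select : ∀ {M k} {c : Vec ℚ k} → Bits c → c ∙ ones k ≡ 1ℚ → Σ (Fin k) λ i → ∀ (T : Vec (Vec ℚ M) k) → comb c T ≡ lookup T i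
bits-select [] e = ⊥-elim (1≢0ℚ (trans (sym e) (∙-zeroʳ [])))
bits-select {c = _ ∷ cs} (inj₁ refl ∷ bs) e =
  let i , eq = bits-select bs (trans (sym (ℚ.+-identityˡ _)) (trans (sym (ones-∷ 0ℚ cs)) e))
  in suc i , λ { (t ∷ T) → trans (ext∙ λ f → trans (∙-linʳ f (comb cs T) 0ℚ t) (lemma (f ∙ comb cs T) (f ∙ t))) (eq T) }
  where
  lemma : ∀ x y → x +ℚ 0ℚ *ℚ y ≡ x
  lemma = solve-∀ ℚ-ring
bits-select {M} {c = _ ∷ cs} (inj₂ refl ∷ bs) e = zero , λ { (t ∷ T) → ext∙ λ f → trans (∙-linʳ f (comb cs T) 1ℚ t)
    (trans (cong (λ u → f ∙ u +ℚ 1ℚ *ℚ f ∙ t) (trans (cong (λ c → comb c T) rest) (comb-zero T)))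
      (trans (cong (_+ℚ 1ℚ *ℚ f ∙ t) (∙-zeroʳ f)) (lemma (f ∙ t)))) }
  where
  lemma : ∀ x → 0ℚ +ℚ 1ℚ *ℚ x ≡ x
  lemma = solve-∀ ℚ-ring
  cancel : ∀ x → x ≡ (1ℚ +ℚ x) +ℚ -ℚ 1ℚ
  cancel = solve-∀ ℚ-ring
  rest : cs ≡ 0v
  rest = bits-sum-zero bs (trans (cancel (cs ∙ ones _)) (cong (_+ℚ -ℚ 1ℚ) (trans (sym (ones-∷ 1ℚ cs)) e)))

-- Central symmetry and cross-polytopes

module _ {M : ℕ} where

  total : List (Vec ℚ M) → Vec ℚ M
  total [] = 0v
  total (a ∷ A) = a ⊕ total A

  total-value : ∀ {A} {f : Vec ℚ M} → Bin A f → f ∙ total A ≡ ι (length (NonZeros A f))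
  total-value {[]} {f} _ = ∙-zeroʳ f
  total-value {a ∷ A} {f} bin with zero? f a | total-value {A} {f} (λ x → bin x ∘ there)
  ... | yes fa | rec = trans (∙-addʳ f a (total A)) (trans (cong₂ _+ℚ_ fa rec) (ℚ.+-identityˡ _))
  ... | no fa≢0 | rec = trans (∙-addʳ f a (total A)) (cong₂ _+ℚ_ (bin-nonzero {A = a ∷ A} bin (here refl) fa≢0) rec)

  total-inspan : ∀ {A : List (Vec ℚ M)} → InSpan A (total A)
  total-inspan {[]} ψ _ = ∙-zeroʳ ψ
  total-inspan {a ∷ A} ψ kills = trans (∙-addʳ ψ a (total A)) (cong₂ _+ℚ_ (kills a (here refl)) (total-inspan {A} ψ λ x → kills x ∘ there))

  full-sub : ∀ {xs ys : List (Vec ℚ M)} → Unique xs → (∀ x → x ∈ xs → x ∈ ys) → length ys ≤ length xs → ∀ y → y ∈ ys → y ∈ xs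
  full-sub {xs} {ys} uniq sub len y y∈ = by-search (any? (y ≟v_) xs)
    where
    by-search : Dec (y ∈ xs) → y ∈ xs
    by-search (yes found) = found
    by-search (no new) = ⊥-elim (ℕ.<-irrefl refl (ℕ.≤-trans (unique-⊆ {xs = y ∷ xs} (All.tabulate (λ { x∈ refl → new x∈ }) ∷ uniq)
      λ { _ (here refl) → y∈ ; x (there x∈) → sub x x∈ }) len))

  index-of : ∀ {k x} (T : Vec (Vec ℚ M) k) → x ∈ Vec.toList T → Σ (Fin k) λ i → x ≡ lookup T i
  index-of (t ∷ T) (here e) = zero , e
  index-of (t ∷ T) (there x∈) = let i , e = index-of T x∈ in suc i , e

  basis-covers : ∀ {G d} (rk : Rank G d) → length G ≤ d → ∀ a → a ∈ G → Σ (Fin d) λ i → a ≡ lookup (Rank.basis rk) i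
  basis-covers (rank T T⊆ ind _) few a a∈ = index-of T (full-sub (ind-distinct ind) (λ x → ∈-toList T⊆)
    (subst (_ ≤_) (sym (length-toList T)) few) a a∈)

  rank-cong : ∀ {G G' : List (Vec ℚ M)} {D} → (∀ a → a ∈ G → a ∈ G') → (∀ a → a ∈ G' → a ∈ G) → Rank G D → Rank G' D
  rank-cong to from (rank T T⊆ ind spans) = rank T (AllV.map (λ {a} → to a) T⊆) ind λ a a∈ → spans a (from a a∈)

  -- The centre is stored doubled, at height 2, so that the antipode of an axis is a plain
  -- difference without halves.
  record Cross (h : Vec ℚ M) (A : List (Vec ℚ M)) (d : ℕ) : Set where
    field
      axes : Vec (Vec ℚ M) d
      double-centre : Vec ℚ M
      double-centre-h : h ∙ double-centre ≡ 1ℚ +ℚ 1ℚ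
      axes-ind : Ind (double-centre ∷ axes)
      axes∈ : ∀ i → lookup axes i ∈ A
      opposite∈ : ∀ i → double-centre ⊕ (-ℚ 1ℚ) • lookup axes i ∈ A
      covers : ∀ a → a ∈ A → Σ (Fin d) λ i → a ≡ lookup axes i ⊎ a ≡ double-centre ⊕ (-ℚ 1ℚ) • lookup axes i

-- m plays the role of twice the centre: every facet functional takes the value 1 there.
module Centred {M : ℕ} {h : Vec ℚ M} {A : List (Vec ℚ M)} {d : ℕ} {m : Vec ℚ M}
  (hom : Homogeneous h A) (tl : TL A) (rk : Rank A (suc d))
  (m-inspan : InSpan A m) (h-m : h ∙ m ≡ 1ℚ +ℚ 1ℚ) (centred : ∀ g → Bin A g → Facet A g → g ∙ m ≡ 1ℚ) where

  opposite : Vec ℚ M → Vec ℚ M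
  opposite a = m ⊕ (-ℚ 1ℚ) • a

  opposite-value : ∀ {g a u v} → g ∙ m ≡ u → g ∙ a ≡ v → g ∙ opposite a ≡ u +ℚ -ℚ v
  opposite-value {g} {a} refl refl = trans (∙-linʳ g m (-ℚ 1ℚ) a) (lemma (g ∙ m) (g ∙ a))
    where
    lemma : ∀ x y → x +ℚ (-ℚ 1ℚ) *ℚ y ≡ x +ℚ -ℚ y
    lemma = solve-∀ ℚ-ring

  opposite-inspan : ∀ {a} → a ∈ A → InSpan A (opposite a)
  opposite-inspan {a} a∈ ψ kills = opposite-value (m-inspan ψ kills) (kills a a∈)

  -- γ + t g₀ is non-negative on A for large t; it is rotated about z.
  opposite-facet : ∀ {g₀ γ z} → Bin A g₀ → z ∈ A → g₀ ∙ z ≡ 0ℚ → γ ∙ z ≡ 1ℚ → (∀ a → a ∈ A → g₀ ∙ a ≡ 0ℚ → 0ℚ ≤ℚ γ ∙ a) →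
    Σ (Vec ℚ M) λ g → Bin A g × Facet A g × g ∙ z ≡ 1ℚ × (∀ a → a ∈ A → g₀ ∙ a ≡ 0ℚ → γ ∙ a ≡ 0ℚ → g ∙ a ≡ 0ℚ)
  opposite-facet {g₀} {γ} {z} g₀-bin z∈ g₀z γz pos = start (add-multiple A g₀ γ g₀-bin pos)
    where
    start : Σ ℚ (λ t → Nonneg A (γ ⊕ t • g₀)) →
      Σ (Vec ℚ M) λ g → Bin A g × Facet A g × g ∙ z ≡ 1ℚ × (∀ a → a ∈ A → g₀ ∙ a ≡ 0ℚ → γ ∙ a ≡ 0ℚ → g ∙ a ≡ 0ℚ)
    start (t , nonneg) = finish (rotate A z (∈⇒inspan z∈) φ nonneg λ e → 1≢0ℚ (trans (sym (value g₀z γz)) e))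
      where
      φ : Vec ℚ M
      φ = γ ⊕ t • g₀
      value : ∀ {a v} → g₀ ∙ a ≡ 0ℚ → γ ∙ a ≡ v → φ ∙ a ≡ v
      value {a} e refl = trans (∙-linˡ γ t g₀ a) (trans (cong (λ u → γ ∙ a +ℚ t *ℚ u) e) (trans (cong (γ ∙ a +ℚ_) (ℚ.*-zeroʳ t)) (ℚ.+-identityʳ _)))
      finish : Rotated A φ z →
        Σ (Vec ℚ M) λ g → Bin A g × Facet A g × g ∙ z ≡ 1ℚ × (∀ a → a ∈ A → g₀ ∙ a ≡ 0ℚ → γ ∙ a ≡ 0ℚ → g ∙ a ≡ 0ℚ)
      finish (ψ , nonnegψ , facetψ , ψz , sub) = conclude (normalise tl nonnegψ facetψ)
        where
        conclude : Normalised A ψ →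
          Σ (Vec ℚ M) λ g → Bin A g × Facet A g × g ∙ z ≡ 1ℚ × (∀ a → a ∈ A → g₀ ∙ a ≡ 0ℚ → γ ∙ a ≡ 0ℚ → g ∙ a ≡ 0ℚ)
        conclude (g , gbin , gfacet , c , 0<c , eq) = g , gbin , gfacet ,
          bin-nonzero gbin z∈ (λ gz → 1≢0ℚ (trans (sym (trans ψz (value g₀z γz))) (trans (eq z) (trans (cong (c *ℚ_) gz) (ℚ.*-zeroʳ c))))) ,
          λ a a∈ g₀a γa → *-cancel-zero {g ∙ a} {c} (trans (ℚ.*-comm (g ∙ a) c) (trans (sym (eq a)) (sub a a∈ (value g₀a γa)))) (0<⇒≢0 0<c)

  -- The antipode lies in the hyperplane `g₀ = 0`, as `g₀` is 1 - 1 there. Each of its barycentric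
  -- coordinates in the simplex `Zeros A g₀` is the value of a facet functional `g` at it, which is
  -- 1 - `g ∙ a`, a bit. Bits with sum 1 single out a vertex.
  opposite∈ : ∀ {g₀ a} → Bin A g₀ → Facet A g₀ → length (Zeros A g₀) ≤ d → a ∈ A → g₀ ∙ a ≡ 1ℚ → opposite a ∈ Zeros A g₀
  opposite∈ {g₀} {a} g₀-bin g₀-facet few a∈ g₀a = place in-span
    where
    rk₀ : Rank (Zeros A g₀) d
    rk₀ = facet-rank rk g₀-facet
    open Rank rk₀ renaming (basis to T; basis⊆ to T⊆; basis-ind to T-ind; basis-spans to T-spans)
    a* : Vec ℚ M
    a* = opposite a
    in-zeros : ∀ k → lookup T k ∈ A × g₀ ∙ lookup T k ≡ 0ℚ
    in-zeros k = ∈-zeros⁻ {A = A} {g₀} (AllV.lookup⁺ T⊆ k)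
    in-span : Span T a*
    in-span = by-alternative (fredholm T a*)
      where
      by-alternative : Span T a* ⊎ Σ (Vec ℚ M) (λ χ → Kills χ T × χ ∙ a* ≡ 1ℚ) → Span T a*
      by-alternative (inj₁ s) = s
      by-alternative (inj₂ (χ , χT , χa)) = ⊥-elim (1≢0ℚ (trans (sym χa) (trans (agree-inspan {g = κ • g₀} agree (opposite-inspan a∈))
          (trans (∙-scaleˡ κ g₀ a*) (trans (cong (κ *ℚ_) (opposite-value (centred g₀ g₀-bin g₀-facet) g₀a)) (ℚ.*-zeroʳ κ))))))
        where
        multiple = facet-determined g₀-facet χ λ x x∈ → kills-span χT (T-spans x x∈)
        κ = proj₁ multiple
        agree : Agree A χ (κ • g₀)
        agree x x∈ = trans (proj₂ multiple x x∈) (sym (∙-scaleˡ κ g₀ x))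
    unit : Fin d → Vec ℚ d
    unit k = Vec.tabulate λ i → if does (k Fin.≟ i) then 1ℚ else 0ℚ
    place : Span T a* → a* ∈ Zeros A g₀
    place (c , eq) = select (bits-select (AllV.lookup⁻ coefficient) sum≡1)
      where
      select : Σ (Fin d) (λ i → ∀ (T : Vec (Vec ℚ M) d) → comb c T ≡ lookup T i) → a* ∈ Zeros A g₀
      select (i , e) = subst (_∈ Zeros A g₀) (trans (sym (e T)) eq) (AllV.lookup⁺ T⊆ i)
      values-h : ∀ {k} {T : Vec (Vec ℚ M) k} → AllV (_∈ Zeros A g₀) T → values h T ≡ Vec.replicate k 1ℚ
      values-h [] = refl
      values-h (t∈ ∷ ts) = cong₂ _∷_ (hom _ (proj₁ (∈-zeros⁻ {A = A} {g₀} t∈))) (values-h ts)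
      sum≡1 : c ∙ Vec.replicate d 1ℚ ≡ 1ℚ
      sum≡1 = trans (cong (c ∙_) (sym (values-h T⊆))) (trans (sym (∙-combʳ h c T)) (trans (cong (h ∙_) eq) (opposite-value h-m (hom a a∈))))
      coefficient : ∀ k → lookup c k ≡ 0ℚ ⊎ lookup c k ≡ 1ℚ
      coefficient k = from-dual (interpolate T-ind (unit k))
        where
        from-dual : Σ (Vec ℚ M) (λ γ → values γ T ≡ unit k) → lookup c k ≡ 0ℚ ⊎ lookup c k ≡ 1ℚ
        -- `γ` is nonnegative on the zero set of `g₀` because this set is just `T`. The facet
        -- functional obtained from it has the same values on `T` and therefore reads off the same
        -- coordinate.
        from-dual (γ , γT) = from-facet (opposite-facet {γ = γ} g₀-bin (proj₁ (in-zeros k)) (proj₂ (in-zeros k))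
              (trans (γ-at k) (cong (λ b → if b then 1ℚ else 0ℚ) (dec-true (k Fin.≟ k) refl))) nonneg)
          where
          γ-at : ∀ i → γ ∙ lookup T i ≡ (if does (k Fin.≟ i) then 1ℚ else 0ℚ)
          γ-at i = trans (sym (Vec.lookup-map i (γ ∙_) T)) (trans (cong (λ v → lookup v i) γT) (Vec.lookup∘tabulate _ i))
          bit-nonneg : ∀ b → 0ℚ ≤ℚ (if b then 1ℚ else 0ℚ)
          bit-nonneg true = 0≤1ℚ
          bit-nonneg false = ℚ.≤-refl
          nonneg : ∀ x → x ∈ A → g₀ ∙ x ≡ 0ℚ → 0ℚ ≤ℚ γ ∙ x
          nonneg x x∈ g₀x = let i , e = basis-covers rk₀ few x (∈-zeros⁺ x∈ g₀x) in
            subst (0ℚ ≤ℚ_) (sym (trans (cong (γ ∙_) e) (γ-at i))) (bit-nonneg (does (k Fin.≟ i)))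
          from-facet : Σ (Vec ℚ M) (λ g → Bin A g × Facet A g × g ∙ lookup T k ≡ 1ℚ × (∀ a → a ∈ A → g₀ ∙ a ≡ 0ℚ → γ ∙ a ≡ 0ℚ → g ∙ a ≡ 0ℚ)) →
            lookup c k ≡ 0ℚ ⊎ lookup c k ≡ 1ℚ
          from-facet (g , gbin , gfacet , gk , goff) = bit (gbin a a∈)
            where
            g-at : ∀ i → g ∙ lookup T i ≡ (if does (k Fin.≟ i) then 1ℚ else 0ℚ)
            g-at i = by-index (k Fin.≟ i) (γ-at i)
              where
              by-index : (e : Dec (k ≡ i)) → γ ∙ lookup T i ≡ (if does e then 1ℚ else 0ℚ) → g ∙ lookup T i ≡ (if does e then 1ℚ else 0ℚ)
              by-index (yes refl) _ = gk
              by-index (no _) γ0 = goff (lookup T i) (proj₁ (in-zeros i)) (proj₂ (in-zeros i)) γ0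
            values-g : values g T ≡ unit k
            values-g = trans (sym (Vec.tabulate∘lookup (values g T))) (Vec.tabulate-cong λ i → trans (Vec.lookup-map i (g ∙_) T) (g-at i))
            at-a* : lookup c k ≡ g ∙ a*
            at-a* = trans (sym (∙-unit c k)) (trans (cong (c ∙_) (sym values-g)) (trans (sym (∙-combʳ g c T)) (cong (g ∙_) eq)))
            bit : g ∙ a ≡ 0ℚ ⊎ g ∙ a ≡ 1ℚ → lookup c k ≡ 0ℚ ⊎ lookup c k ≡ 1ℚ
            bit (inj₁ ga) = inj₂ (trans at-a* (opposite-value (centred g gbin gfacet) ga))
            bit (inj₂ ga) = inj₁ (trans at-a* (opposite-value (centred g gbin gfacet) ga))

-- Two parallel facets

module Parallel {M : ℕ} {h : Vec ℚ M} {A fl : List (Vec ℚ M)} {e : ℕ} {f : Vec ℚ M}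
  (hom : Homogeneous h A) (uniq : Unique A) (tl : TL A) (rk : Rank A (suc (suc (suc e)))) (facets : Facets A fl)
  (fbin : Bin A f) (facet : Facet A f) (facet' : Facet A (opp h f)) (q≤p : length (NonZeros A f) ≤ length (Zeros A f)) where

  d : ℕ
  d = suc (suc e)

  sysA : Σ (List (Vec ℚ M)) (Sys A)
  sysA = sys-exists A

  open Split hom uniq tl rk (proj₂ sysA) fbin facet hiding (module Maximal)

  head : ∀ {G : List (Vec ℚ M)} {k} → Rank G (suc k) → Σ (Vec ℚ M) (_∈ G)
  head (rank (t ∷ _) (t∈ ∷ _) _ _) = t , t∈

  x₀ : Vec ℚ M
  x₀ = proj₁ (head rank₀)

  x₀∈ : x₀ ∈ A₀
  x₀∈ = proj₂ (head rank₀)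

  A₁⇒opp : ∀ a → a ∈ A₁ → a ∈ Zeros A (opp h f)
  A₁⇒opp a a∈ = ∈-zeros⁺ (A₁⊆ a a∈) (opp-A₁ a a∈)

  opp⇒A₁ : ∀ a → a ∈ Zeros A (opp h f) → a ∈ A₁
  opp⇒A₁ a a∈ = ∈-nonzeros⁺ a∈A λ fa → 1≢0ℚ (trans (sym (opp-value (hom a a∈A) fa)) oa)
    where
    a∈A = proj₁ (∈-zeros⁻ {A = A} {opp h f} a∈)
    oa = proj₂ (∈-zeros⁻ {A = A} {opp h f} a∈)

  rank₁-full : Rank A₁ d
  rank₁-full = rank-cong opp⇒A₁ A₁⇒opp (facet-rank rk facet')

  zero-on⇒opp : ∀ {g} → Bin A g → Facet A g → ZeroOn g → Agree A g (opp h f)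
  zero-on⇒opp {g} gbin ((a , a∈ , ga≢0) , _) zeroOn x x∈ = trans (eq x x∈) (trans (cong (_*ℚ opp h f ∙ x) κ≡1) (ℚ.*-identityˡ _))
    where
    multiple = facet-determined facet' g λ x x∈ → zeroOn x (opp⇒A₁ x x∈)
    κ = proj₁ multiple
    eq = proj₂ multiple
    κ≢0 : κ ≢ 0ℚ
    κ≢0 κ≡0 = ga≢0 (trans (eq a a∈) (trans (cong (_*ℚ opp h f ∙ a) κ≡0) (ℚ.*-zeroˡ (opp h f ∙ a))))
    at-x₀ : g ∙ x₀ ≡ κ
    at-x₀ = trans (eq x₀ (A₀⊆ x₀ x₀∈)) (trans (cong (κ *ℚ_) (opp-A₀ x₀ x₀∈)) (ℚ.*-identityʳ κ))
    κ≡1 : κ ≡ 1ℚ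
    κ≡1 = trans (sym at-x₀) (bin-nonzero gbin (A₀⊆ x₀ x₀∈) λ e → κ≢0 (trans (sym at-x₀) e))

  has-zero : ∀ {g} → Facet A g → Σ (Vec ℚ M) λ a → a ∈ A × g ∙ a ≡ 0ℚ
  has-zero {g} gfacet = let a , a∈ = head (facet-rank rk gfacet) in a , ∈-zeros⁻ {A = A} {g} a∈

  -- Otherwise one of them is 1 and the other 0 on `A₁`. The latter agrees with the complement of
  -- `f` and is 1 on `A₀`; then the former is 1 on all of `A`, yet a facet functional has a zero.
  facets-restrict : ∀ {g g'} → Bin A g → Facet A g → Bin A g' → Facet A g' → Agree A₀ g g' → Agree A g g'
  facets-restrict {g} {g'} gbin gfacet gbin' gfacet' agree = by-alternative (extend-agreement gbin gbin' agree)
    where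
    impossible : ∀ {g g'} → Facet A g → Bin A g' → Facet A g' → Agree A₀ g g' → OneOn g → ZeroOn g' → ⊥
    impossible {g} {g'} gfacet gbin' gfacet' agree oneOn zeroOn = 1≢0ℚ (trans (sym (side {λ a → g ∙ a ≡ 1ℚ}
      (λ a a∈ → trans (agree a a∈) (trans (zero-on⇒opp gbin' gfacet' zeroOn a (A₀⊆ a a∈)) (opp-A₀ a a∈))) oneOn
      (proj₁ (has-zero gfacet)) (proj₁ (proj₂ (has-zero gfacet))))) (proj₂ (proj₂ (has-zero gfacet))))
    by-alternative : Agree A g g' ⊎ (OneOn g × ZeroOn g') ⊎ (ZeroOn g × OneOn g') → Agree A g g'
    by-alternative (inj₁ agree') = agree'
    by-alternative (inj₂ (inj₁ (oneOn , zeroOn))) = ⊥-elim (impossible gfacet gbin' gfacet' agree oneOn zeroOn)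
    by-alternative (inj₂ (inj₂ (zeroOn , oneOn))) = ⊥-elim (impossible gfacet' gbin gfacet (λ a a∈ → sym (agree a a∈)) oneOn zeroOn)

  K : ℕ
  K = length fl

  module F = Facets facets

  facets-injective : ∀ {g g'} → g ∈ fl → g' ∈ fl → ¬ Agree A g g' → ¬ Agree A₀ g g'
  facets-injective {g} {g'} g∈ g'∈ ¬agree agree = ¬agree (facets-restrict (F.bin g g∈) (F.facet g g∈) (F.bin g' g'∈) (F.facet g' g'∈) agree)

  K≤U : K ≤ U
  K≤U = pigeonhole {R = Agree A₀} F.distinct (λ g g∈ → Sys.complete (proj₂ sys₀) g λ a a∈ → F.bin g g∈ a (A₀⊆ a a∈))
    λ g∈ g'∈ ¬agree p q → facets-injective g∈ g'∈ ¬agree λ a a∈ → trans (p a a∈) (sym (q a a∈))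

  S≡1 : S ≡ 1
  S≡1 = ℕ.+-cancelʳ-≡ d S 1 (trans (cong (S +_) (sym (rank-unique rank₁ rank₁-full))) S+R)

  -- As `A₁` is a facet, `S` is 1 and `v ≤ 2`, so `A` has at most 2 + 2d two-valued functionals.
  few-functionals-cube : U ≤ 2 * d → Cube h A d
  few-functionals-cube few = cube hom uniq tl rk (proj₂ sysA) (ℕ.≤-trans L≤ (ℕ.≤-trans
    (ℕ.+-mono-≤ (subst (λ S → v ≤ 2 ^ S) S≡1 v≤) (ℕ.≤-trans v+c≤U few)) (ℕ.≤-reflexive (lemma d))))
    where
    lemma : ∀ d → 2 + 2 * d ≡ 2 * suc d
    lemma = ℕSolver.solve-∀

  Goal : Set
  Goal = length A * K ≤ suc e * (2 ^ suc d + 8)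

  n≤2p : length A ≤ 2 * p
  n≤2p = ℕ.≤-trans (ℕ.≤-reflexive p+q) (ℕ.≤-trans (ℕ.+-monoʳ-≤ p q≤p) (ℕ.≤-reflexive (cong (p +_) (sym (ℕ.+-identityʳ p)))))

  small-product : p * U ≤ suc e * (2 ^ d + 4) → Goal
  small-product small = ℕ.≤-trans (ℕ.*-mono-≤ n≤2p K≤U) (ℕ.≤-trans (ℕ.≤-reflexive (ℕ.*-assoc 2 p U))
    (ℕ.≤-trans (ℕ.*-monoʳ-≤ 2 small) (ℕ.≤-reflexive (lemma e (2 ^ d)))))
    where
    lemma : ∀ e X → 2 * (suc e * (X + 4)) ≡ suc e * (2 * X + 8)
    lemma = ℕSolver.solve-∀

  few-facets : p ≤ d → 4 * K ≤ 3 * 2 ^ d → Goal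
  few-facets p≤d few = ℕ.*-cancelˡ-≤ 4 (ℕ.≤-trans (ℕ.≤-reflexive (regroup (length A) K))
    (ℕ.≤-trans (ℕ.*-mono-≤ (ℕ.≤-trans n≤2p (ℕ.*-monoʳ-≤ 2 p≤d)) few) (numeric e)))
    where
    regroup : ∀ n k → 4 * (n * k) ≡ n * (4 * k)
    regroup = ℕSolver.solve-∀
    -- The leading coefficients compare as 3d/2 ≤ 2(d-1), which requires d ≥ 4; for d = 2 and d = 3
    -- the additive term decides.
    numeric : ∀ e → 2 * suc (suc e) * (3 * 2 ^ suc (suc e)) ≤ 4 * (suc e * (2 * 2 ^ suc (suc e) + 8))
    numeric 0 = ℕ.m≤m+n 48 16
    numeric 1 = ℕ.m≤m+n 144 48
    numeric (suc (suc e)) = subst (2 * (4 + e) * (3 * X) ≤_) (lemma e X) (ℕ.m≤m+n _ _)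
      where
      X = 2 ^ (4 + e)
      lemma : ∀ e X → 2 * (4 + e) * (3 * X) + (2 * e * X + 32 * (3 + e)) ≡ 4 * ((3 + e) * (2 * X + 8))
      lemma = ℕSolver.solve-∀

  module Simplices (p≤d : p ≤ d) (dense : ¬ (4 * K ≤ 3 * 2 ^ d)) where

    p≡d : p ≡ d
    p≡d = ℕ.≤-antisym p≤d (rank-≤ rank₀)

    q≡d : q ≡ d
    q≡d = ℕ.≤-antisym (ℕ.≤-trans q≤p p≤d) (rank-≤ rank₁-full)

    n≡ : length A ≡ d + d
    n≡ = trans p+q (cong₂ _+_ p≡d q≡d)

    zeros≥ : ∀ {g} → Facet A g → d ≤ length (Zeros A g)
    zeros≥ gfacet = rank-≤ (facet-rank rk gfacet)

    nonzeros≤ : ∀ {g} → Facet A g → length (NonZeros A g) ≤ d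
    nonzeros≤ {g} gfacet = ℕ.+-cancelˡ-≤ d _ d (ℕ.≤-trans (ℕ.+-monoˡ-≤ _ (zeros≥ gfacet))
      (ℕ.≤-reflexive (trans (sym (filter-split (zero? g) A)) n≡)))

    open Rank rank₀ renaming (basis to T; basis⊆ to T⊆; basis-ind to T-ind; basis-spans to T-spans)

    T∈ : ∀ i → lookup T i ∈ A₀
    T∈ = AllV.lookup⁺ T⊆

    T∈A : ∀ i → lookup T i ∈ A
    T∈A i = A₀⊆ _ (T∈ i)

    -- A facet avoiding A₁ contains A₀, by counting.
    one-on⇒zero : ∀ {g} → Facet A g → OneOn g → ∀ a → a ∈ A₀ → g ∙ a ≡ 0ℚ
    one-on⇒zero {g} gfacet oneOn a a∈ = proj₂ (∈-zeros⁻ {A = A} {g} (full-sub (AllPairs.filter⁺ (zero? g) uniq) inside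
      (ℕ.≤-trans p≤d (zeros≥ gfacet)) a a∈))
      where
      inside : ∀ x → x ∈ Zeros A g → x ∈ A₀
      inside x x∈ = let x∈A , gx = ∈-zeros⁻ {A = A} {g} x∈ in
        side {λ x → g ∙ x ≡ 0ℚ → x ∈ A₀} (λ a a∈ _ → a∈) (λ a a∈ ga → ⊥-elim (1≢0ℚ (trans (sym (oneOn a a∈)) ga))) x x∈A gx

    -- In the exceptional alternatives `g` and `g'` are both 1 or both 0 on `A₁`, hence both 0 or
    -- both 1 on `A₀`, which contradicts `g' = h - g` there.
    complementary : ∀ {g g'} → Bin A g → Facet A g → Bin A g' → Facet A g' → Agree A₀ g' (opp h g) → Agree A g' (opp h g)
    complementary {g} {g'} gbin gfacet gbin' gfacet' agree = by-alternative (extend-agreement gbin' (opp-bin hom gbin) agree)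
      where
      opp-one : ∀ {a v} → h ∙ a ≡ 1ℚ → opp h g ∙ a ≡ v → g ∙ a ≡ 1ℚ +ℚ -ℚ v
      opp-one {a} ha refl = trans (lemma (g ∙ a)) (cong (λ u → 1ℚ +ℚ -ℚ u) (sym (opp-value ha refl)))
        where
        lemma : ∀ x → x ≡ 1ℚ +ℚ -ℚ (1ℚ +ℚ -ℚ x)
        lemma = solve-∀ ℚ-ring
      by-alternative : Agree A g' (opp h g) ⊎ (OneOn g' × ZeroOn (opp h g)) ⊎ (ZeroOn g' × OneOn (opp h g)) → Agree A g' (opp h g)
      by-alternative (inj₁ agree') = agree'
      by-alternative (inj₂ (inj₁ (oneOn , oppZero))) = ⊥-elim (1≢0ℚ (trans
        (sym (opp-value (hom₀ x₀ x₀∈) (one-on⇒zero gfacet (λ a a∈ → opp-one (hom₁ a a∈) (oppZero a a∈)) x₀ x₀∈)))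
        (trans (sym (agree x₀ x₀∈)) (one-on⇒zero gfacet' oneOn x₀ x₀∈))))
      by-alternative (inj₂ (inj₂ (zeroOn , oppOne))) = ⊥-elim (1≢0ℚ (trans
        (sym (trans (zero-on⇒opp gbin' gfacet' zeroOn x₀ (A₀⊆ x₀ x₀∈)) (opp-A₀ x₀ x₀∈)))
        (trans (agree x₀ x₀∈) (opp-value (hom₀ x₀ x₀∈)
          (trans (zero-on⇒opp gbin gfacet (λ a a∈ → opp-one (hom₁ a a∈) (oppOne a a∈)) x₀ (A₀⊆ x₀ x₀∈)) (opp-A₀ x₀ x₀∈))))))

    -- m is twice the centroid of the vertices.
    scale : Σ ℚ λ r → r *ℚ ι d ≡ 1ℚ
    scale = inverse (ι d) (ι-suc≢0 (suc e))

    m : Vec ℚ M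
    m = proj₁ scale • total A

    m-value : ∀ g → g ∙ m ≡ proj₁ scale *ℚ g ∙ total A
    m-value g = ∙-scaleʳ g (proj₁ scale) (total A)

    m-inspan : InSpan A m
    m-inspan ψ kills = trans (m-value ψ) (trans (cong (proj₁ scale *ℚ_) (total-inspan {A = A} ψ kills)) (ℚ.*-zeroʳ (proj₁ scale)))

    half⇒centred : ∀ {g} → Bin A g → length (NonZeros A g) ≡ d → g ∙ m ≡ 1ℚ
    half⇒centred {g} gbin half = trans (m-value g) (trans (cong (proj₁ scale *ℚ_) (trans (total-value gbin) (cong ι half))) (proj₂ scale))

    h-m : h ∙ m ≡ 1ℚ +ℚ 1ℚ
    h-m = trans (m-value h) (trans (cong (proj₁ scale *ℚ_) (trans (total-value (λ a a∈ → inj₂ (hom a a∈))) (trans (cong ι all) (ι-+ d d))))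
        (trans (ℚ.*-distribˡ-+ (proj₁ scale) (ι d) (ι d)) (cong₂ _+ℚ_ (proj₂ scale) (proj₂ scale))))
      where
      nonzero-all : ∀ B → Homogeneous h B → length (NonZeros B h) ≡ length B
      nonzero-all B homB = cong length (List.filter-all (¬? ∘ zero? h) (All.tabulate λ {a} a∈ e → 1≢0ℚ (trans (sym (homB a a∈)) e)))
      all : length (NonZeros A h) ≡ d + d
      all = trans (nonzero-all A hom) n≡

    -- The zeros of `g'`, at least `d` in number, are nonzeros of `g`, and a facet functional has at
    -- most `d` nonzeros. So `g` is 1 at exactly half of the `2d` vertices.
    paired-centred : ∀ {g g'} → Bin A g → Facet A g → Bin A g' → Facet A g' → Agree A₀ g' (opp h g) → g ∙ m ≡ 1ℚ
    paired-centred {g} {g'} gbin gfacet gbin' gfacet' agree = half⇒centred gbin (ℕ.≤-antisym (nonzeros≤ gfacet)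
      (ℕ.≤-trans (zeros≥ gfacet') (unique-⊆ (AllPairs.filter⁺ (zero? g') uniq) λ x x∈ →
        let x∈A , g'x = ∈-zeros⁻ {A = A} {g'} x∈ in ∈-nonzeros⁺ x∈A λ gx →
          1≢0ℚ (trans (sym (opp-value (hom x x∈A) gx)) (trans (sym (complementary gbin gfacet gbin' gfacet' agree x x∈A)) g'x)))))

    pattern-of : Vec ℚ M → Vec Bool d
    pattern-of g = Vec.map (λ t → does (g ∙ t ℚ.≟ 1ℚ)) T

    pattern-at : ∀ {g} → Bin A g → ∀ i → g ∙ lookup T i ≡ ⟦ lookup (pattern-of g) i ⟧
    pattern-at {g} gbin i = trans (sym (bit-value (gbin (lookup T i) (T∈A i)))) (cong ⟦_⟧ (sym (Vec.lookup-map i (λ t → does (g ∙ t ℚ.≟ 1ℚ)) T)))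

    agree-on-basis : ∀ {g g'} → (∀ i → g ∙ lookup T i ≡ g' ∙ lookup T i) → Agree A₀ g g'
    agree-on-basis {g} {g'} eq a a∈ = agree-span {f = g} {g'} (AllV.lookup⁻ eq) (T-spans a a∈)

    Occurs : Vec Bool d → Set
    Occurs y = Any (λ g → pattern-of g ≡ y) fl

    occurs? : ∀ y → Dec (Occurs y)
    occurs? y = any? (λ g → Vec.≡-dec Bool._≟_ (pattern-of g) y) fl

    P : Vec Bool d → Bool
    P y = does (occurs? y)

    K≤count : K ≤ count d P
    K≤count = code-bound d P pattern-of F.distinct (λ g g∈ → dec-true (occurs? (pattern-of g)) (lose g∈ refl))
      λ {g} {g'} g∈ g'∈ ¬agree eq → facets-injective g∈ g'∈ ¬agree (agree-on-basis λ i →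
        trans (pattern-at (F.bin g g∈) i) (trans (cong (λ y → ⟦ lookup y i ⟧) eq) (sym (pattern-at (F.bin g' g'∈) i))))

    Square : Fin d → Vec Bool d → Set
    Square i y = (Occurs y × Occurs (Vec.map not y)) × (Occurs (flip i y) × Occurs (Vec.map not (flip i y)))

    -- More than three quarters of all patterns occur, so some square of the involutions flip i and not is complete.
    square : ∀ i → Σ (Vec Bool d) (Square i)
    square i = by-search (any? square? (all-codes d))
      where
      square? : ∀ y → Dec (Square i y)
      square? y = (occurs? y ×-dec occurs? (Vec.map not y)) ×-dec (occurs? (flip i y) ×-dec occurs? (Vec.map not (flip i y)))
      sum4 : ∀ x → (x + x) + (x + x) ≡ 4 * x
      sum4 = ℕSolver.solve-∀
      four : (count d P + count d (P ∘ Vec.map not)) + (count d (P ∘ flip i) + count d (P ∘ Vec.map not ∘ flip i)) ≡ 4 * count d P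
      four = trans (cong₂ _+_ (cong (count d P +_) (count-not d P)) (cong₂ _+_ (count-flip d i P)
        (trans (count-flip d i (P ∘ Vec.map not)) (count-not d P)))) (sum4 (count d P))
      by-search : Dec (Any (Square i) (all-codes d)) → Σ (Vec Bool d) (Square i)
      by-search (yes found) = let y , _ , sq = find found in y , sq
      by-search (no none) = ⊥-elim (dense (ℕ.≤-trans (ℕ.*-monoʳ-≤ 4 K≤count) (subst (_≤ 3 * 2 ^ d) four
        (count-four d P (P ∘ Vec.map not) (P ∘ flip i) (P ∘ Vec.map not ∘ flip i) λ y p q r s → none (lose (∈-codes d (λ _ → true) y refl)
          ((does-true (occurs? y) p , does-true (occurs? (Vec.map not y)) q) ,
           (does-true (occurs? (flip i y)) r , does-true (occurs? (Vec.map not (flip i y))) s)))))))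

    Centred-with : Vec Bool d → Set
    Centred-with y = Σ (Vec ℚ M) λ g → Bin A g × pattern-of g ≡ y × g ∙ m ≡ 1ℚ

    paired : ∀ {y} → Occurs y → Occurs (Vec.map not y) → Centred-with y
    paired {y} occ occ' = make (find occ) (find occ')
      where
      make : Σ (Vec ℚ M) (λ g → g ∈ fl × pattern-of g ≡ y) → Σ (Vec ℚ M) (λ g → g ∈ fl × pattern-of g ≡ Vec.map not y) → Centred-with y
      make (g , g∈ , gy) (g' , g'∈ , g'y) = g , F.bin g g∈ , gy ,
          paired-centred (F.bin g g∈) (F.facet g g∈) (F.bin g' g'∈) (F.facet g' g'∈) (agree-on-basis λ i →
            trans (pattern-at (F.bin g' g'∈) i) (trans (cong (λ y → ⟦ lookup y i ⟧) g'y) (trans (cong ⟦_⟧ (Vec.lookup-map i not y))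
              (trans (not-value (lookup y i)) (sym (opp-value (hom _ (T∈A i)) (trans (pattern-at (F.bin g g∈) i) (cong (λ y → ⟦ lookup y i ⟧) gy))))))))
        where
        not-value : ∀ b → ⟦ not b ⟧ ≡ 1ℚ +ℚ -ℚ ⟦ b ⟧
        not-value true = refl
        not-value false = refl

    -- The functional dual to the i-th vertex of `A₀`, obtained as the difference of two centred
    -- two-valued functionals: hence integral on `A` and zero at `m`.
    record Step (i : Fin d) : Set where
      field
        δ : Vec ℚ M
        δ-T : ∀ j → δ ∙ lookup T j ≡ (if does (j Fin.≟ i) then 1ℚ else 0ℚ)
        δ-m : δ ∙ m ≡ 0ℚ
        δ-integral : ∀ a → a ∈ A → Integral (δ ∙ a)

    step : ∀ i → Step i
    step i = from-square (square i)
      where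
      difference : ∀ {y y'} → lookup y i ≡ true → lookup y' i ≡ false → (∀ j → j ≢ i → lookup y j ≡ lookup y' j) →
        Centred-with y → Centred-with y' → Step i
      difference {y} {y'} yi yi' off (g , gbin , gy , gm) (g' , gbin' , gy' , gm') = record
        { δ = δ
        ; δ-T = λ j → trans (value (at gbin gy j) (at gbin' gy' j)) (by-index j (j Fin.≟ i))
        ; δ-m = trans (value gm gm') refl
        ; δ-integral = λ a a∈ → subst Integral (sym (∙-linˡ g (-ℚ 1ℚ) g' a))
            (integral-+ {g ∙ a} {(-ℚ 1ℚ) *ℚ g' ∙ a} (integral-bit (gbin a a∈)) (integral-neg (integral-bit (gbin' a a∈)))) }
        where
        δ : Vec ℚ M
        δ = g ⊕ (-ℚ 1ℚ) • g'
        value : ∀ {a u v} → g ∙ a ≡ u → g' ∙ a ≡ v → δ ∙ a ≡ u +ℚ (-ℚ 1ℚ) *ℚ v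
        value {a} refl refl = ∙-linˡ g (-ℚ 1ℚ) g' a
        at : ∀ {g y} → Bin A g → pattern-of g ≡ y → ∀ j → g ∙ lookup T j ≡ ⟦ lookup y j ⟧
        at gbin refl j = pattern-at gbin j
        cancel : ∀ x → x +ℚ (-ℚ 1ℚ) *ℚ x ≡ 0ℚ
        cancel = solve-∀ ℚ-ring
        by-index : ∀ j (e : Dec (j ≡ i)) → ⟦ lookup y j ⟧ +ℚ (-ℚ 1ℚ) *ℚ ⟦ lookup y' j ⟧ ≡ (if does e then 1ℚ else 0ℚ)
        by-index j (yes refl) = cong₂ (λ a b → ⟦ a ⟧ +ℚ (-ℚ 1ℚ) *ℚ ⟦ b ⟧) yi yi'
        by-index j (no j≢i) = trans (cong (λ b → ⟦ b ⟧ +ℚ (-ℚ 1ℚ) *ℚ ⟦ lookup y' j ⟧) (off j j≢i)) (cancel ⟦ lookup y' j ⟧)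
      flipped : ∀ y → lookup (flip i y) i ≡ not (lookup y i)
      flipped y = Vec.lookup∘updateAt i y
      unflipped : ∀ y j → j ≢ i → lookup (flip i y) j ≡ lookup y j
      unflipped y j j≢i = Vec.lookup∘updateAt′ j i j≢i y
      from-square : Σ (Vec Bool d) (Square i) → Step i
      from-square (y , (o₁ , o₂) , (o₃ , o₄)) = by-bit (lookup y i) refl
        where
        by-bit : ∀ b → lookup y i ≡ b → Step i
        by-bit true yi = difference yi (trans (flipped y) (cong not yi)) (λ j j≢i → sym (unflipped y j j≢i)) (paired o₁ o₂) (paired o₃ o₄)
        by-bit false yi = difference (trans (flipped y) (cong not yi)) yi (unflipped y) (paired o₃ o₄) (paired o₁ o₂)

    -- Modulo f, every facet functional is an integral combination of steps, hence integral at m.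
    centred : ∀ g → Bin A g → Facet A g → g ∙ m ≡ 1ℚ
    centred g gbin gfacet = half⇒centred gbin (integral-unit (suc e) o integral-κ product o≥1 (nonzeros≤ gfacet))
      where
      o = length (NonZeros A g)
      coefficients : Vec ℚ d
      coefficients = values g T
      steps : Vec (Vec ℚ M) d
      steps = Vec.tabulate λ i → Step.δ (step i)
      combination : Vec ℚ M
      combination = comb coefficients steps
      combination-value : ∀ x → combination ∙ x ≡ coefficients ∙ Vec.tabulate λ i → Step.δ (step i) ∙ x
      combination-value x = trans (∙-combˡ coefficients steps x) (cong (coefficients ∙_) (sym (Vec.tabulate-∘ (_∙ x) (λ i → Step.δ (step i)))))
      on-T : ∀ j → combination ∙ lookup T j ≡ g ∙ lookup T j
      on-T j = trans (combination-value (lookup T j)) (trans (cong (coefficients ∙_) (Vec.tabulate-cong λ i → Step.δ-T (step i) j))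
        (trans (∙-unit coefficients j) (Vec.lookup-map j (g ∙_) T)))
      at-m : combination ∙ m ≡ 0ℚ
      at-m = trans (combination-value m) (trans (cong (coefficients ∙_) (Vec.tabulate-cong λ i → Step.δ-m (step i)))
        (trans (cong (coefficients ∙_) (zeros d)) (∙-zeroʳ coefficients)))
        where
        zeros : ∀ k → Vec.tabulate {n = k} (λ _ → 0ℚ) ≡ 0v
        zeros zero = refl
        zeros (suc k) = cong (0ℚ ∷_) (zeros k)
      -- `rest` vanishes on `A₀`, so it is `κ` times `f`. At `m` this gives `g ∙ m ≡ κ`, because the
      -- steps vanish there and `f` is 1; at a point `z` of `A₁` it shows that `κ` is an integer.
      rest : Vec ℚ M
      rest = g ⊕ (-ℚ 1ℚ) • combination
      cancel : ∀ x → x +ℚ (-ℚ 1ℚ) *ℚ x ≡ 0ℚ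
      cancel = solve-∀ ℚ-ring
      rest-A₀ : ∀ a → a ∈ A₀ → rest ∙ a ≡ 0ℚ
      rest-A₀ a a∈ = trans (∙-linˡ g (-ℚ 1ℚ) combination a) (trans (cong (λ u → g ∙ a +ℚ (-ℚ 1ℚ) *ℚ u) (agree-on-basis on-T a a∈)) (cancel (g ∙ a)))
      multiple = facet-determined facet rest rest-A₀
      κ : ℚ
      κ = proj₁ multiple
      rest≡ : Agree A rest (κ • f)
      rest≡ a a∈ = trans (proj₂ multiple a a∈) (sym (∙-scaleˡ κ f a))
      f-m : f ∙ m ≡ 1ℚ
      f-m = half⇒centred fbin q≡d
      g-m : g ∙ m ≡ κ
      g-m = trans (sym (lemma (g ∙ m))) (trans (cong (λ u → g ∙ m +ℚ (-ℚ 1ℚ) *ℚ u) (sym at-m)) (trans (sym (∙-linˡ g (-ℚ 1ℚ) combination m))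
        (trans (agree-inspan rest≡ m-inspan) (trans (∙-scaleˡ κ f m) (trans (cong (κ *ℚ_) f-m) (ℚ.*-identityʳ κ))))))
        where
        lemma : ∀ x → x +ℚ (-ℚ 1ℚ) *ℚ 0ℚ ≡ x
        lemma = solve-∀ ℚ-ring
      κ-z : rest ∙ z ≡ κ
      κ-z = trans (rest≡ z (A₁⊆ z z∈)) (trans (∙-scaleˡ κ f z) (trans (cong (κ *ℚ_) (on-A₁ z z∈)) (ℚ.*-identityʳ κ)))
      integral-κ : Integral κ
      integral-κ = subst Integral κ-z (subst Integral (sym (∙-linˡ g (-ℚ 1ℚ) combination z))
        (integral-+ {g ∙ z} {(-ℚ 1ℚ) *ℚ combination ∙ z} (integral-bit (gbin z (A₁⊆ z z∈))) (integral-neg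
          (subst Integral (sym (combination-value z)) (integral-∙ {c = coefficients} bits
            (AllV.tabulate⁺ λ i → Step.δ-integral (step i) z (A₁⊆ z z∈)))))))
        where
        bits : Bits coefficients
        bits = AllV.map⁺ (AllV.map (λ {t} t∈ → gbin t (A₀⊆ t t∈)) T⊆)
      product : κ *ℚ ι d ≡ ι o
      product = trans (cong (_*ℚ ι d) (trans (sym g-m) (trans (m-value g) (cong (proj₁ scale *ℚ_) (total-value gbin)))))
        (trans (lemma (proj₁ scale) (ι o) (ι d)) (trans (cong (_*ℚ ι o) (proj₂ scale)) (ℚ.*-identityˡ _)))
        where
        lemma : ∀ r x y → (r *ℚ x) *ℚ y ≡ (r *ℚ y) *ℚ x
        lemma = solve-∀ ℚ-ring
      o≥1 : 1 ≤ o
      o≥1 = nonempty (∈-nonzeros⁺ (proj₁ (proj₂ (proj₁ gfacet))) (proj₂ (proj₂ (proj₁ gfacet))))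
        where
        nonempty : ∀ {x} {xs : List (Vec ℚ M)} → x ∈ xs → 1 ≤ length xs
        nonempty (here _) = s≤s z≤n
        nonempty (there _) = s≤s z≤n

    open Centred {m = m} hom tl rk m-inspan h-m centred

    cross : Cross h A d
    cross = record
      { axes = T
      ; double-centre = m
      ; double-centre-h = h-m
      ; axes-ind = (λ s → 1≢0ℚ (trans (sym (centred f fbin facet)) (kills-span (AllV.map (λ {t} t∈ → on-A₀ t t∈) T⊆) s))) , T-ind
      ; axes∈ = T∈A
      ; opposite∈ = λ i → proj₁ (∈-zeros⁻ {A = A} {opp h f} (opposite∈ (opp-bin hom fbin) facet'
          (ℕ.≤-trans (unique-⊆ (AllPairs.filter⁺ (zero? (opp h f)) uniq) opp⇒A₁) (ℕ.≤-reflexive q≡d)) (T∈A i) (opp-A₀ _ (T∈ i))))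
      ; covers = side (λ a a∈ → let i , e = basis-covers rank₀ p≤d a a∈ in i , inj₁ e)
          λ a a∈ → let i , e = basis-covers rank₀ p≤d (opposite a) (opposite∈ fbin facet p≤d (A₁⊆ a a∈) (on-A₁ a a∈))
                   in i , inj₂ (trans (involution a) (cong opposite e)) }
      where
      involution : ∀ a → a ≡ opposite (opposite a)
      involution a = ext∙ λ g → sym (trans (opposite-value {g} {opposite a} refl (opposite-value {g} {a} refl refl)) (lemma (g ∙ m) (g ∙ a)))
        where
        lemma : ∀ x y → x +ℚ -ℚ (x +ℚ -ℚ y) ≡ y
        lemma = solve-∀ ℚ-ring

  parallel : ¬ Cube h A d → ¬ Cross h A d → Goal
  parallel ¬cube ¬cross = by-size (size-bound (suc e) hom₀ uniq₀ tl₀ rank₀ (proj₂ sys₀))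
    where
    by-size : Bound p U d → Goal
    by-size (inj₂ (inj₂ small)) = small-product small
    by-size (inj₂ (inj₁ few)) = ⊥-elim (¬cube (few-functionals-cube few))
    by-size (inj₁ p≤d) = by-density (4 * K ℕ.≤? 3 * 2 ^ d)
      where
      by-density : Dec (4 * K ≤ 3 * 2 ^ d) → Goal
      by-density (yes few) = few-facets p≤d few
      by-density (no dense) = ⊥-elim (¬cross (Simplices.cross p≤d dense))

-- The product of vertices and facets

module _ {M : ℕ} {h : Vec ℚ M} {A fl : List (Vec ℚ M)} {e : ℕ}
  (hom : Homogeneous h A) (uniq : Unique A) (tl : TL A) (rk : Rank A (suc (suc (suc e)))) (facets : Facets A fl)
  (¬cube : ¬ Cube h A (suc (suc e))) (¬cross : ¬ Cross h A (suc (suc e))) where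

  private
    module F = Facets facets

    d n K : ℕ
    d = suc (suc e)
    n = length A
    K = length fl

    Goal : Set
    Goal = n * K ≤ suc e * (2 ^ suc d + 8)

    opp-opp : ∀ f → Agree A f (opp h (opp h f))
    opp-opp f a a∈ = trans (lemma (f ∙ a)) (sym (opp-value (hom a a∈) (opp-value {f = f} (hom a a∈) refl)))
      where
      lemma : ∀ x → x ≡ 1ℚ +ℚ -ℚ (1ℚ +ℚ -ℚ x)
      lemma = solve-∀ ℚ-ring

    with-parallel : ∀ f → Bin A f → Facet A f → Facet A (opp h f) → Goal
    with-parallel f fbin facet facet' = by-size (ℕ.≤-total (length (NonZeros A f)) (length (Zeros A f)))
      where
      by-size : length (NonZeros A f) ≤ length (Zeros A f) ⊎ length (Zeros A f) ≤ length (NonZeros A f) → Goal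
      by-size (inj₁ le) = Parallel.parallel hom uniq tl rk facets fbin facet facet' le ¬cube ¬cross
      by-size (inj₂ ge) = Parallel.parallel hom uniq tl rk facets (opp-bin hom fbin) facet' (facet-cong (opp-opp f) facet)
        (ℕ.≤-trans (unique-⊆ (AllPairs.filter⁺ (¬? ∘ zero? (opp h f)) uniq) to-zeros) (ℕ.≤-trans ge
          (unique-⊆ (AllPairs.filter⁺ (¬? ∘ zero? f) uniq) to-opp))) ¬cube ¬cross
        where
        to-zeros : ∀ a → a ∈ NonZeros A (opp h f) → a ∈ Zeros A f
        to-zeros a a∈ = let a∈A , ≢0 = ∈-nonzeros⁻ {A = A} {opp h f} a∈ in ∈-zeros⁺ a∈A (case fbin a a∈A of λ where
          (inj₁ fa) → fa
          (inj₂ fa) → ⊥-elim (≢0 (opp-value (hom a a∈A) fa)))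
        to-opp : ∀ a → a ∈ NonZeros A f → a ∈ Zeros A (opp h f)
        to-opp a a∈ = let a∈A , ≢0 = ∈-nonzeros⁻ {A = A} {f} a∈ in ∈-zeros⁺ a∈A (opp-value (hom a a∈A) (bin-nonzero fbin a∈A ≢0))

    without-parallel : (∀ f → Bin A f → Facet A f → ¬ Facet A (opp h f)) → Goal
    without-parallel none = ℕ.*-cancelˡ-≤ 2 (ℕ.≤-trans (ℕ.≤-reflexive (regroup n K)) (ℕ.≤-trans (ℕ.*-monoʳ-≤ n 2K≤L)
        (ℕ.≤-trans (product-bound hom uniq tl rk (proj₂ sysA)) (numeric e))))
      where
      sysA : Σ (List (Vec ℚ M)) (Sys A)
      sysA = sys-exists A
      regroup : ∀ n k → 2 * (n * k) ≡ n * (2 * k)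
      regroup = ℕSolver.solve-∀
      doubled : List (Vec ℚ M)
      doubled = fl ++ List.map (opp h) fl
      opp-injective : ∀ {f g} → Agree A (opp h f) (opp h g) → Agree A f g
      opp-injective {f} {g} agree a a∈ = trans (opp-opp f a a∈) (trans (opp-value (hom a a∈) (agree a a∈))
        (trans (sym (opp-value (hom a a∈) refl)) (sym (opp-opp g a a∈))))
      doubled-distinct : AllPairs (λ f g → ¬ Agree A f g) doubled
      doubled-distinct = AllPairs.++⁺ F.distinct (AllPairs.map⁺ (AllPairs.map (_∘ opp-injective) F.distinct))
        -- If a facet functional agreed with the complement of a second one, that complement would
        -- define a facet parallel to the second.
        (All.tabulate λ {f} f∈ → All.map⁺ (All.tabulate λ {g} g∈ agree → none g (F.bin g g∈) (F.facet g g∈) (facet-cong agree (F.facet f f∈))))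
      doubled-bin : ∀ f → f ∈ doubled → Bin A f
      doubled-bin f f∈ with ∈-++⁻ fl f∈
      ... | inj₁ p = F.bin f p
      ... | inj₂ p with ∈-map⁻ (opp h) p
      ...   | g , g∈ , refl = opp-bin hom (F.bin g g∈)
      2K≤L : 2 * K ≤ length (proj₁ sysA)
      2K≤L = subst (_≤ length (proj₁ sysA)) (trans (List.length-++ fl) (cong (K +_) (trans (List.length-map (opp h) fl) (sym (ℕ.+-identityʳ K)))))
        (pigeonhole {R = Agree A} doubled-distinct (λ f f∈ → Sys.complete (proj₂ sysA) f (doubled-bin f f∈))
          λ _ _ ¬agree p q → ¬agree λ a a∈ → trans (p a a∈) (sym (q a a∈)))
      numeric : ∀ e → (3 + e) * 2 ^ (3 + e) ≤ 2 * (suc e * (2 ^ (3 + e) + 8))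
      numeric zero = ℕ.m≤m+n 24 8
      numeric (suc e) = subst ((4 + e) * X ≤_) (lemma e X) (ℕ.m≤m+n _ _)
        where
        X = 2 ^ (4 + e)
        lemma : ∀ e X → (4 + e) * X + (e * X + 16 * (2 + e)) ≡ 2 * ((2 + e) * (X + 8))
        lemma = ℕSolver.solve-∀

  -- Existence of two parallel facets is not decided. The inequality is decidable, so it is enough
  -- to refute its failure, which excludes every parallel pair.
  facet-count : Goal
  facet-count = decidable-stable (n * K ℕ.≤? suc e * (2 ^ suc d + 8)) λ ¬goal →
    ¬goal (without-parallel λ f fbin facet facet' → ¬goal (with-parallel f fbin facet facet'))

-- Homogenisation

∑-cong : ∀ {n} {f g : Fin n → ℚ} → (∀ i → f i ≡ g i) → ∑ f ≡ ∑ g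
∑-cong {zero} _ = refl
∑-cong {suc n} eq = cong₂ _+ℚ_ (eq zero) (∑-cong (eq ∘ suc))

∑-neg : ∀ {n} (f : Fin n → ℚ) → ∑ (λ i → -ℚ f i) ≡ -ℚ ∑ f
∑-neg {zero} f = refl
∑-neg {suc n} f = trans (cong (-ℚ f zero +ℚ_) (∑-neg (f ∘ suc))) (sym (ℚ.neg-distrib-+ (f zero) _))

∙-∑ : ∀ {n} (x y : Vec ℚ n) → x ∙ y ≡ ∑ (λ i → lookup x i *ℚ lookup y i)
∙-∑ [] [] = ∙-zeroʳ []
∙-∑ (x ∷ xs) (y ∷ ys) = trans (∙-∷ x xs y ys) (cong (x *ℚ y +ℚ_) (∙-∑ xs ys))

opaque
  unfolding _⊕_

  lookup-⊕ : ∀ {M} (x : Vec ℚ M) c y j → lookup (x ⊕ c • y) j ≡ lookup x j +ℚ c *ℚ lookup y j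
  lookup-⊕ x c y j = trans (Vec.lookup-zipWith _+ℚ_ j x (c • y)) (cong (lookup x j +ℚ_) (Vec.lookup-map j (c *ℚ_) y))

lookup-0v : ∀ {M} j → lookup (0v {M}) j ≡ 0ℚ
lookup-0v j = Vec.lookup-replicate j 0ℚ

lookup-comb : ∀ {M k} (c : Vec ℚ k) (T : Vec (Vec ℚ M) k) j → lookup (comb c T) j ≡ ∑ (λ i → lookup c i *ℚ lookup (lookup T i) j)
lookup-comb [] [] j = lookup-0v j
lookup-comb (c ∷ cs) (t ∷ T) j = trans (lookup-⊕ (comb cs T) c t j) (trans (ℚ.+-comm (lookup (comb cs T) j) (c *ℚ lookup t j))
  (cong (c *ℚ lookup t j +ℚ_) (lookup-comb cs T j)))

lookup-ext : ∀ {n} {x y : Vec ℚ n} → (∀ j → lookup x j ≡ lookup y j) → x ≡ y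
lookup-ext {x = x} {y} eq = trans (sym (Vec.tabulate∘lookup x)) (trans (Vec.tabulate-cong eq) (Vec.tabulate∘lookup y))

comb-ind : ∀ {M k} (T : Vec (Vec ℚ M) k) → (∀ c → comb c T ≡ 0v → c ≡ 0v) → Ind T
comb-ind [] _ = tt
comb-ind (t ∷ T) indep = not-in-span , comb-ind T λ c eq → Vec.∷-injectiveʳ (indep (0ℚ ∷ c) (ext∙ λ f →
    trans (∙-linʳ f (comb c T) 0ℚ t) (trans (lemma₀ (f ∙ comb c T) (f ∙ t)) (cong (f ∙_) eq))))
  where
  lemma₀ : ∀ x y → x +ℚ 0ℚ *ℚ y ≡ x
  lemma₀ = solve-∀ ℚ-ring
  lemma₁ : ∀ x → x +ℚ (-ℚ 1ℚ) *ℚ x ≡ 0ℚ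
  lemma₁ = solve-∀ ℚ-ring
  not-in-span : ¬ Span T t
  not-in-span (c , eq) = case Vec.∷-injectiveˡ (indep (-ℚ 1ℚ ∷ c) (ext∙ λ f → trans (∙-linʳ f (comb c T) (-ℚ 1ℚ) t)
    (trans (cong (λ u → f ∙ u +ℚ (-ℚ 1ℚ) *ℚ f ∙ t) eq) (trans (lemma₁ (f ∙ t)) (sym (∙-zeroʳ f)))))) of λ ()

homogenise : ∀ {d} → Point d → Vec ℚ (suc d)
homogenise x = 1ℚ ∷ Vec.tabulate x

height : ∀ {d} → Vec ℚ (suc d)
height = 1ℚ ∷ 0v

height-value : ∀ {d} (x : Vec ℚ (suc d)) → height ∙ x ≡ lookup x zero
height-value (x ∷ xs) = trans (∙-∷ 1ℚ 0v x xs) (trans (cong (1ℚ *ℚ x +ℚ_) (∙-zeroˡ xs)) (lemma x))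
  where
  lemma : ∀ x → 1ℚ *ℚ x +ℚ 0ℚ ≡ x
  lemma = solve-∀ ℚ-ring

homogenise-value : ∀ {d} b (as : Vec ℚ d) x → (b ∷ as) ∙ homogenise x ≡ b +ℚ ∑ (λ j → lookup as j *ℚ x j)
homogenise-value b as x = trans (∙-∷ b as 1ℚ (Vec.tabulate x)) (cong₂ _+ℚ_ (ℚ.*-identityʳ b)
  (trans (∙-∑ as (Vec.tabulate x)) (∑-cong λ j → cong (lookup as j *ℚ_) (Vec.lookup∘tabulate x j))))

-- The functional b - a · x.
slackness : ∀ {d} → Point d → ℚ → Vec ℚ (suc d)
slackness a b = b ∷ Vec.tabulate (λ j → -ℚ a j)

slackness-value : ∀ {d} (a : Point d) b x → slackness a b ∙ homogenise x ≡ b +ℚ -ℚ (a · x)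
slackness-value a b x = trans (homogenise-value b (Vec.tabulate (λ j → -ℚ a j)) x) (cong (b +ℚ_) (trans (∑-cong λ j →
    trans (cong (_*ℚ x j) (Vec.lookup∘tabulate (λ j → -ℚ a j) j)) (sym (ℚ.neg-distribˡ-* (a j) (x j)))) (∑-neg (λ j → a j *ℚ x j))))

affine⇒ind : ∀ {m d} (W : Fin m → Point d) → AffinelyIndependent W → Ind (Vec.tabulate (homogenise ∘ W))
affine⇒ind W indep = comb-ind T λ c eq → lookup-ext λ i → trans (indep (lookup c) (sum-zero c eq) (lincomb-zero c eq) i) (sym (lookup-0v i))
  where
  T = Vec.tabulate (homogenise ∘ W)
  coordinate : ∀ c j → lookup (comb c T) j ≡ ∑ (λ i → lookup c i *ℚ lookup (homogenise (W i)) j)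
  coordinate c j = trans (lookup-comb c T j) (∑-cong λ i → cong (λ t → lookup c i *ℚ lookup t j) (Vec.lookup∘tabulate (homogenise ∘ W) i))
  vanish : ∀ c → comb c T ≡ 0v → ∀ j → ∑ (λ i → lookup c i *ℚ lookup (homogenise (W i)) j) ≡ 0ℚ
  vanish c eq j = trans (sym (coordinate c j)) (trans (cong (λ v → lookup v j) eq) (lookup-0v j))
  sum-zero : ∀ c → comb c T ≡ 0v → ∑ (lookup c) ≡ 0ℚ
  sum-zero c eq = trans (∑-cong λ i → sym (ℚ.*-identityʳ (lookup c i))) (vanish c eq zero)
  lincomb-zero : ∀ c → comb c T ≡ 0v → ∀ j → lincomb (lookup c) W j ≡ 0ℚ
  lincomb-zero c eq j = trans (∑-cong λ i → cong (lookup c i *ℚ_) (sym (Vec.lookup∘tabulate (W i) j))) (vanish c eq (suc j))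

ind⇒affine : ∀ {m d} (W : Fin m → Point d) → Ind (Vec.tabulate (homogenise ∘ W)) → AffinelyIndependent W
ind⇒affine W ind c sum-zero lincomb-zero i = trans (sym (Vec.lookup∘tabulate c i))
    (trans (cong (λ v → lookup v i) (ind-comb ind (Vec.tabulate c) (lookup-ext λ j → trans (coordinate j) (trans (vanish j) (sym (lookup-0v j)))))) (lookup-0v i))
  where
  T = Vec.tabulate (homogenise ∘ W)
  coordinate : ∀ j → lookup (comb (Vec.tabulate c) T) j ≡ ∑ (λ i → c i *ℚ lookup (homogenise (W i)) j)
  coordinate j = trans (lookup-comb (Vec.tabulate c) T j) (∑-cong λ i → cong₂ (λ u t → u *ℚ lookup t j)
    (Vec.lookup∘tabulate c i) (Vec.lookup∘tabulate (homogenise ∘ W) i))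
  vanish : ∀ j → ∑ (λ i → c i *ℚ lookup (homogenise (W i)) j) ≡ 0ℚ
  vanish zero = trans (∑-cong λ i → ℚ.*-identityʳ (c i)) sum-zero
  vanish (suc j) = trans (∑-cong λ i → cong (c i *ℚ_) (Vec.lookup∘tabulate (W i) j)) (lincomb-zero j)

-- Functionals y dual to directions w at height 0 are the rows of an invertible matrix, with the w as columns of the inverse.
module Coordinatisation {d : ℕ} (y w : Fin d → Vec ℚ (suc d)) (w-height : ∀ k → height ∙ w k ≡ 0ℚ)
  (dual : ∀ i k → y i ∙ w k ≡ (if does (i Fin.≟ k) then 1ℚ else 0ℚ)) where

  matrix : Matrix d
  matrix i j = lookup (y i) (suc j)

  shift : Point d
  shift i = lookup (y i) zero

  affine-at : ∀ x i → affine matrix shift x i ≡ y i ∙ homogenise x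
  affine-at x i = trans (ℚ.+-comm _ (shift i)) (sym (value (y i)))
    where
    value : ∀ (u : Vec ℚ (suc d)) → u ∙ homogenise x ≡ lookup u zero +ℚ ∑ (λ j → lookup u (suc j) *ℚ x j)
    value (b ∷ as) = homogenise-value b as x

  private
    inverse-matrix : Matrix d
    inverse-matrix j k = lookup (w k) (suc j)

    columns : Vec (Vec ℚ (suc d)) d
    columns = Vec.tabulate w

    columns-height : Kills height columns
    columns-height = AllV.tabulate⁺ w-height

    rows-at-columns : ∀ i → values (y i) columns ≡ Vec.tabulate (λ k → if does (i Fin.≟ k) then 1ℚ else 0ℚ)
    rows-at-columns i = trans (sym (Vec.tabulate-∘ (y i ∙_) w)) (Vec.tabulate-cong (dual i))

    row-coefficient : ∀ i c → y i ∙ comb c columns ≡ lookup c i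
    row-coefficient i c = trans (∙-combʳ (y i) c columns) (trans (cong (c ∙_) (rows-at-columns i)) (∙-unit c i))

    columns-ind : Ind columns
    columns-ind = comb-ind columns λ c eq → lookup-ext λ i → trans (sym (row-coefficient i c)) (trans (cong (y i ∙_) eq) (trans (∙-zeroʳ (y i)) (sym (lookup-0v i))))

    -- `height` and the columns form a basis, and at height 0 the coefficient of `height` vanishes.
    -- Duality identifies the other coefficients; applied to unit vectors, this yields the left
    -- inverse.
    expansion : ∀ x → height ∙ x ≡ 0ℚ → comb (Vec.tabulate λ i → y i ∙ x) columns ≡ x
    expansion x hx = from-span (full-span {T = height ∷ columns} (height∉ , columns-ind) x)
      where
      height∉ : ¬ Span columns height
      height∉ s = 1≢0ℚ (trans (sym (height-value height)) (kills-span columns-height s))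
      from-span : Span (height ∷ columns) x → comb (Vec.tabulate λ i → y i ∙ x) columns ≡ x
      from-span ((c ∷ cs) , eq) = trans (cong (λ c → comb c columns) (lookup-ext {x = Vec.tabulate λ i → y i ∙ x} {cs} λ i → trans (Vec.lookup∘tabulate (λ i → y i ∙ x) i)
          (trans (cong (y i ∙_) (sym x≡)) (row-coefficient i cs)))) x≡
        where
        unit₁ : ∀ c → 0ℚ +ℚ c *ℚ 1ℚ ≡ c
        unit₁ = solve-∀ ℚ-ring
        unit₂ : ∀ x y → x +ℚ 0ℚ *ℚ y ≡ x
        unit₂ = solve-∀ ℚ-ring
        c≡0 : c ≡ 0ℚ
        c≡0 = trans (sym (trans (cong₂ (λ u v → u +ℚ c *ℚ v) (kills-span columns-height (cs , refl)) (height-value height)) (unit₁ c)))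
          (trans (sym (∙-linʳ height (comb cs columns) c height)) (trans (cong (height ∙_) eq) hx))
        x≡ : comb cs columns ≡ x
        x≡ = trans (ext∙ λ f → sym (trans (∙-linʳ f (comb cs columns) c height)
          (trans (cong (λ c → f ∙ comb cs columns +ℚ c *ℚ f ∙ height) c≡0) (unit₂ (f ∙ comb cs columns) (f ∙ height))))) eq

    split-∙ : ∀ (u v : Vec ℚ (suc d)) → u ∙ v ≡ lookup u zero *ℚ lookup v zero +ℚ ∑ (λ j → lookup u (suc j) *ℚ lookup v (suc j))
    split-∙ (u ∷ us) (v ∷ vs) = trans (∙-∷ u us v vs) (cong (u *ℚ v +ℚ_) (∙-∑ us vs))

    level-∙ : ∀ u v → lookup v zero ≡ 0ℚ → ∑ (λ j → lookup u (suc j) *ℚ lookup v (suc j)) ≡ u ∙ v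
    level-∙ u v v₀ = sym (trans (split-∙ u v) (trans (cong (λ z → lookup u zero *ℚ z +ℚ rest) v₀)
        (trans (cong (_+ℚ rest) (ℚ.*-zeroʳ (lookup u zero))) (ℚ.+-identityˡ rest))))
      where rest = ∑ (λ j → lookup u (suc j) *ℚ lookup v (suc j))

    unit : Fin d → Vec ℚ (suc d)
    unit k = 0ℚ ∷ Vec.tabulate (λ j → if does (k Fin.≟ j) then 1ℚ else 0ℚ)

    tail-∙-unit : ∀ (u : Vec ℚ (suc d)) k → u ∙ unit k ≡ lookup u (suc k)
    tail-∙-unit (u ∷ us) k = trans (∙-∷ u us 0ℚ _) (trans (cong₂ _+ℚ_ (ℚ.*-zeroʳ u) (∙-unit us k)) (ℚ.+-identityˡ _))

    symmetric : ∀ (i k : Fin d) → (if does (i Fin.≟ k) then 1ℚ else 0ℚ) ≡ (if does (k Fin.≟ i) then 1ℚ else 0ℚ)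
    symmetric i k = by-cases (i Fin.≟ k)
      where
      by-cases : (e : Dec (i ≡ k)) → (if does e then 1ℚ else 0ℚ) ≡ (if does (k Fin.≟ i) then 1ℚ else 0ℚ)
      by-cases (yes e) = cong (λ b → if b then 1ℚ else 0ℚ) (sym (dec-true (k Fin.≟ i) (sym e)))
      by-cases (no ne) = cong (λ b → if b then 1ℚ else 0ℚ) (sym (dec-false (k Fin.≟ i) (ne ∘ sym)))

  invertible : Invertible matrix
  invertible = inverse-matrix , right , left
    where
    right : ∀ i k → mmul matrix inverse-matrix i k ≡ idM i k
    right i k = trans (level-∙ (y i) (w k) (trans (sym (height-value (w k))) (w-height k))) (dual i k)
    left : ∀ i k → mmul inverse-matrix matrix i k ≡ idM i k
    left i k = begin
      ∑ (λ j → lookup (w j) (suc i) *ℚ lookup (y j) (suc k))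
        ≡⟨ ∑-cong (λ j → trans (ℚ.*-comm (lookup (w j) (suc i)) (lookup (y j) (suc k)))
             (cong₂ _*ℚ_ (trans (sym (tail-∙-unit (y j) k)) (sym (Vec.lookup∘tabulate (λ j → y j ∙ unit k) j))) (cong (λ u → lookup u (suc i)) (sym (Vec.lookup∘tabulate w j))))) ⟩
      ∑ (λ j → lookup (Vec.tabulate λ j → y j ∙ unit k) j *ℚ lookup (lookup columns j) (suc i))
        ≡⟨ sym (lookup-comb (Vec.tabulate λ j → y j ∙ unit k) columns (suc i)) ⟩
      lookup (comb (Vec.tabulate λ j → y j ∙ unit k) columns) (suc i)
        ≡⟨ cong (λ x → lookup x (suc i)) (expansion (unit k) (height-value (unit k))) ⟩
      lookup (unit k) (suc i)
        ≡⟨ Vec.lookup∘tabulate (λ j → if does (k Fin.≟ j) then 1ℚ else 0ℚ) i ⟩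
      (if does (k Fin.≟ i) then 1ℚ else 0ℚ)
        ≡⟨ symmetric k i ⟩
      idM i k ∎
      where open ≡-Reasoning

-- From polytopes to two-level sets

module Polytope {e n : ℕ} (V : Fin n → Point (suc (suc e))) (V-distinct : Distinct V) (V-full : FullDim V) (V-two : TwoLevel V) where

  private
    d : ℕ
    d = suc (suc e)

  vertex : Fin n → Vec ℚ (suc d)
  vertex = homogenise ∘ V

  A : List (Vec ℚ (suc d))
  A = List.tabulate vertex

  vertex∈ : ∀ i → vertex i ∈ A
  vertex∈ = ∈-tabulate⁺

  elim : ∀ {P : Vec ℚ (suc d) → Set} → (∀ i → P (vertex i)) → ∀ a → a ∈ A → P a
  elim {P} p a a∈ = let i , eq = ∈-tabulate⁻ a∈ in subst P (sym eq) (p i)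

  hom : Homogeneous height A
  hom = elim λ i → height-value (vertex i)

  vertex-injective : ∀ {i j} → vertex i ≡ vertex j → i ≡ j
  vertex-injective {i} {j} eq = V-distinct i j λ k → trans (sym (Vec.lookup∘tabulate (V i) k))
    (trans (cong (λ v → lookup v (suc k)) eq) (Vec.lookup∘tabulate (V j) k))

  uniq : Unique A
  uniq = Unique.tabulate⁺ vertex-injective

  rk : Rank A (suc d)
  rk = rank (Vec.tabulate (vertex ∘ proj₁ V-full)) (AllV.tabulate⁺ (vertex∈ ∘ proj₁ V-full)) ind (λ a _ → full-span ind a)
    where
    ind = affine⇒ind (V ∘ proj₁ V-full) (proj₂ V-full)

  -- The `d` affinely independent tight vertices are a basis of the zero set, whose rank is `d` by
  -- `facet-rank`.
  facet⇒ineq : ∀ a b → Nonneg A (slackness a b) → Facet A (slackness a b) → IsFacetIneq V a b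
  facet⇒ineq a b nonneg facet@((x , x∈ , x≢0) , _) = valid , strict , s , tight , ind⇒affine (V ∘ s) (subst Ind T≡ (Rank.basis-ind zeros-rank))
    where
    φ = slackness a b
    zeros-rank : Rank (Zeros A φ) d
    zeros-rank = facet-rank rk facet
    T : Vec (Vec ℚ (suc d)) d
    T = Rank.basis zeros-rank
    valid : ∀ i → a · V i ℚ.≤ b
    valid i = 0≤-⇒≤ (subst (0ℚ ≤ℚ_) (slackness-value a b (V i)) (nonneg (vertex i) (vertex∈ i)))
    tight-at : ∀ {i} → φ ∙ vertex i ≡ 0ℚ → a · V i ≡ b
    tight-at {i} e = trans (lemma (a · V i) b) (trans (cong (λ u → b +ℚ -ℚ u) (trans (sym (slackness-value a b (V i))) e)) (ℚ.+-identityʳ b))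
      where
      lemma : ∀ x b → x ≡ b +ℚ -ℚ (b +ℚ -ℚ x)
      lemma = solve-∀ ℚ-ring
    strict : Σ (Fin n) λ i → a · V i ℚ.< b
    strict = let i , eq = ∈-tabulate⁻ x∈ in i , below i (valid i) λ e → x≢0 (trans (cong (φ ∙_) eq)
      (trans (slackness-value a b (V i)) (trans (cong (λ u → b +ℚ -ℚ u) e) (ℚ.+-inverseʳ b))))
      where
      below : ∀ i → a · V i ℚ.≤ b → a · V i ≢ b → a · V i ℚ.< b
      below i le ne with ℚ.<-cmp (a · V i) b
      ... | tri< lt _ _ = lt
      ... | tri≈ _ eq _ = ⊥-elim (ne eq)
      ... | tri> _ _ gt = ⊥-elim (ℚ.<-irrefl refl (ℚ.<-≤-trans gt le))
    index : ∀ k → Σ (Fin n) λ i → lookup T k ≡ vertex i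
    index k = ∈-tabulate⁻ (proj₁ (∈-zeros⁻ {A = A} {φ} (AllV.lookup⁺ (Rank.basis⊆ zeros-rank) k)))
    s : Fin d → Fin n
    s k = proj₁ (index k)
    tight : ∀ k → a · V (s k) ≡ b
    tight k = tight-at (trans (cong (φ ∙_) (sym (proj₂ (index k)))) (proj₂ (∈-zeros⁻ {A = A} {φ} (AllV.lookup⁺ (Rank.basis⊆ zeros-rank) k))))
    T≡ : T ≡ Vec.tabulate (vertex ∘ s)
    T≡ = trans (sym (Vec.tabulate∘lookup T)) (Vec.tabulate-cong (proj₂ ∘ index))

  ineq⇒facet : ∀ a b → IsFacetIneq V a b → Nonneg A (slackness a b) × Facet A (slackness a b)
  ineq⇒facet a b (valid , (i , strict) , s , tight , indep) =
    elim (λ i → subst (0ℚ ≤ℚ_) (sym (slackness-value a b (V i))) (≤⇒0≤- (valid i))) ,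
    spanned-facet strict≢0 (∈⇒inspan (vertex∈ i)) (AllV.tabulate⁺ λ k → vertex∈ (s k) , zero-at k) λ x _ → full-span
      ((λ span → strict≢0 (kills-span (AllV.tabulate⁺ zero-at) span)) , affine⇒ind (V ∘ s) indep) x
    where
    zero-at : ∀ k → slackness a b ∙ vertex (s k) ≡ 0ℚ
    zero-at k = trans (slackness-value a b (V (s k))) (trans (cong (λ u → b +ℚ -ℚ u) (tight k)) (ℚ.+-inverseʳ b))
    strict≢0 : slackness a b ∙ vertex i ≢ 0ℚ
    strict≢0 e = ℚ.<-irrefl (sym (trans (lemma (a · V i) b) (trans (cong (_+ℚ a · V i) (trans (sym (slackness-value a b (V i))) e)) (ℚ.+-identityˡ _)))) strict
      where
      lemma : ∀ x b → b ≡ (b +ℚ -ℚ x) +ℚ x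
      lemma = solve-∀ ℚ-ring

  as-slackness : ∀ (φ : Vec ℚ (suc d)) → φ ≡ slackness (λ j → -ℚ lookup φ (suc j)) (lookup φ zero)
  as-slackness (b ∷ as) = cong (b ∷_) (trans (sym (Vec.tabulate∘lookup as)) (Vec.tabulate-cong λ j → lemma (lookup as j)))
    where
    lemma : ∀ x → x ≡ -ℚ (-ℚ x)
    lemma = solve-∀ ℚ-ring

  tl : TL A
  tl φ nonneg facet = subst (λ φ → Σ ℚ λ c → ∀ x → x ∈ A → φ ∙ x ≡ 0ℚ ⊎ φ ∙ x ≡ c) (sym eq)
      (b +ℚ -ℚ proj₁ two , elim λ i → level i (proj₂ two i))
    where
    a : Point d
    a j = -ℚ lookup φ (suc j)
    b = lookup φ zero
    eq = as-slackness φ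
    two = V-two a b (facet⇒ineq a b (subst (Nonneg A) eq nonneg) (subst (Facet A) eq facet))
    level : ∀ i → a · V i ≡ b ⊎ a · V i ≡ proj₁ two → slackness a b ∙ vertex i ≡ 0ℚ ⊎ slackness a b ∙ vertex i ≡ b +ℚ -ℚ proj₁ two
    level i (inj₁ e) = inj₁ (trans (slackness-value a b (V i)) (trans (cong (λ u → b +ℚ -ℚ u) e) (ℚ.+-inverseʳ b)))
    level i (inj₂ e) = inj₂ (trans (slackness-value a b (V i)) (cong (λ u → b +ℚ -ℚ u) e))

  Represents : Sub.Subset n → Vec ℚ (suc d) → Set
  Represents F f = Bin A f × Facet A f × (∀ i → (i Sub.∈ F → f ∙ vertex i ≡ 0ℚ) × (f ∙ vertex i ≡ 0ℚ → i Sub.∈ F))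

  represent : ∀ {F} → IsFacet V F → Σ (Vec ℚ (suc d)) (Represents F)
  represent {F} (a , b , ineq , tight) = make (normalise tl (proj₁ (ineq⇒facet a b ineq)) (proj₂ (ineq⇒facet a b ineq)))
    where
    make : Normalised A (slackness a b) → Σ (Vec ℚ (suc d)) (Represents F)
    make (f , fbin , facet , c , 0<c , eq) = f , fbin , facet , λ i →
      (λ i∈ → *-cancel-zero {f ∙ vertex i} {c} (trans (ℚ.*-comm (f ∙ vertex i) c) (trans (sym (eq (vertex i)))
        (trans (slackness-value a b (V i)) (trans (cong (λ u → b +ℚ -ℚ u) (Equivalence.to (tight i) i∈)) (ℚ.+-inverseʳ b))))) (0<⇒≢0 0<c)) ,
      λ fi → Equivalence.from (tight i) (trans (lemma (a · V i) b) (trans (cong (λ u → b +ℚ -ℚ u) (trans (sym (slackness-value a b (V i)))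
        (trans (eq (vertex i)) (trans (cong (c *ℚ_) fi) (ℚ.*-zeroʳ c))))) (ℚ.+-identityʳ b)))
      where
      lemma : ∀ x b → x ≡ b +ℚ -ℚ (b +ℚ -ℚ x)
      lemma = solve-∀ ℚ-ring

  represented-unique : ∀ {F F' f f'} → Represents F f → Represents F' f' → Agree A f f' → F ≡ F'
  represented-unique (_ , _ , zf) (_ , _ , zf') agree = Sub.⊆-antisym
    (λ {i} i∈ → proj₂ (zf' i) (trans (sym (agree (vertex i) (vertex∈ i))) (proj₁ (zf i) i∈)))
    (λ {i} i∈ → proj₂ (zf i) (trans (agree (vertex i) (vertex∈ i)) (proj₁ (zf' i) i∈)))

  same-zeros : ∀ {F f f'} → Represents F f → Represents F f' → Agree A f f'
  same-zeros (fbin , _ , zf) (fbin' , _ , zf') = elim λ i → values-equal (fbin _ (vertex∈ i)) (fbin' _ (vertex∈ i))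
    (λ e → proj₁ (zf' i) (proj₂ (zf i) e)) (λ e → proj₁ (zf i) (proj₂ (zf' i) e))
    where
    values-equal : ∀ {x y} → x ≡ 0ℚ ⊎ x ≡ 1ℚ → y ≡ 0ℚ ⊎ y ≡ 1ℚ → (x ≡ 0ℚ → y ≡ 0ℚ) → (y ≡ 0ℚ → x ≡ 0ℚ) → x ≡ y
    values-equal (inj₁ p) _ to _ = trans p (sym (to p))
    values-equal (inj₂ p) (inj₁ q) _ from = trans (from q) (sym q)
    values-equal (inj₂ p) (inj₂ q) _ _ = trans p (sym q)

  zero-set : Vec ℚ (suc d) → Sub.Subset n
  zero-set f = Vec.tabulate λ i → does (zero? f (vertex i))

  zero-set-represents : ∀ f → Bin A f → Facet A f → Represents (zero-set f) f
  zero-set-represents f fbin facet = fbin , facet , λ i →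
    (λ i∈ → does-true (zero? f (vertex i)) (trans (sym (Vec.lookup∘tabulate _ i)) (Vec.[]=⇒lookup i∈))) ,
    λ e → Vec.lookup⇒[]= i (zero-set f) (trans (Vec.lookup∘tabulate _ i) (dec-true (zero? f (vertex i)) e))

  zero-set-facet : ∀ f → Bin A f → Facet A f → IsFacet V (zero-set f)
  zero-set-facet f fbin facet = a , b , facet⇒ineq a b (subst (Nonneg A) eq (bin-nonneg fbin)) (subst (Facet A) eq facet) , λ i →
      mk⇔ (λ i∈ → trans (lemma (a · V i) b) (trans (cong (λ u → b +ℚ -ℚ u) (trans (sym (value i)) (proj₁ (zeros i) i∈))) (ℚ.+-identityʳ b)))
          (λ e → proj₂ (zeros i) (trans (value i) (trans (cong (λ u → b +ℚ -ℚ u) e) (ℚ.+-inverseʳ b))))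
    where
    a : Point d
    a j = -ℚ lookup f (suc j)
    b = lookup f zero
    eq = as-slackness f
    zeros = proj₂ (proj₂ (zero-set-represents f fbin facet))
    value : ∀ i → f ∙ vertex i ≡ b +ℚ -ℚ (a · V i)
    value i = trans (cong (_∙ vertex i) eq) (slackness-value a b (V i))
    lemma : ∀ x b → x ≡ b +ℚ -ℚ (b +ℚ -ℚ x)
    lemma = solve-∀ ℚ-ring

  record Represented (L : List (Sub.Subset n)) (fl : List (Vec ℚ (suc d))) : Set where
    field
      length≡ : length fl ≡ length L
      sound : ∀ f → f ∈ fl → Σ (Sub.Subset n) λ F → F ∈ L × Represents F f
      distinct : AllPairs (λ f g → ¬ Agree A f g) fl
      complete : ∀ F → F ∈ L → Σ (Vec ℚ (suc d)) λ f → f ∈ fl × Represents F f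

  represent-all : ∀ {L} → Unique L → (∀ F → F ∈ L → IsFacet V F) → Σ (List (Vec ℚ (suc d))) (Represented L)
  represent-all [] _ = [] , record { length≡ = refl ; sound = λ _ () ; distinct = [] ; complete = λ _ () }
  represent-all {F ∷ L} (F∉ ∷ uniqL) isf = cons (represent (isf F (here refl))) (represent-all uniqL (λ G → isf G ∘ there))
    where
    cons : Σ (Vec ℚ (suc d)) (Represents F) → Σ (List (Vec ℚ (suc d))) (Represented L) → Σ (List (Vec ℚ (suc d))) (Represented (F ∷ L))
    cons (f , rep) (fl , all) = f ∷ fl , record
      { length≡ = cong suc (Represented.length≡ all)
      ; sound = λ where
          _ (here refl) → F , here refl , rep
          g (there g∈) → let G , G∈ , rep' = Represented.sound all g g∈ in G , there G∈ , rep'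
      ; distinct = All.tabulate (λ {g} g∈ agree → let G , G∈ , rep' = Represented.sound all g g∈
                                                  in All.lookup F∉ G∈ (represented-unique rep rep' agree)) ∷ Represented.distinct all
      ; complete = λ where
          _ (here refl) → f , here refl , rep
          G (there G∈) → let g , g∈ , rep' = Represented.complete all G G∈ in g , there g∈ , rep' }

  facet-list : ∀ {k} → NumFacets V k → Σ (List (Vec ℚ (suc d))) λ fl → length fl ≡ k × Facets A fl
  facet-list {k} (L , uniqL , facets , len) = from-represented (represent-all uniqL λ F → Equivalence.from (facets F))
    where
    from-represented : Σ (List (Vec ℚ (suc d))) (Represented L) → Σ (List (Vec ℚ (suc d))) λ fl → length fl ≡ k × Facets A fl
    from-represented (fl , all) = fl , trans (Represented.length≡ all) len , record
      { bin = λ f f∈ → proj₁ (proj₂ (proj₂ (Represented.sound all f f∈)))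
      ; facet = λ f f∈ → proj₁ (proj₂ (proj₂ (proj₂ (Represented.sound all f f∈))))
      ; distinct = Represented.distinct all
      ; complete = λ f fbin facet →
          let g , g∈ , rep = Represented.complete all (zero-set f) (Equivalence.to (facets (zero-set f)) (zero-set-facet f fbin facet))
          in g , g∈ , same-zeros (zero-set-represents f fbin facet) rep }

  iso-cube : Cube height A d → IsoCube V
  iso-cube cube = C.matrix , C.shift , C.invertible , to-vertex , from-vertex
    where
    open Cube cube
    unit : Fin d → Vec ℚ d
    unit k = Vec.tabulate λ i → if does (i Fin.≟ k) then 1ℚ else 0ℚ
    w : Fin d → Vec ℚ (suc d)
    w k = proj₁ (realise 0ℚ (unit k))
    module C = Coordinatisation (lookup axes) w (λ k → proj₁ (proj₂ (proj₂ (realise 0ℚ (unit k)))))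
      (λ i k → trans (sym (Vec.lookup-map i (_∙ w k) axes)) (trans (cong (λ v → lookup v i) (proj₂ (proj₂ (proj₂ (realise 0ℚ (unit k))))))
        (Vec.lookup∘tabulate (λ i → if does (i Fin.≟ k) then 1ℚ else 0ℚ) i)))
    to-vertex : ∀ i → Σ (Fin d → Bool) λ b → affine C.matrix C.shift (V i) ≐ cubeVertex b
    to-vertex i = (λ j → does (lookup axes j ∙ vertex i ℚ.≟ 1ℚ)) , λ j → trans (C.affine-at (V i) j)
      (sym (bit-value (AllV.lookup⁺ axes-bin j (vertex i) (vertex∈ i))))
    from-vertex : ∀ b → Σ (Fin n) λ i → affine C.matrix C.shift (V i) ≐ cubeVertex b
    from-vertex b = let a , a∈ , eq = attained (Vec.tabulate b)
                        i , ai = ∈-tabulate⁻ a∈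
      in i , λ j → trans (C.affine-at (V i) j) (trans (cong (lookup axes j ∙_) (sym ai)) (trans (sym (Vec.lookup-map j (_∙ a) axes))
           (trans (cong (λ v → lookup v j) eq) (trans (Vec.lookup-map j ⟦_⟧ (Vec.tabulate b)) (cong ⟦_⟧ (Vec.lookup∘tabulate b j))))))

  iso-cross : Cross height A d → IsoCross V
  iso-cross cross = C.matrix , C.shift , C.invertible , to-vertex , from-vertex
    where
    open Cross cross renaming (double-centre to m)
    indicator : Fin d → Fin d → ℚ
    indicator i k = if does (i Fin.≟ k) then 1ℚ else 0ℚ
    dual : ∀ i → Σ (Vec ℚ (suc d)) λ f → values f (m ∷ axes) ≡ 0ℚ ∷ Vec.tabulate (indicator i)
    dual i = interpolate axes-ind (0ℚ ∷ Vec.tabulate (indicator i))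
    y : Fin d → Vec ℚ (suc d)
    y i = proj₁ (dual i)
    y-m : ∀ i → y i ∙ m ≡ 0ℚ
    y-m i = Vec.∷-injectiveˡ (proj₂ (dual i))
    y-axis : ∀ i k → y i ∙ lookup axes k ≡ indicator i k
    y-axis i k = trans (sym (Vec.lookup-map k (y i ∙_) axes)) (trans (cong (λ v → lookup v k) (Vec.∷-injectiveʳ (proj₂ (dual i)))) (Vec.lookup∘tabulate (indicator i) k))
    half : ℚ
    half = proj₁ (inverse (1ℚ +ℚ 1ℚ) λ ())
    w : Fin d → Vec ℚ (suc d)
    -- Half of `m` is the centre, so `w k` is the direction from the centre to the k-th axis vertex,
    -- at height 0.
    w k = lookup axes k ⊕ (-ℚ half) • m
    w-height : ∀ k → height ∙ w k ≡ 0ℚ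
    w-height k = trans (∙-linʳ height (lookup axes k) (-ℚ half) m) (trans (cong₂ (λ u v → u +ℚ (-ℚ half) *ℚ v) (hom _ (axes∈ k)) double-centre-h)
      (trans (cong (1ℚ +ℚ_) (sym (ℚ.neg-distribˡ-* half (1ℚ +ℚ 1ℚ)))) (cong (λ u → 1ℚ +ℚ -ℚ u) (proj₂ (inverse (1ℚ +ℚ 1ℚ) λ ())))))
    w-dual : ∀ i k → y i ∙ w k ≡ indicator i k
    w-dual i k = trans (∙-linʳ (y i) (lookup axes k) (-ℚ half) m) (trans (cong₂ (λ u v → u +ℚ (-ℚ half) *ℚ v) (y-axis i k) (y-m i))
      (trans (cong (indicator i k +ℚ_) (ℚ.*-zeroʳ (-ℚ half))) (ℚ.+-identityʳ _)))
    module C = Coordinatisation y w w-height w-dual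
    negated : ∀ b → (if b then 1ℚ else 0ℚ) ≡ (if b then (if true then 1ℚ else -ℚ 1ℚ) else 0ℚ)
    negated true = refl
    negated false = refl
    opposite-sign : ∀ b → 0ℚ +ℚ (-ℚ 1ℚ) *ℚ (if b then 1ℚ else 0ℚ) ≡ (if b then (if false then 1ℚ else -ℚ 1ℚ) else 0ℚ)
    opposite-sign true = refl
    opposite-sign false = refl
    at-axis : ∀ {i k} → vertex i ≡ lookup axes k → affine C.matrix C.shift (V i) ≐ crossVertex k true
    at-axis {i} {k} eq j = trans (C.affine-at (V i) j) (trans (cong (y j ∙_) eq) (trans (y-axis j k) (negated (does (j Fin.≟ k)))))
    at-opposite : ∀ {i k} → vertex i ≡ m ⊕ (-ℚ 1ℚ) • lookup axes k → affine C.matrix C.shift (V i) ≐ crossVertex k false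
    at-opposite {i} {k} eq j = trans (C.affine-at (V i) j) (trans (cong (y j ∙_) eq) (trans (∙-linʳ (y j) m (-ℚ 1ℚ) (lookup axes k))
      (trans (cong₂ (λ u v → u +ℚ (-ℚ 1ℚ) *ℚ v) (y-m j) (y-axis j k)) (opposite-sign (does (j Fin.≟ k))))))
    to-vertex : ∀ i → Σ (Fin d) λ k → Σ Bool λ s → affine C.matrix C.shift (V i) ≐ crossVertex k s
    to-vertex i = by-cover (covers (vertex i) (vertex∈ i))
      where
      by-cover : Σ (Fin d) (λ k → vertex i ≡ lookup axes k ⊎ vertex i ≡ m ⊕ (-ℚ 1ℚ) • lookup axes k) →
        Σ (Fin d) λ k → Σ Bool λ s → affine C.matrix C.shift (V i) ≐ crossVertex k s
      by-cover (k , inj₁ eq) = k , true , at-axis eq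
      by-cover (k , inj₂ eq) = k , false , at-opposite eq
    from-vertex : ∀ k s → Σ (Fin n) λ i → affine C.matrix C.shift (V i) ≐ crossVertex k s
    from-vertex k true = let i , eq = ∈-tabulate⁻ (axes∈ k) in i , at-axis (sym eq)
    from-vertex k false = let i , eq = ∈-tabulate⁻ (opposite∈ k) in i , at-opposite (sym eq)

theorem2 : (d : ℕ) → 1 < d → (n : ℕ) → (V : Fin n → Point d) →
    Distinct V → ConvexPosition V → FullDim V → TwoLevel V →
    ¬ IsoCube V → ¬ IsoCross V →
    (k : ℕ) → NumFacets V k →
    n * k ≤ (d ∸ 1) * 2 ^ (d + 1) + 8 * (d ∸ 1)
theorem2 (suc zero) (s≤s ()) n V _ _ _ _ _ _ k _
theorem2 (suc (suc e)) _ n V distinct _ full two ¬cube ¬cross k num = from-list (facet-list num)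
  where
  open Polytope V distinct full two
  from-list : Σ (List (Vec ℚ (suc (suc (suc e))))) (λ fl → length fl ≡ k × Facets A fl) →
    n * k ≤ suc e * 2 ^ (suc (suc e) + 1) + 8 * suc e
  from-list (fl , len , facets) = subst₂ _≤_ (cong₂ _*_ (List.length-tabulate vertex) len) (bound e)
      (facet-count hom uniq tl rk facets (¬cube ∘ iso-cube) (¬cross ∘ iso-cross))
    where
    expand : ∀ e X → suc e * (X + 8) ≡ suc e * X + 8 * suc e
    expand = ℕSolver.solve-∀
    bound : ∀ e → suc e * (2 ^ suc (suc (suc e)) + 8) ≡ suc e * 2 ^ (suc (suc e) + 1) + 8 * suc e
    bound e = trans (expand e (2 ^ suc (suc (suc e)))) (cong (λ m → suc e * 2 ^ m + 8 * suc e) (ℕ.+-comm 1 (suc (suc e))))
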